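{- The almost-sure reachability problem is decidable for 1-VASS-MDPs.
   Context: A VASS-MDP of dimension $d\ge 0$ is a tuple $S=\langle Q,Q_1,Q_P,T,\tau\rangle$ where $Q$ is a finite set of control states partitioned into $Q_1$ (Player 1) and $Q_P$ (probabilistic), $T\subseteq Q\times\mathbb{Z}^d\times Q$ is finite, and $\tau:T\to\mathbb{N}_{>0}$. Configurations are $\langle q,\mathbf{v}\rangle\in Q\times\mathbb{N}^d$; $t=\langle q,\mathbf{z},q'\rangle$ is enabled in $\langle q,\mathbf{v}\rangle$ if $\mathbf{v}+\mathbf{z}\in\mathbb{N}^d$ and leads to $\langle q',\mathbf{v}+\mathbf{z}\rangle$. The induced MDP $M_S=\langle C,C_1,C_P,\rightarrow,p\rangle$ has $C=Q\times\mathbb{N}^d$, $C_1=Q_1\times\mathbb{N}^d$, $C_P=Q_P\times\mathbb{N}^d$, $c\rightarrow c'$ iff $c'$ is obtained from $c$ by an enabled transition, and for $c\in C_P$, $p(c)(c')$ is the total weight of enabled transitions from $c$ leading to $c'$ divided by the total weight of transitions enabled in $c$. A 1-VASS-MDP is a VASS-MDP in which every transition $\langle q,\mathbf{z},q'\rangle$ with $q\in Q_P$ has $\mathbf{z}=\mathbf{0}$. A strategy $\sigma$ of Player 1 maps each finite play ending in a non-deadlock configuration $c\in C_1$ to a successor of $c$; an initial configuration $c$ and $\sigma$ induce a probability measure $\mathbb{P}(M_S,c,\sigma,\cdot)$ on maximal plays. $[\![\Diamond q_F]\!]$ is the set of plays visiting control state $q_F$. The almost-sure reachability problem asks, given $S$,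 an initial configuration $c_0$ and $q_F\in Q$, whether there is $\sigma$ with $\mathbb{P}(M_S,c_0,\sigma,[\![\Diamond q_F]\!])=1$. -}

module Defs where

open import Data.Nat as ℕ using (ℕ; zero; suc; _∸_; _≤?_)
open import Data.Integer as ℤ using (ℤ; +_; -[1+_])
open import Data.Rational as ℚ using (ℚ; 0ℚ; 1ℚ; _/_)
open import Data.Fin using (Fin)
open import Data.Fin.Properties using () renaming (_≟_ to _≟F_)
open import Data.Vec using (Vec; []; _∷_; replicate)
open import Data.List using (List; []; _∷_; map; mapMaybe)
open import Data.List.Membership.Propositional using (_∈_)
open import Data.List.Relation.Unary.Unique.Propositional using (Unique)
open import Data.Maybe using (Maybe; just; nothing)
open import Data.Product using (Σ; ∃; _×_; _,_; proj₁; proj₂)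
open import Relation.Nullary using (¬_; yes; no)
open import Relation.Binary.PropositionalEquality using (_≡_)

data Owner : Set where
  P1 PP : Owner

record Transition (k d : ℕ) : Set where
  field
    src        : Fin k
    upd        : Vec ℤ d
    tgt        : Fin k
    weight     : ℕ
    weight-pos : 0 ℕ.< weight
open Transition public

triple : ∀ {k d} → Transition k d → Fin k × Vec ℤ d × Fin k
triple t = src t , upd t , tgt t

-- A VASS-MDP of dimension d with control states Q = Fin k,
-- partition given by `owner`, finite set T of transitions (no duplicate
-- triples) and weight function τ (stored in each transition).
record VASSMDP (k d : ℕ) : Set where
  field
    owner  : Fin k → Owner
    trans  : List (Transition k d)
    unique : Unique (map triple trans)
open VASSMDP public

Is1VASSMDP : ∀ {k d} → VASSMDP k d → Set
Is1VASSMDP {k} {d} S =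
  ∀ t → t ∈ trans S → owner S (src t) ≡ PP → upd t ≡ replicate d (+ 0)

Config : ℕ → ℕ → Set
Config k d = Fin k × Vec ℕ d

addℤ : ℕ → ℤ → Maybe ℕ
addℤ n (+ m) = just (n ℕ.+ m)
addℤ n -[1+ m ] with suc m ≤? n
... | yes _ = just (n ∸ suc m)
... | no  _ = nothing

applyUpd : ∀ {d} → Vec ℕ d → Vec ℤ d → Maybe (Vec ℕ d)
applyUpd [] [] = just []
applyUpd (v ∷ vs) (z ∷ zs) with addℤ v z | applyUpd vs zs
... | just w  | just ws = just (w ∷ ws)
... | just _  | nothing = nothing
... | nothing | _       = nothing

fire : ∀ {k d} → Config k d → Transition k d → Maybe (Config k d)
fire (q , v) t with q ≟F src t
... | no _ = nothing
... | yes _ with applyUpd v (upd t)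
...   | nothing = nothing
...   | just v' = just (tgt t , v')

enabled : ∀ {k d} → VASSMDP k d → Config k d → List (ℕ × Config k d)
enabled S c = mapMaybe step (trans S)
  where
  step : _ → Maybe _
  step t with fire c t
  ... | nothing = nothing
  ... | just c' = just (weight t , c')

Succ : ∀ {k d} → VASSMDP k d → Config k d → Config k d → Set
Succ S c c' = Σ _ λ t → t ∈ trans S × fire c t ≡ just c'

-- A strategy of Player 1: given the finite play so far (the earlier
-- configurations, most recent first) and the current configuration c,
-- it picks a successor of c whenever c ∈ C₁ is not a deadlock.
record Strategy {k d} (S : VASSMDP k d) : Set where
  field
    choose : List (Config k d) → Config k d → Config k d
    valid  : ∀ h c → owner S (proj₁ c) ≡ P1 → ¬ (enabled S c ≡ []) →
             Succ S c (choose h c)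
open Strategy public

sumℚ : List ℚ → ℚ
sumℚ []       = 0ℚ
sumℚ (x ∷ xs) = x ℚ.+ sumℚ xs

sumℕ : ∀ {k d} → List (ℕ × Config k d) → ℕ
sumℕ [] = 0
sumℕ ((w , _) ∷ xs) = w ℕ.+ sumℕ xs

-- Probability (under σ) that the play continuing from history h and
-- current configuration c visits q_F within n further steps.
-- (Plays ending in a deadlock stop.)
reachProb : ∀ {k d} (S : VASSMDP k d) → Strategy S → Fin k → ℕ →
            List (Config k d) → Config k d → ℚ
reachProb S σ qF n h c with proj₁ c ≟F qF
... | yes _ = 1ℚ
reachProb S σ qF zero h c | no _ = 0ℚ
reachProb S σ qF (suc n) h c | no _ with enabled S c | sumℕ (enabled S c) | owner S (proj₁ c)
... | []      | _     | _  = 0ℚ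
... | _ ∷ _   | _     | P1 = reachProb S σ qF n (c ∷ h) (choose σ h c)
... | _ ∷ _   | zero  | PP = 0ℚ  -- impossible: weights are positive
... | es@(_ ∷ _) | suc W | PP =
  sumℚ (map (λ wc → ((+ proj₁ wc) / suc W) ℚ.* reachProb S σ qF n (c ∷ h) (proj₂ wc)) es)

-- P(M_S, c₀, σ, ◇q_F) = 1, i.e. sup_n P(reach q_F within n steps) = 1.
AlmostSure : ∀ {k d} (S : VASSMDP k d) → Strategy S → Config k d → Fin k → Set
AlmostSure S σ c₀ qF =
  ∀ (ε : ℚ) → 0ℚ ℚ.< ε → ∃ λ n → (1ℚ ℚ.- ε) ℚ.≤ reachProb S σ qF n [] c₀

ASReach : ∀ {k d} → VASSMDP k d → Config k d → Fin k → Set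
ASReach S c₀ qF = Σ (Strategy S) λ σ → AlmostSure S σ c₀ qF

{-# OPTIONS --safe #-}
module Submission where

-- A 1-VASS-MDP is turned into a counter game: at a probabilistic state an
-- opponent either fixes the successor, which counts as a good event, or leaves
-- the choice to Player 1. Almost-sure reachability then means that Player 1
-- forces infinitely many good events (or reaches qF) without a counter becoming
-- negative: more counter value never hurts, so by well-quasi-ordering a bound on
-- the distance to the next good event holds uniformly over the winning region,
-- and restarting after that many steps drives the failure probability to 0.
--
-- The game is decided in two steps. With unknown initial credit, winning
-- strategies against two sets of options of the opponent at a state can be
-- interleaved, so the opponent may be assumed memoryless; what is left is the
-- search for a closed walk with a good edge and nonnegative effect (by Dickson's
-- lemma every infinite play contains one), which is a question about semilinear
-- sets, solved by eliminating coordinates of a cone. A game with known values on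
-- some coordinates reduces to this one: by the argument of Valk and Jantzen there
-- is a computable threshold above which a coordinate may be forgotten, and below
-- it the value of the coordinate is stored in the state.

-- A decision needs a constructive proof, and this shapes the development. Infinite plays never
-- appear: a winning strategy is an invariant from which one more good event can be forced, where
-- forcing is inductive, and strategies are combined by combining invariants. Steps, effects and
-- credits are compared by inequalities only. As counter value may always be given up, the sets of
-- effects are downward closed, and the exact reachability problem for vector addition systems is
-- avoided. The restriction on probabilistic transitions is the source of monotonicity: if their
-- updates could be blocked, a larger vector might enable additional, harmful outcomes, and more
-- counter value could hurt.

open import Defs renaming (trans to transitions)
open import Level using (Level)
open import Function using (const; _∋_)
open import Data.Empty using (⊥; ⊥-elim)
open import Data.Unit using (⊤; tt)
open import Data.Bool using (Bool; true; false; if_then_else_; not; _∧_; T?)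
import Data.Bool.Properties as BoolP
open import Data.Nat as ℕ using (ℕ; zero; suc; z≤n; s≤s; _∸_; _⊓_)
open import Data.Nat.ListAction using (sum)
import Data.Nat.Properties as ℕP
open import Data.Integer as ℤ using (ℤ; +_; -[1+_]; +≤+; +<+; -≤+)
import Data.Integer.Properties as ℤP
open import Data.Integer.Tactic.RingSolver using (solve-∀)
open import Data.Rational as ℚ using (ℚ; 0ℚ; 1ℚ; ½; _/_)
import Data.Rational.Properties as ℚP
open import Data.Rational.Solver using (module +-*-Solver)
import Data.Rational.Unnormalised as ℚᵘ
import Data.Rational.Unnormalised.Properties as ℚᵘP
open import Data.Fin as Fin using (Fin; zero; suc)
import Data.Fin.Properties as FinP
open import Data.Maybe using (Maybe; just; nothing)
open import Data.Vec using (Vec; []; _∷_; lookup)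
open import Data.Vec.Properties using (lookup-replicate)
open import Data.Vec.Functional using (updateAt)
open import Data.Vec.Functional.Properties using (updateAt-updates; updateAt-minimal)
open import Data.List using (List; []; _∷_; _++_; map; mapMaybe; filter; foldr; length; allFin; concatMap; cartesianProductWith)
open import Data.List.Membership.Propositional using (_∈_; find; lose)
open import Data.List.Membership.Propositional.Properties
open import Data.List.Relation.Unary.All as All using (All; []; _∷_)
open import Data.List.Relation.Unary.Any as Any using (Any; here; there)
open import Data.Product using (Σ; ∃; ∃₂; _×_; _,_; proj₁; proj₂)
open import Data.Sum as Sum using (_⊎_; inj₁; inj₂)
open import Relation.Nullary using (¬_; Dec; yes; no)
open import Relation.Nullary.Decidable using (map′; _×-dec_; _⊎-dec_; _→-dec_; True; toWitness; fromWitness)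
open import Relation.Binary.PropositionalEquality using (_≡_; _≢_; refl; sym; trans; cong; cong₂; subst)

-- Almost-full relations and Dickson's lemma

-- Almost-full relations (Vytiniotis, Coquand, Wahlstedt): the constructive
-- form of "every infinite sequence has i < j with R xᵢ xⱼ".
data AF {A : Set} (R : A → A → Set) : Set where
  now   : (∀ x y → R x y) → AF R
  later : (∀ x → AF (λ y z → R y z ⊎ R x y)) → AF R

af-map : ∀ {A : Set} {R S : A → A → Set} → (∀ {x y} → R x y → S x y) → AF R → AF S
af-map f (now r)   = now λ x y → f (r x y)
af-map f (later r) = later λ x → af-map (Sum.map f f) (r x)

af-on : ∀ {A B : Set} {R : A → A → Set} (f : B → A) → AF R → AF (λ x y → R (f x) (f y))
af-on f (now r)   = now λ x y → r (f x) (f y)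
af-on f (later r) = later λ x → af-on f (r (f x))

_∧⊎_ : ∀ {C X Y : Set} → C ⊎ X → C ⊎ Y → C ⊎ (X × Y)
inj₁ c ∧⊎ _      = inj₁ c
inj₂ _ ∧⊎ inj₁ c = inj₁ c
inj₂ a ∧⊎ inj₂ b = inj₂ (a , b)

⊎-swap : ∀ {P Q T : Set} → (P ⊎ Q) ⊎ T → (P ⊎ T) ⊎ Q
⊎-swap (inj₁ (inj₁ p)) = inj₁ (inj₁ p)
⊎-swap (inj₁ (inj₂ q)) = inj₂ q
⊎-swap (inj₂ t)        = inj₁ (inj₂ t)

⊎-interchange : ∀ {P Q T U : Set} → ((P ⊎ Q) ⊎ T) ⊎ U → (P ⊎ T) ⊎ (Q ⊎ U)
⊎-interchange (inj₁ (inj₁ (inj₁ p))) = inj₁ (inj₁ p)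
⊎-interchange (inj₁ (inj₁ (inj₂ q))) = inj₂ (inj₁ q)
⊎-interchange (inj₁ (inj₂ t))        = inj₁ (inj₂ t)
⊎-interchange (inj₂ u)               = inj₂ (inj₂ u)

-- Constructive Ramsey argument in three stages: the parts `X` and `Y` to be joined depend on no,
-- one or two points of the sequence. In the upper two stages, reading a point fixes one argument;
-- two calls at the same stage, each advancing one of the trees, are then joined by the stage below.
-- `C` stores the alternatives already obtained.
af-∩₀ : ∀ {A : Set} {R S : A → A → Set} {C : A → A → Set} {X Y : Set} →
        AF R → AF S →
        (∀ {x y} → R x y → C x y ⊎ X) → (∀ {x y} → S x y → C x y ⊎ Y) →
        AF (λ x y → C x y ⊎ (X × Y))
af-∩₀ (now r) s f g = af-map (λ {x} {y} q → f (r x y) ∧⊎ g q) s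
af-∩₀ {R = R} {C = C} {X} {Y} (later r) s f g = later λ x →
  af-map reassoc (af-∩₀ {C = λ y z → C y z ⊎ C x y} (r x) s fˣ gˣ)
  where
  fˣ : ∀ {x y z} → R y z ⊎ R x y → (C y z ⊎ C x y) ⊎ X
  fˣ (inj₁ r) = Sum.map₁ inj₁ (f r)
  fˣ (inj₂ r) = Sum.map₁ inj₂ (f r)
  gˣ : ∀ {x y z} → _ → (C y z ⊎ C x y) ⊎ Y
  gˣ s = Sum.map₁ inj₁ (g s)
  reassoc : ∀ {x y z} → (C y z ⊎ C x y) ⊎ (X × Y) → (C y z ⊎ X × Y) ⊎ (C x y ⊎ X × Y)
  reassoc (inj₁ (inj₁ c)) = inj₁ (inj₁ c)
  reassoc (inj₁ (inj₂ c)) = inj₂ (inj₁ c)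
  reassoc (inj₂ p)        = inj₁ (inj₂ p)

af-∩₁ : ∀ {A : Set} {R S : A → A → Set} {C : A → A → Set} {X Y : A → Set} →
        AF R → AF S →
        (∀ {x y} → R x y → C x y ⊎ X x) → (∀ {x y} → S x y → C x y ⊎ Y x) →
        AF (λ x y → C x y ⊎ (X x × Y x))
af-∩₁ (now r) s f g = af-map (λ {x} {y} q → f (r x y) ∧⊎ g q) s
af-∩₁ (later r) (now s) f g = af-map (λ {x} {y} q → f q ∧⊎ g (s x y)) (later r)
af-∩₁ {R = R} {S} {C} {X} {Y} (later r) (later s) f g = later λ x →
  af-map ⊎-interchange
    (af-∩₀ {C = λ y z → (C y z ⊎ C x y) ⊎ (X y × Y y)}
      (af-∩₁ {C = λ y z → (C y z ⊎ C x y) ⊎ X x} (r x) (later s) fˣ (λ q → Sum.map₁ (λ c → inj₁ (inj₁ c)) (g q)))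
      (af-∩₁ {C = λ y z → (C y z ⊎ C x y) ⊎ Y x} (later r) (s x) (λ q → Sum.map₁ (λ c → inj₁ (inj₁ c)) (f q)) gˣ)
      ⊎-swap ⊎-swap)
  where
  fˣ : ∀ {x y z} → R y z ⊎ R x y → ((C y z ⊎ C x y) ⊎ X x) ⊎ X y
  fˣ (inj₁ r) = Sum.map₁ (λ c → inj₁ (inj₁ c)) (f r)
  fˣ (inj₂ r) = inj₁ (Sum.map₁ inj₂ (f r))
  gˣ : ∀ {x y z} → S y z ⊎ S x y → ((C y z ⊎ C x y) ⊎ Y x) ⊎ Y y
  gˣ (inj₁ s) = Sum.map₁ (λ c → inj₁ (inj₁ c)) (g s)
  gˣ (inj₂ s) = inj₁ (Sum.map₁ inj₂ (g s))

af-∩₂ : ∀ {A : Set} {R S : A → A → Set} {C : A → A → Set} {X Y : A → A → Set} →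
        AF R → AF S →
        (∀ {x y} → R x y → C x y ⊎ X x y) → (∀ {x y} → S x y → C x y ⊎ Y x y) →
        AF (λ x y → C x y ⊎ (X x y × Y x y))
af-∩₂ (now r) s f g = af-map (λ {x} {y} q → f (r x y) ∧⊎ g q) s
af-∩₂ (later r) (now s) f g = af-map (λ {x} {y} q → f q ∧⊎ g (s x y)) (later r)
af-∩₂ {R = R} {S} {C} {X} {Y} (later r) (later s) f g = later λ x →
  af-map ⊎-interchange
    (af-∩₁ {C = λ y z → (C y z ⊎ C x y) ⊎ (X y z × Y y z)}
      (af-∩₂ {C = λ y z → (C y z ⊎ C x y) ⊎ X x y} (r x) (later s) fˣ (λ q → Sum.map₁ (λ c → inj₁ (inj₁ c)) (g q)))
      (af-∩₂ {C = λ y z → (C y z ⊎ C x y) ⊎ Y x y} (later r) (s x) (λ q → Sum.map₁ (λ c → inj₁ (inj₁ c)) (f q)) gˣ)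
      ⊎-swap ⊎-swap)
  where
  fˣ : ∀ {x y z} → R y z ⊎ R x y → ((C y z ⊎ C x y) ⊎ X x y) ⊎ X y z
  fˣ (inj₁ r) = Sum.map₁ (λ c → inj₁ (inj₁ c)) (f r)
  fˣ (inj₂ r) = inj₁ (Sum.map₁ inj₂ (f r))
  gˣ : ∀ {x y z} → S y z ⊎ S x y → ((C y z ⊎ C x y) ⊎ Y x y) ⊎ Y y z
  gˣ (inj₁ s) = Sum.map₁ (λ c → inj₁ (inj₁ c)) (g s)
  gˣ (inj₂ s) = inj₁ (Sum.map₁ inj₂ (g s))

af-∩ : ∀ {A : Set} {R S : A → A → Set} → AF R → AF S → AF (λ x y → R x y × S x y)
af-∩ r s = af-map (λ { (inj₂ p) → p }) (af-∩₂ {C = λ _ _ → ⊥} r s inj₂ inj₂)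

af-≤ : AF ℕ._≤_
af-≤ = later below
  where
  below : ∀ n → AF (λ y z → y ℕ.≤ z ⊎ n ℕ.≤ y)
  below zero    = now λ _ _ → inj₂ z≤n
  below (suc n) = later split
    where
    split : ∀ y → AF (λ z w → (z ℕ.≤ w ⊎ suc n ℕ.≤ z) ⊎ (y ℕ.≤ z ⊎ suc n ℕ.≤ y))
    split y with suc n ℕ.≤? y
    ... | yes n<y = now λ _ _ → inj₂ (inj₂ n<y)
    ... | no  n≮y = af-map (λ { (inj₁ z≤w) → inj₁ (inj₁ z≤w)
                              ; (inj₂ n≤z) → inj₂ (inj₁ (ℕP.≤-trans (ℕP.≮⇒≥ n≮y) n≤z)) })
                           (below n)

af-pointwise : ∀ {A : Set} d {R : Fin d → A → A → Set} → (∀ i → AF (R i)) → AF (λ x y → ∀ i → R i x y)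
af-pointwise zero    r = now λ _ _ ()
af-pointwise (suc d) r =
  af-map (λ { (p , ps) zero → p ; (p , ps) (suc i) → ps i })
         (af-∩ (r zero) (af-pointwise d (λ i → r (suc i))))

-- The usual order and its reverse, realised by `k ∸ toℕ x`, are both almost full; where both hold,
-- antisymmetry gives equality.
af-Fin : ∀ k → AF {Fin k} _≡_
af-Fin k = af-map antisym (af-∩ (af-on Fin.toℕ af-≤) (af-on (λ x → k ∸ Fin.toℕ x) af-≤))
  where
  antisym : ∀ {x y : Fin k} → Fin.toℕ x ℕ.≤ Fin.toℕ y × k ∸ Fin.toℕ x ℕ.≤ k ∸ Fin.toℕ y → x ≡ y
  antisym {x} {y} (x≤y , k-x≤k-y) = FinP.toℕ-injective (ℕP.≤-antisym x≤y (ℕP.≮⇒≥ λ x<y →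
    ℕP.<⇒≱ (ℕP.∸-monoʳ-< x<y (ℕP.<⇒≤ (FinP.toℕ<n y))) k-x≤k-y))

dickson : ∀ k d → AF {Fin k × (Fin d → ℕ)} (λ (x , v) (y , w) → x ≡ y × (∀ i → v i ℕ.≤ w i))
dickson k d = af-∩ (af-on proj₁ (af-Fin k)) (af-pointwise d (λ i → af-on (λ c → proj₂ c i) af-≤))

-- Cones of integer vectors

Z : ℕ → Set
Z d = Fin d → ℤ

infix  4 _≼_
infixl 6 _⊞_
infixl 7 _⊡_

_≼_ : ∀ {d} → Z d → Z d → Set
z ≼ z′ = ∀ i → z i ℤ.≤ z′ i

_⊞_ : ∀ {d} → Z d → Z d → Z d
(z ⊞ z′) i = z i ℤ.+ z′ i

_⊡_ : ∀ {d} → ℕ → Z d → Z d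
(n ⊡ z) i = + n ℤ.* z i

𝟎 : ∀ {d} → Z d
𝟎 _ = + 0

≼-refl : ∀ {d} {z : Z d} → z ≼ z
≼-refl i = ℤP.≤-refl

≼-reflexive : ∀ {d} {z z′ : Z d} → (∀ i → z i ≡ z′ i) → z ≼ z′
≼-reflexive eq i = ℤP.≤-reflexive (eq i)

≼-trans : ∀ {d} {x y z : Z d} → x ≼ y → y ≼ z → x ≼ z
≼-trans p q i = ℤP.≤-trans (p i) (q i)

⊞-mono : ∀ {d} {x y x′ y′ : Z d} → x ≼ y → x′ ≼ y′ → x ⊞ x′ ≼ y ⊞ y′
⊞-mono p q i = ℤP.+-mono-≤ (p i) (q i)

⊞-monoʳ : ∀ {d} (z : Z d) {x y : Z d} → x ≼ y → z ⊞ x ≼ z ⊞ y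
⊞-monoʳ z = ⊞-mono {x = z} ≼-refl

⊡-mono : ∀ {d} n {x y : Z d} → x ≼ y → n ⊡ x ≼ n ⊡ y
⊡-mono n p i = ℤP.*-monoˡ-≤-nonNeg (+ n) (p i)

⊞-assoc : ∀ {d} (x y z : Z d) → (x ⊞ y) ⊞ z ≼ x ⊞ (y ⊞ z)
⊞-assoc x y z i = ℤP.≤-reflexive (ℤP.+-assoc (x i) (y i) (z i))

⊞-assoc⁻ : ∀ {d} (x y z : Z d) → x ⊞ (y ⊞ z) ≼ (x ⊞ y) ⊞ z
⊞-assoc⁻ x y z i = ℤP.≤-reflexive (sym (ℤP.+-assoc (x i) (y i) (z i)))

-- The ℕ-combinations of gs and everything pointwise below them.
data Comb {d} (gs : List (Z d)) (e : Z d) : Set where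
  none : e ≼ 𝟎 → Comb gs e
  add  : ∀ {g e′} → g ∈ gs → Comb gs e′ → e ≼ g ⊞ e′ → Comb gs e

comb-down : ∀ {d} {gs : List (Z d)} {e f} → e ≼ f → Comb gs f → Comb gs e
comb-down e≼f (none p)    = none (≼-trans e≼f p)
comb-down e≼f (add m c p) = add m c (≼-trans e≼f p)

comb-+ : ∀ {d} {gs : List (Z d)} {e f x} → Comb gs e → Comb gs f → x ≼ e ⊞ f → Comb gs x
comb-+ {e = e} {f} (none p) c q =
  comb-down (≼-trans q (≼-trans (⊞-mono p ≼-refl) (≼-reflexive (λ i → ℤP.+-identityˡ (f i))))) c
comb-+ {e = e} {f} (add {g} {e′} m c p) c′ q =
  add m (comb-+ c c′ ≼-refl) (≼-trans q (≼-trans (⊞-mono p ≼-refl) (⊞-assoc g e′ f)))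

comb-∈ : ∀ {d} {gs : List (Z d)} {g} → g ∈ gs → Comb gs g
comb-∈ {g = g} m = add m (none ≼-refl) (≼-reflexive (λ i → sym (ℤP.+-identityʳ (g i))))

comb-⊡ : ∀ {d} {gs : List (Z d)} n {e} → Comb gs e → Comb gs (n ⊡ e)
comb-⊡ zero {e} c = none (≼-reflexive (λ i → ℤP.*-zeroˡ (e i)))
comb-⊡ (suc n) {e} c = comb-+ c (comb-⊡ n c) (≼-reflexive (λ i → ℤP.suc-* (+ n) (e i)))

comb-bind : ∀ {d} {gs hs : List (Z d)} → (∀ {g} → g ∈ gs → Comb hs g) → ∀ {e} → Comb gs e → Comb hs e
comb-bind f (none p)    = none p
comb-bind f (add m c p) = comb-+ (f m) (comb-bind f c) p

comb-⊆ : ∀ {d} {gs hs : List (Z d)} → (∀ {g} → g ∈ gs → g ∈ hs) → ∀ {e} → Comb gs e → Comb hs e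
comb-⊆ f = comb-bind (λ m → comb-∈ (f m))

0≤n*z : ∀ n {z} → + 0 ℤ.≤ z → + 0 ℤ.≤ + n ℤ.* z
0≤n*z n {z} 0≤z = subst (ℤ._≤ + n ℤ.* z) (ℤP.*-zeroʳ (+ n)) (ℤP.*-monoˡ-≤-nonNeg (+ n) 0≤z)

module Eliminate {d} (i : Fin d) where

  -- The weights make the `i`-th coordinate cancel when `p i` is positive and `n i` is negative.
  pair : Z d → Z d → Z d
  pair p n = ℤ.∣ n i ∣ ⊡ p ⊞ ℤ.∣ p i ∣ ⊡ n

  -- The rays of the cone generated by gs cut with the half-space of
  -- nonnegative i-th coordinate (one step of the double description method).
  elim : List (Z d) → List (Z d)
  elim gs = filter (λ g → + 0 ℤ.≤? g i) gs
         ++ cartesianProductWith pair (filter (λ g → + 0 ℤ.<? g i) gs) (filter (λ g → g i ℤ.<? + 0) gs)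

  module _ {gs : List (Z d)} where

    elim-∈⁻ : ∀ {x} → x ∈ elim gs → (x ∈ gs × + 0 ℤ.≤ x i) ⊎
              ∃₂ λ p n → p ∈ gs × n ∈ gs × + 0 ℤ.< p i × n i ℤ.< + 0 × x ≡ pair p n
    elim-∈⁻ m with ∈-++⁻ (filter (λ g → + 0 ℤ.≤? g i) gs) m
    ... | inj₁ m₁ = inj₁ (∈-filter⁻ (λ g → + 0 ℤ.≤? g i) m₁)
    ... | inj₂ m₂ with ∈-cartesianProductWith⁻ pair (filter (λ g → + 0 ℤ.<? g i) gs) (filter (λ g → g i ℤ.<? + 0) gs) m₂
    ... | p , n , p∈ , n∈ , eq with ∈-filter⁻ (λ g → + 0 ℤ.<? g i) p∈ | ∈-filter⁻ (λ g → g i ℤ.<? + 0) n∈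
    ... | p∈gs , 0<p | n∈gs , n<0 = inj₂ (p , n , p∈gs , n∈gs , 0<p , n<0 , eq)

    elim-nonneg⁺ : ∀ {g} → g ∈ gs → + 0 ℤ.≤ g i → g ∈ elim gs
    elim-nonneg⁺ m 0≤g = ∈-++⁺ˡ (∈-filter⁺ (λ g → + 0 ℤ.≤? g i) m 0≤g)

    elim-pair⁺ : ∀ {p n a b} → p ∈ gs → n ∈ gs → p i ≡ + suc a → n i ≡ -[1+ b ] → (suc b ⊡ p ⊞ suc a ⊡ n) ∈ elim gs
    elim-pair⁺ {p} {n} {a} {b} p∈ n∈ pa nb =
      subst (_∈ elim gs) eq
        (∈-++⁺ʳ (filter (λ g → + 0 ℤ.≤? g i) gs)
          (∈-cartesianProductWith⁺ pair
            (∈-filter⁺ (λ g → + 0 ℤ.<? g i) p∈ (subst (+ 0 ℤ.<_) (sym pa) (+<+ (s≤s z≤n))))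
            (∈-filter⁺ (λ g → g i ℤ.<? + 0) n∈ (subst (ℤ._< + 0) (sym nb) ℤ.-<+))))
      where
      eq : pair p n ≡ suc b ⊡ p ⊞ suc a ⊡ n
      eq rewrite pa | nb = refl

    elim-sound : ∀ {x} → x ∈ elim gs → Comb gs x
    elim-sound m with elim-∈⁻ m
    ... | inj₁ (x∈ , _) = comb-∈ x∈
    ... | inj₂ (p , n , p∈ , n∈ , _ , _ , refl) =
      comb-+ (comb-⊡ ℤ.∣ n i ∣ (comb-∈ p∈)) (comb-⊡ ℤ.∣ p i ∣ (comb-∈ n∈)) ≼-refl

    elim-preserves : ∀ j → (∀ {g} → g ∈ gs → + 0 ℤ.≤ g j) → ∀ {x} → x ∈ elim gs → + 0 ℤ.≤ x j
    elim-preserves j 0≤ m with elim-∈⁻ m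
    ... | inj₁ (x∈ , _) = 0≤ x∈
    ... | inj₂ (p , n , p∈ , n∈ , _ , _ , refl) =
      ℤP.+-mono-≤ (0≤n*z ℤ.∣ n i ∣ (0≤ p∈)) (0≤n*z ℤ.∣ p i ∣ (0≤ n∈))

    elim-nonneg : ∀ {x} → x ∈ elim gs → + 0 ℤ.≤ x i
    elim-nonneg m with elim-∈⁻ m
    ... | inj₁ (_ , 0≤x) = 0≤x
    ... | inj₂ (p , n , p∈ , n∈ , 0<p , n<0 , refl) = ℤP.≤-reflexive (sym (balance (p i) (n i) 0<p n<0))
      where
      balance : ∀ a b → + 0 ℤ.< a → b ℤ.< + 0 → + ℤ.∣ b ∣ ℤ.* a ℤ.+ + ℤ.∣ a ∣ ℤ.* b ≡ + 0
      balance (+ a) -[1+ b ] _ _ =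
        trans (cong (ℤ._+ (+ a ℤ.* -[1+ b ])) (ℤP.*-comm (+ suc b) (+ a)))
        (trans (sym (ℤP.*-distribˡ-+ (+ a) (+ suc b) -[1+ b ]))
        (trans (cong (+ a ℤ.*_) (ℤP.+-inverseʳ (+ suc b))) (ℤP.*-zeroʳ (+ a))))
      balance (+ a) (+ b) _ (+<+ ())
      balance -[1+ a ] b () _

    -- The index records the total height in coordinate `i`; it becomes the multiplier of the other
    -- side when positive and negative generators are paired.
    data Pos : Z d → ℕ → Set where
      none : ∀ {e} → e ≼ 𝟎 → Pos e 0
      add  : ∀ {g e e′ a A} → g ∈ gs → g i ≡ + suc a → Pos e′ A → e ≼ g ⊞ e′ → Pos e (suc a ℕ.+ A)

    data Neg : Z d → ℕ → Set where
      none : ∀ {e} → e ≼ 𝟎 → Neg e 0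
      add  : ∀ {g e e′ b B} → g ∈ gs → g i ≡ -[1+ b ] → Neg e′ B → e ≼ g ⊞ e′ → Neg e (suc b ℕ.+ B)

    pos-height : ∀ {e A} → Pos e A → e i ℤ.≤ + A
    pos-height (none p)          = p i
    pos-height (add {a = a} {A} _ eq ps p) = ℤP.≤-trans (p i) (ℤP.+-mono-≤ (ℤP.≤-reflexive eq) (pos-height ps))

    neg-height : ∀ {e B} → Neg e B → e i ℤ.≤ ℤ.- (+ B)
    neg-height (none p)            = p i
    neg-height (add {b = b} {B} _ eq ns p) =
      ℤP.≤-trans (p i) (ℤP.≤-trans (ℤP.+-mono-≤ (ℤP.≤-reflexive eq) (neg-height ns))
        (ℤP.≤-reflexive (sym (ℤP.neg-distrib-+ (+ suc b) (+ B)))))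

    pos-comb : ∀ {e A} → Pos e A → Comb (elim gs) e
    pos-comb (none p)        = none p
    pos-comb (add m eq ps p) = add (elim-nonneg⁺ m (subst (+ 0 ℤ.≤_) (sym eq) (+≤+ z≤n))) (pos-comb ps) p

    absorb : ∀ {g b} → g ∈ gs → g i ≡ -[1+ b ] → ∀ {e A} → Pos e A → Comb (elim gs) (A ⊡ g ⊞ suc b ⊡ e)
    absorb {g} {b} m eq {e} (none p) = none (λ j → ℤP.≤-trans
      (ℤP.+-mono-≤ (ℤP.≤-reflexive (ℤP.*-zeroˡ (g j))) (⊡-mono (suc b) p j))
      (ℤP.≤-reflexive (trans (ℤP.+-identityˡ _) (ℤP.*-zeroʳ (+ suc b)))))
    absorb {g} {b} m eq {e} (add {p} {e′ = e′} {a} {A} p∈ pa ps q) =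
      add (elim-pair⁺ p∈ m pa eq) (absorb m eq ps) (λ j → ℤP.≤-trans
        (ℤP.+-monoʳ-≤ (+ (suc a ℕ.+ A) ℤ.* g j) (⊡-mono (suc b) q j))
        (ℤP.≤-reflexive (ring (+ suc a) (+ A) (+ suc b) (g j) (p j) (e′ j))))
      where
      ring : ∀ a A b g p e → (a ℤ.+ A) ℤ.* g ℤ.+ b ℤ.* (p ℤ.+ e) ≡ (b ℤ.* p ℤ.+ a ℤ.* g) ℤ.+ (A ℤ.* g ℤ.+ b ℤ.* e)
      ring = solve-∀

    -- Every negative generator is paired with every positive one, which scales each side by the
    -- total height of the other. No matching of heights has to be found.
    absorb-all : ∀ {n p A B} → Neg n B → Pos p A → Comb (elim gs) (A ⊡ n ⊞ B ⊡ p)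
    absorb-all {n} {p} {A} (none q) ps = none (λ j → ℤP.≤-trans
      (ℤP.+-mono-≤ (⊡-mono A q j) (ℤP.≤-reflexive (ℤP.*-zeroˡ (p j))))
      (ℤP.≤-reflexive (trans (ℤP.+-identityʳ _) (ℤP.*-zeroʳ (+ A)))))
    absorb-all {n} {p} {A} (add {g} {e′ = n′} {b} {B} m eq ns q) ps =
      comb-+ (absorb m eq ps) (absorb-all ns ps) (λ j → ℤP.≤-trans
        (ℤP.+-monoˡ-≤ (+ (suc b ℕ.+ B) ℤ.* p j) (⊡-mono A q j))
        (ℤP.≤-reflexive (ring (+ A) (g j) (n′ j) (+ suc b) (+ B) (p j))))
      where
      ring : ∀ A g n b B p → A ℤ.* (g ℤ.+ n) ℤ.+ (b ℤ.+ B) ℤ.* p ≡ (A ℤ.* g ℤ.+ b ℤ.* p) ℤ.+ (A ℤ.* n ℤ.+ B ℤ.* p)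
      ring = solve-∀

    zer : List (Z d)
    zer = filter (λ g → g i ℤ.≟ + 0) gs

    zer-height : ∀ {e} → Comb zer e → e i ℤ.≤ + 0
    zer-height (none p)    = p i
    zer-height (add m c p) = ℤP.≤-trans (p i)
      (ℤP.+-mono-≤ (ℤP.≤-reflexive (proj₂ (∈-filter⁻ (λ g → g i ℤ.≟ + 0) {xs = gs} m))) (zer-height c))

    zer-comb : ∀ {e} → Comb zer e → Comb (elim gs) e
    zer-comb = comb-⊆ (λ m → let g∈ , eq = ∈-filter⁻ (λ g → g i ℤ.≟ + 0) {xs = gs} m
                             in elim-nonneg⁺ g∈ (ℤP.≤-reflexive (sym eq)))

    record Split (x : Z d) : Set where
      field
        {p n z} : Z d
        {A B}   : ℕ
        pos     : Pos p A
        neg     : Neg n B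
        zer∈    : Comb zer z
        below   : x ≼ (p ⊞ n) ⊞ z

    split : ∀ {x} → Comb gs x → Split x
    split (none p) = record { pos = none (≼-refl {z = 𝟎}) ; neg = none (≼-refl {z = 𝟎}) ; zer∈ = none (≼-refl {z = 𝟎}) ; below = p }
    split {x} (add {g} {e′} m c q) with split c | g i in eq
    ... | record { p = p ; n = n ; z = z ; pos = ps ; neg = ns ; zer∈ = zs ; below = b } | + zero = record
      { pos = ps ; neg = ns ; zer∈ = add (∈-filter⁺ (λ g → g i ℤ.≟ + 0) m eq) zs ≼-refl
      ; below = ≼-trans q (≼-trans (⊞-monoʳ g b) (≼-reflexive λ j → ring (g j) (p j) (n j) (z j))) }
      where
      ring : ∀ g p n z → g ℤ.+ ((p ℤ.+ n) ℤ.+ z) ≡ (p ℤ.+ n) ℤ.+ (g ℤ.+ z)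
      ring = solve-∀
    ... | record { p = p ; n = n ; z = z ; pos = ps ; neg = ns ; zer∈ = zs ; below = b } | + suc a = record
      { pos = add m eq ps ≼-refl ; neg = ns ; zer∈ = zs
      ; below = ≼-trans q (≼-trans (⊞-monoʳ g b) (≼-reflexive λ j → ring (g j) (p j) (n j) (z j))) }
      where
      ring : ∀ g p n z → g ℤ.+ ((p ℤ.+ n) ℤ.+ z) ≡ ((g ℤ.+ p) ℤ.+ n) ℤ.+ z
      ring = solve-∀
    ... | record { p = p ; n = n ; z = z ; pos = ps ; neg = ns ; zer∈ = zs ; below = b } | -[1+ a ] = record
      { pos = ps ; neg = add m eq ns ≼-refl ; zer∈ = zs
      ; below = ≼-trans q (≼-trans (⊞-monoʳ g b) (≼-reflexive λ j → ring (g j) (p j) (n j) (z j))) }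
      where
      ring : ∀ g p n z → g ℤ.+ ((p ℤ.+ n) ℤ.+ z) ≡ (p ℤ.+ (g ℤ.+ n)) ℤ.+ z
      ring = solve-∀

    elim-complete : ∀ {x} → Comb gs x → + 0 ℤ.≤ x i → ∃ λ N → Comb (elim gs) (suc N ⊡ x)
    elim-complete {x} c 0≤x with split c
    ... | record { p = p ; n = n ; z = z ; A = A ; B = B ; pos = ps ; neg = ns ; zer∈ = zs ; below = b } =
      scale A B ps ns B≤A
      where
      B≤A : B ℕ.≤ A
      B≤A = ℤP.drop‿+≤+ (ℤP.0≤i-j⇒j≤i (ℤP.≤-trans 0≤x (ℤP.≤-trans (b i)
        (ℤP.≤-trans (ℤP.+-mono-≤ (ℤP.+-mono-≤ (pos-height ps) (neg-height ns)) (zer-height zs))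
          (ℤP.≤-reflexive (ℤP.+-identityʳ (+ A ℤ.- + B)))))))
      scale : ∀ A B → Pos p A → Neg n B → B ℕ.≤ A → ∃ λ N → Comb (elim gs) (suc N ⊡ x)
      scale zero zero ps (none n≼0) _ = 0 , comb-+ (pos-comb ps) (zer-comb zs) (λ j →
        ℤP.≤-trans (ℤP.≤-reflexive (ℤP.*-identityˡ (x j))) (ℤP.≤-trans (b j)
          (ℤP.+-monoˡ-≤ (z j) (ℤP.≤-trans (ℤP.+-monoʳ-≤ (p j) (n≼0 j)) (ℤP.≤-reflexive (ℤP.+-identityʳ (p j)))))))
      scale (suc A) B ps ns B≤A with ℕP.m≤n⇒∃[o]m+o≡n B≤A
      ... | D , B+D≡A = A , comb-+ (comb-+ (absorb-all ns ps) (comb-⊡ D (pos-comb ps)) ≼-refl)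
                                  (comb-⊡ (suc A) (zer-comb zs)) (λ j →
        ℤP.≤-trans (⊡-mono (suc A) b j)
          (ℤP.≤-reflexive (ring′ (cong +_ (sym B+D≡A)) (+ B) (+ D) (p j) (n j) (z j) refl)))
        where
        ring : ∀ B D p n z → (B ℤ.+ D) ℤ.* ((p ℤ.+ n) ℤ.+ z) ≡ (((B ℤ.+ D) ℤ.* n ℤ.+ B ℤ.* p) ℤ.+ D ℤ.* p) ℤ.+ (B ℤ.+ D) ℤ.* z
        ring = solve-∀
        ring′ : ∀ {a c} → a ≡ c → ∀ B D p n z → c ≡ B ℤ.+ D → a ℤ.* ((p ℤ.+ n) ℤ.+ z) ≡ ((a ℤ.* n ℤ.+ B ℤ.* p) ℤ.+ D ℤ.* p) ℤ.+ a ℤ.* z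
        ring′ refl B D p n z refl = ring B D p n z

open Eliminate using (elim; elim-sound; elim-nonneg; elim-preserves; elim-complete)

eliminate : ∀ {d} → List (Fin d) → List (Z d) → List (Z d)
eliminate is gs = foldr elim gs is

eliminate-sound : ∀ {d} is {gs : List (Z d)} {x} → x ∈ eliminate is gs → Comb gs x
eliminate-sound []       m = comb-∈ m
eliminate-sound (i ∷ is) m = comb-bind (eliminate-sound is) (elim-sound i m)

eliminate-nonneg : ∀ {d} is {gs : List (Z d)} {x i} → i ∈ is → x ∈ eliminate is gs → + 0 ℤ.≤ x i
eliminate-nonneg (i ∷ is) {gs} (here refl) m = elim-nonneg i {gs = eliminate is gs} m
eliminate-nonneg (i ∷ is) {gs} (there j∈)  m = elim-preserves i {gs = eliminate is gs} _ (eliminate-nonneg is j∈) m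

eliminate-complete : ∀ {d} is {gs : List (Z d)} {x} → Comb gs x → 𝟎 ≼ x → ∃ λ N → Comb (eliminate is gs) (suc N ⊡ x)
eliminate-complete [] {x = x} c _ = 0 , comb-down (≼-reflexive (λ i → ℤP.*-identityˡ (x i))) c
eliminate-complete (i ∷ is) {gs} {x} c 0≼x with eliminate-complete is c 0≼x
... | N , c′ with elim-complete i c′ (0≤n*z (suc N) (0≼x i))
... | M , c″ = N ℕ.+ M ℕ.* suc N , comb-down (λ j → ℤP.≤-reflexive
                 (trans (cong (ℤ._* x j) (ℤP.pos-* (suc M) (suc N))) (ℤP.*-assoc (+ suc M) (+ suc N) (x j)))) c″

comb-positive : ∀ {d} {gs : List (Z d)} i {x} → Comb gs x → + 0 ℤ.< x i → Any (λ g → + 0 ℤ.< g i) gs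
comb-positive i (none p) 0<x = ⊥-elim (ℤP.<⇒≱ 0<x (p i))
comb-positive {gs = gs} i (add {g} {e′} m c p) 0<x with + 0 ℤ.<? g i
... | yes 0<g = Any.map (λ { refl → 0<g }) m
... | no  0≮g = comb-positive i c (ℤP.<-≤-trans 0<x (ℤP.≤-trans (p i)
  (ℤP.≤-trans (ℤP.+-monoˡ-≤ (e′ i) (ℤP.≮⇒≥ 0≮g)) (ℤP.≤-reflexive (ℤP.+-identityˡ (e′ i))))))

-- Once the cone has been cut by all half-spaces, each generator is nonnegative and thus a witness
-- by itself; and a positive coordinate of a combination can only come from a generator positive
-- there.
positive-ray? : ∀ {d} (gs : List (Z d)) i → Dec (∃ λ x → Comb gs x × 𝟎 ≼ x × + 0 ℤ.< x i)
positive-ray? {d} gs i = map′ to from (Any.any? (λ g → + 0 ℤ.<? g i) (eliminate (allFin d) gs))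
  where
  to : Any (λ g → + 0 ℤ.< g i) (eliminate (allFin d) gs) → ∃ λ x → Comb gs x × 𝟎 ≼ x × + 0 ℤ.< x i
  to a = let g , g∈ , 0<g = find a in
    g , eliminate-sound (allFin d) g∈ , (λ j → eliminate-nonneg (allFin d) (∈-allFin j) g∈) , 0<g
  from : (∃ λ x → Comb gs x × 𝟎 ≼ x × + 0 ℤ.< x i) → Any (λ g → + 0 ℤ.< g i) (eliminate (allFin d) gs)
  from (x , c , 0≼x , 0<x) with eliminate-complete (allFin d) c 0≼x
  ... | N , c′ = comb-positive i c′ (subst (ℤ._< + suc N ℤ.* x i) (ℤP.*-zeroʳ (+ suc N)) (ℤP.*-monoˡ-<-pos (+ suc N) 0<x))

-- A further coordinate counts the uses of b.
ext : ∀ {d} → ℤ → Z d → Z (suc d)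
ext t z zero    = t
ext t z (suc i) = z i

-- A sum of `n ≥ 1` elements of the linear set of `b` and `P` uses `b` exactly `n` times and the
-- periods freely. Asking for at least one use of `b` instead of exactly one makes the question
-- homogeneous, hence a question about rays of a cone.
recurrent? : ∀ {d} (b : Z d) (P : List (Z d)) → Dec (∃ λ c → Comb (b ∷ P) c × 𝟎 ≼ b ⊞ c)
recurrent? {d} b P = map′ to from (positive-ray? gs zero)
  where
  gs : List (Z (suc d))
  gs = ext (+ 1) b ∷ map (ext (+ 0)) P

  tail : Z (suc d) → Z d
  tail x i = x (suc i)

  tail-∈ : ∀ {g} → g ∈ gs → tail g ∈ b ∷ P
  tail-∈ (here refl) = here refl
  tail-∈ (there m) with ∈-map⁻ (ext (+ 0)) m
  ... | p , p∈ , refl = there p∈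

  tail-comb : ∀ {x} → Comb gs x → Comb (b ∷ P) (tail x)
  tail-comb (none p)    = none (λ i → p (suc i))
  tail-comb (add m c p) = add (tail-∈ m) (tail-comb c) (λ i → p (suc i))

  uses : ∀ {x} → Comb gs x → x zero ℤ.≤ + 0 ⊎ ∃ λ c → Comb (b ∷ P) c × tail x ≼ b ⊞ c
  uses (none p) = inj₁ (p zero)
  uses (add (here refl) c p) = inj₂ (_ , tail-comb c , λ i → p (suc i))
  uses (add {e′ = e′} (there m) c p) with ∈-map⁻ (ext (+ 0)) m | uses c
  ... | q , q∈ , refl | inj₁ ≤0 = inj₁ (ℤP.≤-trans (p zero) (ℤP.≤-trans (ℤP.≤-reflexive (ℤP.+-identityˡ (e′ zero))) ≤0))
  ... | q , q∈ , refl | inj₂ (f , cf , le) = inj₂ (q ⊞ f , add (there q∈) cf ≼-refl , λ i →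
    ℤP.≤-trans (p (suc i)) (ℤP.≤-trans (ℤP.+-monoʳ-≤ (q i) (le i)) (ℤP.≤-reflexive (ring (q i) (b i) (f i)))))
    where
    ring : ∀ q b f → q ℤ.+ (b ℤ.+ f) ≡ b ℤ.+ (q ℤ.+ f)
    ring = solve-∀

  to : (∃ λ x → Comb gs x × 𝟎 ≼ x × + 0 ℤ.< x zero) → ∃ λ c → Comb (b ∷ P) c × 𝟎 ≼ b ⊞ c
  to (x , cx , 0≼x , 0<x) with uses cx
  ... | inj₁ ≤0           = ⊥-elim (ℤP.<⇒≱ 0<x ≤0)
  ... | inj₂ (c , cc , le) = c , cc , λ i → ℤP.≤-trans (0≼x (suc i)) (le i)

  lift : ∀ {c} → Comb (b ∷ P) c → Comb gs (ext (+ 0) c)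
  lift (none p) = none (λ { zero → ℤP.≤-refl ; (suc i) → p i })
  lift (add (here refl) c p) = add (here refl) (lift c) (λ { zero → +≤+ z≤n ; (suc i) → p i })
  lift (add (there m) c p) = add (there (∈-map⁺ (ext (+ 0)) m)) (lift c) (λ { zero → ℤP.≤-refl ; (suc i) → p i })

  from : (∃ λ c → Comb (b ∷ P) c × 𝟎 ≼ b ⊞ c) → ∃ λ x → Comb gs x × 𝟎 ≼ x × + 0 ℤ.< x zero
  from (c , cc , 0≼) = ext (+ 1) b ⊞ ext (+ 0) c , add (here refl) (lift cc) ≼-refl ,
    (λ { zero → +≤+ z≤n ; (suc i) → 0≼ i }) , +<+ (s≤s z≤n)

-- Semilinear sets and effects of walks

-- (b , P) stands for the down-closure of b + ⟨P⟩, a list for the union.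
Linear : ℕ → Set
Linear d = Z d × List (Z d)

infix 4 _∈ᴸ_ _∈ˢ_
infixr 6 _⊗_

_∈ᴸ_ : ∀ {d} → Z d → Linear d → Set
e ∈ᴸ (b , P) = ∃ λ c → Comb P c × e ≼ b ⊞ c

_∈ˢ_ : ∀ {d} → Z d → List (Linear d) → Set
e ∈ˢ S = ∃ λ l → l ∈ S × e ∈ᴸ l

_⊕_ : ∀ {d} → Linear d → Linear d → Linear d
(b , P) ⊕ (b′ , P′) = b ⊞ b′ , P ++ P′

_⊗_ : ∀ {d} → List (Linear d) → List (Linear d) → List (Linear d)
_⊗_ = cartesianProductWith _⊕_

_⊕*_ : ∀ {d} → Linear d → Linear d → Linear d
(b , P) ⊕* (b′ , P′) = b ⊞ b′ , b ∷ P ++ P′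

⟨_⟩ : ∀ {d} → Z d → List (Linear d)
⟨ z ⟩ = (z , []) ∷ []

-- In a commutative monoid the star of a union is the product of the stars. A nonempty sum of
-- elements of `b + ⟨P⟩` is `b` plus a combination of `b` and `P`, as all periods may be charged to
-- one summand; this is what `_⊕*_` adds. The other branch is the case without `l`.
star : ∀ {d} → List (Linear d) → List (Linear d)
star []      = ⟨ 𝟎 ⟩
star (l ∷ S) = star S ++ map (l ⊕*_) (star S)

∈ˢ-down : ∀ {d} {S : List (Linear d)} {e f} → e ≼ f → f ∈ˢ S → e ∈ˢ S
∈ˢ-down e≼f (l , l∈ , c , cc , p) = l , l∈ , c , cc , ≼-trans e≼f p

∈ˢ-⊆ : ∀ {d} {S T : List (Linear d)} {e} → (∀ {l} → l ∈ S → l ∈ T) → e ∈ˢ S → e ∈ˢ T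
∈ˢ-⊆ f (l , l∈ , m) = l , f l∈ , m

+-identityʳ-≼ : ∀ {d} (z : Z d) → z ≼ z ⊞ 𝟎
+-identityʳ-≼ z i = ℤP.≤-reflexive (sym (ℤP.+-identityʳ (z i)))

base∈ : ∀ {d} (l : Linear d) → proj₁ l ∈ᴸ l
base∈ (b , P) = 𝟎 , none ≼-refl , +-identityʳ-≼ b

∈-⟨⟩ : ∀ {d} {e z : Z d} → e ≼ z → e ∈ˢ ⟨ z ⟩
∈-⟨⟩ {z = z} p = _ , here refl , 𝟎 , none ≼-refl , ≼-trans p (+-identityʳ-≼ z)

comb-[] : ∀ {d} {c : Z d} → Comb [] c → c ≼ 𝟎
comb-[] (none p) = p

⟨⟩-∈ : ∀ {d} {e z : Z d} → e ∈ˢ ⟨ z ⟩ → e ≼ z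
⟨⟩-∈ {z = z} (_ , here refl , c , cc , p) i =
  ℤP.≤-trans (p i) (ℤP.≤-trans (ℤP.+-monoʳ-≤ (z i) (comb-[] cc i)) (ℤP.≤-reflexive (ℤP.+-identityʳ (z i))))

⊞-interchange : ∀ {d} (a b c e : Z d) → (a ⊞ b) ⊞ (c ⊞ e) ≼ (a ⊞ c) ⊞ (b ⊞ e)
⊞-interchange a b c e i = ℤP.≤-reflexive (ring (a i) (b i) (c i) (e i))
  where
  ring : ∀ a b c e → (a ℤ.+ b) ℤ.+ (c ℤ.+ e) ≡ (a ℤ.+ c) ℤ.+ (b ℤ.+ e)
  ring = solve-∀

comb-++⁻ : ∀ {d} (P : List (Z d)) {P′ c} → Comb (P ++ P′) c → ∃₂ λ c₁ c₂ → Comb P c₁ × Comb P′ c₂ × c ≼ c₁ ⊞ c₂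
comb-++⁻ P (none p) = 𝟎 , 𝟎 , none ≼-refl , none ≼-refl , p
comb-++⁻ P (add {g} m c p) with ∈-++⁻ P m | comb-++⁻ P c
... | inj₁ m₁ | c₁ , c₂ , cc₁ , cc₂ , q =
  g ⊞ c₁ , c₂ , add m₁ cc₁ ≼-refl , cc₂ , ≼-trans p (≼-trans (⊞-monoʳ g q) (⊞-assoc⁻ g c₁ c₂))
... | inj₂ m₂ | c₁ , c₂ , cc₁ , cc₂ , q =
  c₁ , g ⊞ c₂ , cc₁ , add m₂ cc₂ ≼-refl , ≼-trans p (≼-trans (⊞-monoʳ g q)
    (λ i → ℤP.≤-reflexive (ring (g i) (c₁ i) (c₂ i))))
  where
  ring : ∀ g a b → g ℤ.+ (a ℤ.+ b) ≡ a ℤ.+ (g ℤ.+ b)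
  ring = solve-∀

comb-++⁺ : ∀ {d} (P : List (Z d)) {P′ c₁ c₂} → Comb P c₁ → Comb P′ c₂ → Comb (P ++ P′) (c₁ ⊞ c₂)
comb-++⁺ P cc₁ cc₂ = comb-+ (comb-⊆ ∈-++⁺ˡ cc₁) (comb-⊆ (∈-++⁺ʳ P) cc₂) ≼-refl

⊗⁺ : ∀ {d} {S T : List (Linear d)} {e f x} → e ∈ˢ S → f ∈ˢ T → x ≼ e ⊞ f → x ∈ˢ S ⊗ T
⊗⁺ ((b , P) , l∈ , c , cc , p) ((b′ , P′) , l′∈ , c′ , cc′ , p′) q =
  _ , ∈-cartesianProductWith⁺ _⊕_ l∈ l′∈ , c ⊞ c′ , comb-++⁺ P cc cc′ ,
  ≼-trans q (≼-trans (⊞-mono p p′) (⊞-interchange b c b′ c′))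

⊗⁻ : ∀ {d} (S T : List (Linear d)) {x} → x ∈ˢ S ⊗ T → ∃₂ λ e f → e ∈ˢ S × f ∈ˢ T × x ≼ e ⊞ f
⊗⁻ S T (l , l∈ , c , cc , p) with ∈-cartesianProductWith⁻ _⊕_ S T l∈
... | (b , P) , (b′ , P′) , m , m′ , refl with comb-++⁻ P cc
... | c₁ , c₂ , cc₁ , cc₂ , q = b ⊞ c₁ , b′ ⊞ c₂ , ((b , P) , m , c₁ , cc₁ , ≼-refl) , ((b′ , P′) , m′ , c₂ , cc₂ , ≼-refl) ,
  ≼-trans p (≼-trans (⊞-monoʳ (b ⊞ b′) q) (⊞-interchange b b′ c₁ c₂))

record IsSubmonoid {d} (Q : Z d → Set) : Set where
  field
    Q-𝟎 : ∀ {e} → e ≼ 𝟎 → Q e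
    Q-+ : ∀ {e f x} → Q e → Q f → x ≼ e ⊞ f → Q x

module _ {d} {Q : Z d → Set} (isSubmonoid : IsSubmonoid Q) where
  open IsSubmonoid isSubmonoid

  private
    split : ∀ {b} P {P′ c} → Q b → Comb (b ∷ P ++ P′) c →
            ∃₂ λ c₁ c₂ → ∃ λ r → Comb P c₁ × Comb P′ c₂ × Q r × c ≼ (c₁ ⊞ c₂) ⊞ r
    split P qb (none p) = 𝟎 , 𝟎 , 𝟎 , none ≼-refl , none ≼-refl , Q-𝟎 ≼-refl , p
    split {b} P qb (add (here refl) c p) with split P qb c
    ... | c₁ , c₂ , r , cc₁ , cc₂ , qr , q = c₁ , c₂ , b ⊞ r , cc₁ , cc₂ , Q-+ qb qr ≼-refl ,
      ≼-trans p (≼-trans (⊞-monoʳ b q) (λ i → ℤP.≤-reflexive (ring (b i) (c₁ i) (c₂ i) (r i))))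
      where
      ring : ∀ b x y r → b ℤ.+ ((x ℤ.+ y) ℤ.+ r) ≡ (x ℤ.+ y) ℤ.+ (b ℤ.+ r)
      ring = solve-∀
    split P qb (add {g} (there m) c p) with ∈-++⁻ P m | split P qb c
    ... | inj₁ m₁ | c₁ , c₂ , r , cc₁ , cc₂ , qr , q = g ⊞ c₁ , c₂ , r , add m₁ cc₁ ≼-refl , cc₂ , qr ,
      ≼-trans p (≼-trans (⊞-monoʳ g q) (λ i → ℤP.≤-reflexive (ring (g i) (c₁ i) (c₂ i) (r i))))
      where
      ring : ∀ b x y r → b ℤ.+ ((x ℤ.+ y) ℤ.+ r) ≡ ((b ℤ.+ x) ℤ.+ y) ℤ.+ r
      ring = solve-∀
    ... | inj₂ m₂ | c₁ , c₂ , r , cc₁ , cc₂ , qr , q = c₁ , g ⊞ c₂ , r , cc₁ , add m₂ cc₂ ≼-refl , qr ,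
      ≼-trans p (≼-trans (⊞-monoʳ g q) (λ i → ℤP.≤-reflexive (ring (g i) (c₁ i) (c₂ i) (r i))))
      where
      ring : ∀ b x y r → b ℤ.+ ((x ℤ.+ y) ℤ.+ r) ≡ (x ℤ.+ (b ℤ.+ y)) ℤ.+ r
      ring = solve-∀

  -- The universal property of the star, with `Q` abstract so that it serves twice: for the effects
  -- of closed walks at a vertex, and for the vectors that `star S` absorbs.
  star-sound : ∀ S → (∀ {e} → e ∈ˢ S → Q e) → ∀ {e} → e ∈ˢ star S → Q e
  star-sound [] f m = Q-𝟎 (⟨⟩-∈ m)
  star-sound (l@(b , P) ∷ S) f (l′ , l′∈ , c , cc , p) with ∈-++⁻ (star S) l′∈
  ... | inj₁ m = star-sound S (λ (l , l∈ , m) → f (l , there l∈ , m)) (l′ , m , c , cc , p)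
  ... | inj₂ m with ∈-map⁻ (l ⊕*_) m
  ... | (b′ , P′) , m′ , refl with split P (f (l , here refl , base∈ l)) cc
  ... | c₁ , c₂ , r , cc₁ , cc₂ , qr , q =
    Q-+ (Q-+ (f (l , here refl , c₁ , cc₁ , ≼-refl))
             (star-sound S (λ (l , l∈ , m) → f (l , there l∈ , m)) (_ , m′ , c₂ , cc₂ , ≼-refl)) ≼-refl)
        qr
        (≼-trans p (≼-trans (⊞-monoʳ (b ⊞ b′) q) (λ i → ℤP.≤-reflexive (ring (b i) (b′ i) (c₁ i) (c₂ i) (r i)))))
    where
    ring : ∀ b b′ x y r → (b ℤ.+ b′) ℤ.+ ((x ℤ.+ y) ℤ.+ r) ≡ ((b ℤ.+ x) ℤ.+ (b′ ℤ.+ y)) ℤ.+ r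
    ring = solve-∀

star-𝟎 : ∀ {d} (S : List (Linear d)) {e} → e ≼ 𝟎 → e ∈ˢ star S
star-𝟎 []      p = ∈-⟨⟩ p
star-𝟎 (l ∷ S) p = ∈ˢ-⊆ ∈-++⁺ˡ (star-𝟎 S p)

star-∷ : ∀ {d} (S : List (Linear d)) {e f x} → e ∈ˢ S → f ∈ˢ star S → x ≼ e ⊞ f → x ∈ˢ star S
star-∷ ((b , P) ∷ S) {e} {f} (_ , here refl , c , cc , p) (l′ , l′∈ , c′ , cc′ , p′) q with ∈-++⁻ (star S) l′∈
... | inj₁ m = _ , ∈-++⁺ʳ (star S) (∈-map⁺ ((b , P) ⊕*_) m) , c ⊞ c′ , comb-⊆ there (comb-++⁺ P cc cc′) ,
  ≼-trans q (≼-trans (⊞-mono p p′) (⊞-interchange b c (proj₁ l′) c′))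
... | inj₂ m with ∈-map⁻ ((b , P) ⊕*_) m
... | (b″ , P″) , m″ , refl = _ , l′∈ , (b ⊞ c) ⊞ c′ ,
  comb-+ (add (here refl) (comb-⊆ (λ z → there (∈-++⁺ˡ z)) cc) ≼-refl) cc′ ≼-refl ,
  ≼-trans q (≼-trans (⊞-mono p p′) (λ i → ℤP.≤-reflexive (ring (b i) (c i) (b″ i) (c′ i))))
  where
  ring : ∀ b c b″ c′ → (b ℤ.+ c) ℤ.+ ((b ℤ.+ b″) ℤ.+ c′) ≡ (b ℤ.+ b″) ℤ.+ ((b ℤ.+ c) ℤ.+ c′)
  ring = solve-∀
star-∷ ((b , P) ∷ S) {e} {f} (l , there l∈ , c , cc , p) (l′ , l′∈ , c′ , cc′ , p′) q with ∈-++⁻ (star S) l′∈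
... | inj₁ m = ∈ˢ-⊆ ∈-++⁺ˡ (star-∷ S (l , l∈ , c , cc , p) (l′ , m , c′ , cc′ , p′) q)
... | inj₂ m with ∈-map⁻ ((b , P) ⊕*_) m
... | (b″ , P″) , m″ , refl with comb-++⁻ (b ∷ P) cc′
... | c₁ , c₂ , cc₁ , cc₂ , r
  with star-∷ S {e} {b″ ⊞ c₂} (l , l∈ , c , cc , p) ((b″ , P″) , m″ , c₂ , cc₂ , ≼-refl) ≼-refl
... | (b₃ , P₃) , m₃ , c₃ , cc₃ , s =
  _ , ∈-++⁺ʳ (star S) (∈-map⁺ ((b , P) ⊕*_) m₃) , c₁ ⊞ c₃ , comb-++⁺ (b ∷ P) cc₁ cc₃ ,
  λ i → ℤP.≤-trans (q i) (ℤP.≤-trans (ℤP.+-monoʳ-≤ (e i) (ℤP.≤-trans (p′ i) (ℤP.+-monoʳ-≤ (b i ℤ.+ b″ i) (r i))))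
    (ℤP.≤-trans (ℤP.≤-reflexive (ring₁ (e i) (b i) (b″ i) (c₁ i) (c₂ i)))
    (ℤP.≤-trans (ℤP.+-monoʳ-≤ (b i ℤ.+ c₁ i) (s i)) (ℤP.≤-reflexive (ring₂ (b i) (c₁ i) (b₃ i) (c₃ i))))))
  where
  ring₁ : ∀ e b b″ c₁ c₂ → e ℤ.+ ((b ℤ.+ b″) ℤ.+ (c₁ ℤ.+ c₂)) ≡ (b ℤ.+ c₁) ℤ.+ (e ℤ.+ (b″ ℤ.+ c₂))
  ring₁ = solve-∀
  ring₂ : ∀ b c₁ b₃ c₃ → (b ℤ.+ c₁) ℤ.+ (b₃ ℤ.+ c₃) ≡ (b ℤ.+ b₃) ℤ.+ (c₁ ℤ.+ c₃)
  ring₂ = solve-∀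

-- The vectors that can be added to every element of `star S` form a submonoid; it contains `S` by
-- `star-∷`, hence all of `star S`.
star-+ : ∀ {d} (S : List (Linear d)) {e f x} → e ∈ˢ star S → f ∈ˢ star S → x ≼ e ⊞ f → x ∈ˢ star S
star-+ {d} S {f = f₀} m m′ p = ∈ˢ-down p (star-sound submonoid S absorbs m _ m′)
  where
  Absorbs : Z d → Set
  Absorbs e = ∀ f → f ∈ˢ star S → e ⊞ f ∈ˢ star S
  submonoid : IsSubmonoid Absorbs
  submonoid = record
    { Q-𝟎 = λ p f m → ∈ˢ-down (λ i → ℤP.≤-trans (ℤP.+-monoˡ-≤ (f i) (p i)) (ℤP.≤-reflexive (ℤP.+-identityˡ (f i)))) m
    ; Q-+ = λ {e} {e′} qe qe′ p f m → ∈ˢ-down (≼-trans (⊞-mono p (≼-refl {z = f})) (⊞-assoc e e′ f)) (qe _ (qe′ f m)) }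
  absorbs : ∀ {e} → e ∈ˢ S → Absorbs e
  absorbs m f m′ = star-∷ S m m′ ≼-refl

Edge : ℕ → ℕ → Set
Edge k d = Fin k × Z d × Fin k

data Walk {k d} (es : List (Edge k d)) (x : Fin k) : Fin k → Z d → Set where
  nil  : ∀ {e} → e ≼ 𝟎 → Walk es x x e
  cons : ∀ {z y w e e′} → (x , z , y) ∈ es → Walk es y w e′ → e ≼ z ⊞ e′ → Walk es x w e

walk-++ : ∀ {k d} {es : List (Edge k d)} {x y w e f g} → Walk es x y e → Walk es y w f → g ≼ e ⊞ f → Walk es x w g
walk-++ {f = f} (nil p) (nil q) r = nil (λ i → ℤP.≤-trans (r i) (ℤP.+-mono-≤ (p i) (q i)))
walk-++ {f = f} (nil p) (cons {z} {e′ = e′} m π q) r = cons m π (λ i → ℤP.≤-trans (r i)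
  (ℤP.≤-trans (ℤP.+-mono-≤ (p i) (q i)) (ℤP.≤-reflexive (ℤP.+-identityˡ (z i ℤ.+ e′ i)))))
walk-++ {f = f} (cons {z} {e′ = e′} m π q) π′ r =
  cons m (walk-++ π π′ ≼-refl) (≼-trans r (≼-trans (⊞-mono q ≼-refl) (⊞-assoc z e′ f)))

walk-⊆ : ∀ {k d} {es fs : List (Edge k d)} → (∀ {a} → a ∈ es → a ∈ fs) → ∀ {x y e} → Walk es x y e → Walk fs x y e
walk-⊆ f (nil p)      = nil p
walk-⊆ f (cons m π p) = cons (f m) (walk-⊆ f π) p

loops : ∀ {k d} (es : List (Edge k d)) x → IsSubmonoid (Walk es x x)
loops es x = record { Q-𝟎 = nil ; Q-+ = walk-++ }

-- Kleene's algorithm, adding one edge at a time; commutativity keeps the sets semilinear.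
effects : ∀ {k d} → List (Edge k d) → Fin k → Fin k → List (Linear d)
effects [] x y with x Fin.≟ y
... | yes _ = ⟨ 𝟎 ⟩
... | no  _ = []
effects ((s , z , t) ∷ es) x y =
  effects es x y ++ effects es x s ⊗ ⟨ z ⟩ ⊗ star (effects es t s ⊗ ⟨ z ⟩) ⊗ effects es t y

effects-refl : ∀ {k d} (es : List (Edge k d)) {x e} → e ≼ 𝟎 → e ∈ˢ effects es x x
effects-refl [] {x} p with x Fin.≟ x
... | yes _   = ∈-⟨⟩ p
... | no  x≢x = ⊥-elim (x≢x refl)
effects-refl (_ ∷ es) p = ∈ˢ-⊆ ∈-++⁺ˡ (effects-refl es p)

module _ {k d} (s : Fin k) (z : Z d) (t : Fin k) (es : List (Edge k d)) where

  private
    L : List (Linear d)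
    L = effects es t s ⊗ ⟨ z ⟩

  record Through (x y : Fin k) (e : Z d) : Set where
    constructor through
    field
      {e₁ e₂ e₃} : Z d
      to   : e₁ ∈ˢ effects es x s
      loop : e₂ ∈ˢ star L
      from : e₃ ∈ˢ effects es t y
      le   : e ≼ e₁ ⊞ (z ⊞ (e₂ ⊞ e₃))

  through⁺ : ∀ {x y e} → Through x y e → e ∈ˢ effects ((s , z , t) ∷ es) x y
  through⁺ {x} {y} (through a b c p) =
    ∈ˢ-⊆ (∈-++⁺ʳ (effects es x y)) (⊗⁺ a (⊗⁺ (∈-⟨⟩ {e = z} ≼-refl) (⊗⁺ b c ≼-refl) ≼-refl) p)

  through⁻ : ∀ {x y e} → e ∈ˢ effects ((s , z , t) ∷ es) x y → e ∈ˢ effects es x y ⊎ Through x y e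
  through⁻ {x} {y} (l , l∈ , m) with ∈-++⁻ (effects es x y) l∈
  ... | inj₁ l∈₁ = inj₁ (l , l∈₁ , m)
  ... | inj₂ l∈₂ with ⊗⁻ (effects es x s) _ (l , l∈₂ , m)
  ... | e₁ , f₁ , m₁ , n₁ , p₁ with ⊗⁻ ⟨ z ⟩ _ n₁
  ... | e₂ , f₂ , m₂ , n₂ , p₂ with ⊗⁻ (star L) _ n₂
  ... | e₃ , f₃ , m₃ , n₃ , p₃ = inj₂ (through m₁ m₃ n₃
    (≼-trans p₁ (⊞-monoʳ e₁ (≼-trans p₂ (⊞-mono (⟨⟩-∈ m₂) p₃)))))

effects-sound : ∀ {k d} (es : List (Edge k d)) {x y e} → e ∈ˢ effects es x y → Walk es x y e
effects-sound [] {x} {y} m with x Fin.≟ y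
... | yes refl = nil (⟨⟩-∈ m)
effects-sound (a@(s , z , t) ∷ es) {x} {y} m with through⁻ s z t es m
... | inj₁ m′ = walk-⊆ there (effects-sound es m′)
... | inj₂ (through m₁ m₂ m₃ p) =
  walk-++ (walk-⊆ there (effects-sound es m₁))
    (cons (here refl) (walk-++ (star-sound (loops (a ∷ es) t) (effects es t s ⊗ ⟨ z ⟩) loop m₂)
                               (walk-⊆ there (effects-sound es m₃)) ≼-refl) ≼-refl)
    p
  where
  loop : ∀ {e} → e ∈ˢ effects es t s ⊗ ⟨ z ⟩ → Walk (a ∷ es) t t e
  loop m with ⊗⁻ (effects es t s) ⟨ z ⟩ m
  ... | e , f , m₁ , m₂ , p = walk-++ (walk-⊆ there (effects-sound es m₁))
        (cons (here refl) (nil ≼-refl) (≼-trans (⟨⟩-∈ m₂) (+-identityʳ-≼ z))) p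

-- If both parts use the added edge, the stretch between its last use in the first part and its
-- first use in the second leads from `t` back to `s`. Closed by `z`, it is one more loop between
-- the two starred ones.
effects-trans : ∀ {k d} (es : List (Edge k d)) {x y w e f g} →
                e ∈ˢ effects es x y → f ∈ˢ effects es y w → g ≼ e ⊞ f → g ∈ˢ effects es x w
effects-trans [] {x} {y} {w} m n p with x Fin.≟ y | y Fin.≟ w | x Fin.≟ w
... | yes refl | yes refl | yes _   = ∈-⟨⟩ (≼-trans p (λ i → ℤP.+-mono-≤ (⟨⟩-∈ m i) (⟨⟩-∈ n i)))
... | yes refl | yes refl | no  x≢x = ⊥-elim (x≢x refl)
effects-trans (a@(s , z , t) ∷ es) {x} {y} {w} {e} {f} {g} m n p
  with through⁻ s z t es m | through⁻ s z t es n
... | inj₁ m′ | inj₁ n′ = ∈ˢ-⊆ ∈-++⁺ˡ (effects-trans es m′ n′ p)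
... | inj₁ m′ | inj₂ (through {a} {b} {c} n₁ n₂ n₃ q) =
  through⁺ s z t es (through (effects-trans es m′ n₁ ≼-refl) n₂ n₃
    (≼-trans p (≼-trans (⊞-monoʳ e q) (⊞-assoc⁻ e a (z ⊞ (b ⊞ c))))))
... | inj₂ (through {a} {b} {c} m₁ m₂ m₃ q) | inj₁ n′ =
  through⁺ s z t es (through m₁ m₂ (effects-trans es m₃ n′ ≼-refl)
    (≼-trans p (≼-trans (⊞-mono q ≼-refl) (λ i → ℤP.≤-reflexive (ring (a i) (z i) (b i) (c i) (f i))))))
  where
  ring : ∀ a z b c f → (a ℤ.+ (z ℤ.+ (b ℤ.+ c))) ℤ.+ f ≡ a ℤ.+ (z ℤ.+ (b ℤ.+ (c ℤ.+ f)))
  ring = solve-∀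
... | inj₂ (through {a} {b} {c} m₁ m₂ m₃ q) | inj₂ (through {a′} {b′} {c′} n₁ n₂ n₃ r) =
  through⁺ s z t es (through m₁
    (star-+ L m₂ (star-∷ L (⊗⁺ {S = effects es t s} (effects-trans es m₃ n₁ ≼-refl) (∈-⟨⟩ {e = z} ≼-refl) ≼-refl) n₂ ≼-refl) ≼-refl)
    n₃
    (≼-trans p (≼-trans (⊞-mono q r) (λ i → ℤP.≤-reflexive (ring (a i) (z i) (b i) (c i) (a′ i) (b′ i) (c′ i))))))
  where
  L = effects es t s ⊗ ⟨ z ⟩
  ring : ∀ a z b c a′ b′ c′ → (a ℤ.+ (z ℤ.+ (b ℤ.+ c))) ℤ.+ (a′ ℤ.+ (z ℤ.+ (b′ ℤ.+ c′)))
                            ≡ a ℤ.+ (z ℤ.+ ((b ℤ.+ (((c ℤ.+ a′) ℤ.+ z) ℤ.+ b′)) ℤ.+ c′))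
  ring = solve-∀

effects-edge : ∀ {k d} (es : List (Edge k d)) {x z y} → (x , z , y) ∈ es → z ∈ˢ effects es x y
effects-edge ((s , z , t) ∷ es) (here refl) =
  through⁺ s z t es (through (effects-refl es ≼-refl) (star-𝟎 (effects es t s ⊗ ⟨ z ⟩) ≼-refl) (effects-refl es ≼-refl)
    (λ i → ℤP.≤-reflexive (ring (z i))))
  where
  ring : ∀ z → z ≡ + 0 ℤ.+ (z ℤ.+ (+ 0 ℤ.+ + 0))
  ring = solve-∀
effects-edge (_ ∷ es) (there m) = ∈ˢ-⊆ ∈-++⁺ˡ (effects-edge es m)

effects-complete : ∀ {k d} (es : List (Edge k d)) {x y e} → Walk es x y e → e ∈ˢ effects es x y
effects-complete es (nil p)      = effects-refl es p
effects-complete es (cons m π p) = effects-trans es (effects-edge es m) (effects-complete es π) p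

-- Counter games

V : ℕ → Set
V d = Fin d → ℕ

infix 4 _≤ⱽ_

_≤ⱽ_ : ∀ {d} → V d → V d → Set
v ≤ⱽ w = ∀ i → v i ℕ.≤ w i

≤ⱽ-refl : ∀ {d} {v : V d} → v ≤ⱽ v
≤ⱽ-refl i = ℕP.≤-refl

ι : ∀ {d} → V d → Z d
ι v i = + v i

ι-mono : ∀ {d} {v w : V d} → v ≤ⱽ w → ι v ≼ ι w
ι-mono p i = +≤+ (p i)

-- A step may lose counter value, which makes winning monotone by construction.
Step : ∀ {d} → V d → Z d → V d → Set
Step v z v′ = ι v′ ≼ ι v ⊞ z

step-mono : ∀ {d} {v w : V d} z {v′} → v ≤ⱽ w → Step v z v′ → Step w z v′
step-mono z v≤w s = ≼-trans s (⊞-mono (ι-mono v≤w) (≼-refl {z = z}))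

-- At a state the opponent picks an option and Player 1 picks one of its moves;
-- the Boolean of an option tells whether taking it counts as a good event.
Option Game : ℕ → ℕ → Set
Option k d = Bool × List (Z d × Fin k)
Game k d = Fin k → List (Option k d)

module _ {k d} (G : Game k d) (P : Fin k → V d → Set) where

  -- Player 1 can force a good event (or a state without options) and be in P right after it.
  data Ind (q : Fin k) (v : V d) : Set
  data Choice (b : Bool) (ms : List (Z d × Fin k)) (v : V d) : Set
  data Next : Bool → Fin k → V d → Set

  data Ind q v where
    node : (∀ {b ms} → (b , ms) ∈ G q → Choice b ms v) → Ind q v

  data Choice b ms v where
    choice : ∀ {z q′ v′} → (z , q′) ∈ ms → Step v z v′ → Next b q′ v′ → Choice b ms v

  data Next where
    good : ∀ {q v} → P q v → Next true q v
    more : ∀ {q v} → Ind q v → Next false q v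

-- Player 1 forces infinitely many good events: the greatest fixed point of Ind.
record Win {k d} (G : Game k d) (q : Fin k) (v : V d) : Set₁ where
  field
    P      : Fin k → V d → Set
    closed : ∀ {q v} → P q v → Ind G P q v
    holds  : P q v

module _ {k d} {G : Game k d} where

  ind-up : ∀ {P : Fin k → V d → Set} {q v w} → v ≤ⱽ w → Ind G P q v → Ind G P q w
  ind-up v≤w (node f) = node λ m → up (f m)
    where
    up : ∀ {b ms} → Choice G _ b ms _ → Choice G _ b ms _
    up (choice {z} m s n) = choice m (step-mono z v≤w s) n

  mutual
    ind-map : ∀ {P P′ : Fin k → V d → Set} → (∀ {q v} → P q v → P′ q v) → ∀ {q v} → Ind G P q v → Ind G P′ q v
    ind-map f (node g) = node λ m → choice-map f (g m)

    choice-map : ∀ {P P′ : Fin k → V d → Set} → (∀ {q v} → P q v → P′ q v) → ∀ {b ms v} → Choice G P b ms v → Choice G P′ b ms v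
    choice-map f (choice m s (good p)) = choice m s (good (f p))
    choice-map f (choice m s (more i)) = choice m s (more (ind-map f i))

  ind⇒win : ∀ {P : Fin k → V d → Set} → (∀ {q v} → P q v → Ind G P q v) → ∀ {q v} → Ind G P q v → Win G q v
  ind⇒win {P} closed i = record { P = Ind G P ; closed = ind-map closed ; holds = i }

  win-up : ∀ {q v w} → v ≤ⱽ w → Win G q v → Win G q w
  win-up v≤w W = ind⇒win (Win.closed W) (ind-up v≤w (Win.closed W (Win.holds W)))

  -- The family must be indexed by a small type, as Win is large.
  win-merge : ∀ {I : Set} {q : I → Fin k} {v : I → V d} → (∀ i → Win G (q i) (v i)) →
              Σ (Fin k → V d → Set) λ P → (∀ {q v} → P q v → Ind G P q v) × (∀ i → P (q i) (v i))
  win-merge {I} W = (λ q v → Σ I λ i → Win.P (W i) q v) ,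
    (λ (i , p) → ind-map (i ,_) (Win.closed (W i) p)) , (λ i → i , Win.holds (W i))

ind-restrict : ∀ {k d} {G G′ : Game k d} {P} → (∀ {q o} → o ∈ G′ q → o ∈ G q) → ∀ {q v} → Ind G P q v → Ind G′ P q v
choice-restrict : ∀ {k d} {G G′ : Game k d} {P} → (∀ {q o} → o ∈ G′ q → o ∈ G q) → ∀ {b ms v} → Choice G P b ms v → Choice G′ P b ms v
ind-restrict r (node f) = node λ m → choice-restrict r (f (r m))
choice-restrict r (choice m s (good p)) = choice m s (good p)
choice-restrict r (choice m s (more i)) = choice m s (more (ind-restrict r i))

UnknownCredit : ∀ {k d} → Game k d → Fin k → Set₁
UnknownCredit G q = ∃ λ w → Win G q w

+-cancelˡ-≤ : ∀ u {a b} → u ℤ.+ a ℤ.≤ u ℤ.+ b → a ℤ.≤ b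
+-cancelˡ-≤ u {a} {b} p = ℤP.≤-trans (ℤP.≤-reflexive (sym (ring u a)))
  (ℤP.≤-trans (ℤP.+-monoʳ-≤ (ℤ.- u) p) (ℤP.≤-reflexive (ring u b)))
  where
  ring : ∀ u a → ℤ.- u ℤ.+ (u ℤ.+ a) ≡ a
  ring = solve-∀

≤∣∣ : ∀ z → z ℤ.≤ + ℤ.∣ z ∣
≤∣∣ (+ n)    = ℤP.≤-refl
≤∣∣ -[1+ n ] = -≤+

-- Games in which the opponent has no choice

module SinglePlayer {k d} (G : Game k d) (single : ∀ {q o o′} → o ∈ G q → o′ ∈ G q → o ≡ o′) where

  labelled : List (Bool × Edge k d)
  labelled = concatMap (λ q → concatMap (λ (b , ms) → map (λ (z , y) → b , q , z , y) ms) (G q)) (allFin k)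

  labelled⁺ : ∀ {b q z y ms} → (b , ms) ∈ G q → (z , y) ∈ ms → (b , q , z , y) ∈ labelled
  labelled⁺ {q = q} o m = ∈-concatMap⁺ _ (lose (∈-allFin q) (∈-concatMap⁺ _ (lose o (∈-map⁺ _ m))))

  labelled⁻ : ∀ {b q z y} → (b , q , z , y) ∈ labelled → ∃ λ ms → (b , ms) ∈ G q × (z , y) ∈ ms
  labelled⁻ m with find (∈-concatMap⁻ (λ q → concatMap (λ (b , ms) → map (λ (z , y) → b , q , z , y) ms) (G q)) {xs = allFin k} m)
  ... | q , _ , m₁ with find (∈-concatMap⁻ (λ (b , ms) → map (λ (z , y) → b , q , z , y) ms) {xs = G q} m₁)
  ... | (b , ms) , o , m₂ with ∈-map⁻ (λ (z , y) → b , q , z , y) m₂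
  ... | (z , y) , m₃ , refl = ms , o , m₃

  es : List (Edge k d)
  es = map proj₂ labelled

  es⁻ : ∀ {q z y} → (q , z , y) ∈ es → ∃₂ λ b ms → (b , ms) ∈ G q × (z , y) ∈ ms
  es⁻ m with ∈-map⁻ proj₂ m
  ... | (b , _) , m′ , refl = b , labelled⁻ m′

  resolve : ∀ {P q v b ms} → (b , ms) ∈ G q → Choice G P b ms v → Ind G P q v
  resolve o c = node λ o′ → subst (λ (b , ms) → Choice G _ b ms _) (single o o′) c

  Terminal : Fin k → Set
  Terminal y = G y ≡ []

  -- `(e , Q)` is one linear set of effects of walks from `t` back to `y`, so the good edge followed
  -- by such a walk is a lap with effect `z ⊞ e` plus periods. The base occurs again among the
  -- generators because several laps may be combined.
  Recurrent : Bool × Edge k d → Fin k → Set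
  Recurrent (b , g , z , t) y = b ≡ true × g ≡ y ×
    Any (λ (e , Q) → ∃ λ c → Comb (z ⊞ e ∷ Q) c × 𝟎 ≼ (z ⊞ e) ⊞ c) (effects es t y)

  Criterion : Fin k → Set
  Criterion q = ∃ λ y → Any (λ _ → ⊤) (effects es q y) × (Terminal y ⊎ Any (λ a → Recurrent a y) labelled)

  criterion? : ∀ q → Dec (Criterion q)
  criterion? q = FinP.any? λ y → Any.any? (λ _ → yes tt) _ ×-dec (terminal? (G y) ⊎-dec
    Any.any? (λ (b , g , z , t) → (b BoolP.≟ true) ×-dec ((g Fin.≟ y) ×-dec Any.any? (λ (e , Q) → recurrent? (z ⊞ e) Q) _)) _)
    where
    terminal? : ∀ {A : Set} (xs : List A) → Dec (xs ≡ [])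
    terminal? []      = yes refl
    terminal? (_ ∷ _) = no λ ()

  back : ∀ {q y e} → Walk es q y e → UnknownCredit G y → UnknownCredit G q
  back (nil _) u = u
  back (cons {z} {y} m π _) u with back π u | es⁻ m
  ... | w , W | b , ms , o , m′ = (λ i → w i ℕ.+ ℤ.∣ z i ∣) , ind⇒win (Win.closed W) (resolve o (choice m′ step (next b)))
    where
    step : Step (λ i → w i ℕ.+ ℤ.∣ z i ∣) z w
    step i = ℤP.≤-trans (ℤP.≤-reflexive (sym (ℤP.+-identityʳ (+ w i))))
      (ℤP.≤-trans (ℤP.+-monoʳ-≤ (+ w i) (0≤∣z∣+z (z i))) (ℤP.≤-reflexive (sym (ℤP.+-assoc (+ w i) (+ ℤ.∣ z i ∣) (z i)))))
      where
      0≤∣z∣+z : ∀ z → + 0 ℤ.≤ + ℤ.∣ z ∣ ℤ.+ z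
      0≤∣z∣+z (+ n)    = +≤+ z≤n
      0≤∣z∣+z -[1+ n ] = ℤP.≤-reflexive (sym (ℤP.+-inverseʳ (+ suc n)))
    next : ∀ b → Next G (Win.P W) b y w
    next true  = good (Win.holds W)
    next false = more (Win.closed W (Win.holds W))

  terminal-wins : ∀ {y} → Terminal y → UnknownCredit G y
  terminal-wins {y} t = (λ _ → 0) , record { P = λ q _ → q ≡ y ; closed = λ { refl → node (λ m → ⊥-elim (¬m m)) } ; holds = refl }
    where
    ¬m : ∀ {o} → ¬ o ∈ G y
    ¬m m with subst (_ ∈_) t m
    ... | ()

  -- A closed walk of nonnegative effect through a good edge can be repeated
  -- forever from any credit w bounding the effects of its suffixes.
  module Repeat {y z t e₀} (edge : (true , y , z , t) ∈ labelled) (π₀ : Walk es t y e₀) (0≼ : 𝟎 ≼ z ⊞ e₀) where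

    Fits : V d → ∀ {x e} → Walk es x y e → Set
    Fits w {e = e} (nil _)      = ⊤
    Fits w {e = e} (cons _ π _) = e ≼ ι w × Fits w π

    fits-mono : ∀ {w w′} → w ≤ⱽ w′ → ∀ {x e} (π : Walk es x y e) → Fits w π → Fits w′ π
    fits-mono p (nil _)      _       = tt
    fits-mono p (cons _ π _) (q , f) = ≼-trans q (ι-mono p) , fits-mono p π f

    credit : ∀ {x e} (π : Walk es x y e) → ∃ λ w → Fits w π
    credit (nil _) = (λ _ → 0) , tt
    credit {e = e} (cons _ π _) with credit π
    ... | w , f = (λ i → ℤ.∣ e i ∣ ℕ.+ w i) ,
      (λ i → ℤP.≤-trans (≤∣∣ (e i)) (+≤+ (ℕP.m≤m+n _ _))) , fits-mono (λ i → ℕP.m≤n+m _ _) π f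

    fits-head : ∀ {w x e} {π : Walk es x y e} → Fits w π → e ≼ ι w
    fits-head {π = nil p}      _ i = ℤP.≤-trans (p i) (+≤+ z≤n)
    fits-head {π = cons _ _ _} (q , _) = q

    w₀ : V d
    w₀ = proj₁ (credit π₀)

    Inv : Fin k → V d → Set
    Inv x v = ∃ λ e → Σ (Walk es x y e) λ π → Fits w₀ π × ι w₀ ≼ ι v ⊞ e

    -- With e a suffix effect and so e ≤ w₀, the invariant for v + z makes v + z nonnegative.
    advance : ∀ {v z e} → e ≼ ι w₀ → ι w₀ ≼ (ι v ⊞ z) ⊞ e → ∃ λ v′ → Step v z v′ × ι w₀ ≼ ι v′ ⊞ e
    advance {v} {z} {e} e≼ inv = (λ i → ℤ.∣ + v i ℤ.+ z i ∣) , (λ i → ℤP.≤-reflexive (exact i)) ,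
      (λ i → ℤP.≤-trans (inv i) (ℤP.≤-reflexive (cong (ℤ._+ e i) (sym (exact i)))))
      where
      exact : ∀ i → + ℤ.∣ + v i ℤ.+ z i ∣ ≡ + v i ℤ.+ z i
      exact i = ℤP.0≤i⇒+∣i∣≡i (ℤP.≤-trans (ℤP.i≤j⇒0≤j-i (ℤP.≤-trans (e≼ i) (inv i)))
        (ℤP.≤-reflexive (ring (+ v i ℤ.+ z i) (e i))))
        where
        ring : ∀ a e → (a ℤ.+ e) ℤ.- e ≡ a
        ring = solve-∀

    inv-nil : ∀ {v} → ι w₀ ≼ ι v → Inv y v
    inv-nil {v} p = 𝟎 , nil (≼-refl {z = 𝟎}) , tt , ≼-trans p (+-identityʳ-≼ (ι v))

    closed : ∀ {x v e} (π : Walk es x y e) → Fits w₀ π → ι w₀ ≼ ι v ⊞ e → Ind G Inv x v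
    closed {v = v} (nil e≼0) _ inv with labelled⁻ edge
    ... | ms , o , m with advance {v} {z} {e₀} (fits-head (proj₂ (credit π₀))) start
      where
      start : ι w₀ ≼ (ι v ⊞ z) ⊞ e₀
      start i = ℤP.≤-trans (inv i) (ℤP.≤-trans (ℤP.+-monoʳ-≤ (+ v i) (ℤP.≤-trans (e≼0 i) (0≼ i)))
        (ℤP.≤-reflexive (sym (ℤP.+-assoc (+ v i) (z i) (e₀ i)))))
    ... | v′ , s , inv′ = resolve o (choice m s (good (e₀ , π₀ , proj₂ (credit π₀) , inv′)))
    closed {v = v} (cons {z′} {x′} {e′ = e′} m π p) (_ , f) inv with es⁻ m | advance {v} {z′} {e′} (fits-head f)
            (≼-trans inv (≼-trans (⊞-monoʳ (ι v) p) (⊞-assoc⁻ (ι v) z′ e′)))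
    ... | true  , ms , o , m′ | v′ , s , inv′ = resolve o (choice m′ s (good (e′ , π , f , inv′)))
    ... | false , ms , o , m′ | v′ , s , inv′ = resolve o (choice m′ s (more (closed π f inv′)))

    wins : UnknownCredit G y
    wins = w₀ , record { P = Inv ; closed = λ (_ , π , f , inv) → closed π f inv ; holds = inv-nil (≼-refl {z = ι w₀}) }

  criterion⇒wins : ∀ {q} → Criterion q → UnknownCredit G q
  criterion⇒wins (y , a , t) with find a
  ... | l , l∈ , _ = back (effects-sound es (l , l∈ , base∈ l)) (base t)
    where
    base : Terminal y ⊎ Any (λ a → Recurrent a y) labelled → UnknownCredit G y
    base (inj₁ t) = terminal-wins t
    base (inj₂ r) with find r
    ... | (b , .y , z , t) , edge , refl , refl , r′ with find r′
    ... | (e , Q) , l∈ , c , cc , 0≼ with closing cc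
      where
      -- Each use of the generator `z ⊞ e` becomes a lap of its own along the base walk; the periods
      -- are collected in `c₁` and inserted into one single lap.
      closing : ∀ {c} → Comb (z ⊞ e ∷ Q) c → ∃₂ λ c₁ r → Comb Q c₁ × Walk es y y r × c ≼ c₁ ⊞ r
      closing (none p) = 𝟎 , 𝟎 , none (≼-refl {z = 𝟎}) , nil (≼-refl {z = 𝟎}) , p
      closing (add {g} m cc p) with closing cc
      closing (add {g} (there m) cc p) | c₁ , r , cc₁ , π , q =
        g ⊞ c₁ , r , add m cc₁ (≼-refl {z = g ⊞ c₁}) , π , ≼-trans p (≼-trans (⊞-monoʳ g q) (⊞-assoc⁻ g c₁ r))
      closing (add {g} (here refl) cc p) | c₁ , r , cc₁ , π , q =
        c₁ , (z ⊞ e) ⊞ r , cc₁ ,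
        cons (∈-map⁺ proj₂ edge) (walk-++ (effects-sound es (_ , l∈ , base∈ (e , Q))) π (≼-refl {z = e ⊞ r})) (⊞-assoc z e r) ,
        ≼-trans p (≼-trans (⊞-monoʳ g q) (λ i → ℤP.≤-reflexive (ring (z i ℤ.+ e i) (c₁ i) (r i))))
        where
        ring : ∀ g a b → g ℤ.+ (a ℤ.+ b) ≡ a ℤ.+ (g ℤ.+ b)
        ring = solve-∀
    ... | c₁ , r , cc₁ , π , q = Repeat.wins edge
      (walk-++ (effects-sound es (_ , l∈ , c₁ , cc₁ , ≼-refl {z = e ⊞ c₁})) π (≼-refl {z = (e ⊞ c₁) ⊞ r}))
      (λ i → ℤP.≤-trans (0≼ i) (ℤP.≤-trans (ℤP.+-monoʳ-≤ (z i ℤ.+ e i) (q i))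
        (ℤP.≤-reflexive (ring (z i) (e i) (c₁ i) (r i)))))
      where
      ring : ∀ z e a b → (z ℤ.+ e) ℤ.+ (a ℤ.+ b) ≡ z ℤ.+ ((e ℤ.+ a) ℤ.+ b)
      ring = solve-∀

  module Play {P : Fin k → V d → Set} (closed : ∀ {q v} → P q v → Ind G P q v) where

    Run : Fin k → V d → Fin k → V d → Set
    Run x v y u = ∃ λ e → Walk es x y e × ι u ≼ ι v ⊞ e

    run-refl : ∀ {x v} → Run x v x v
    run-refl {v = v} = 𝟎 , nil (≼-refl {z = 𝟎}) , +-identityʳ-≼ (ι v)

    run-trans : ∀ {x v y u w t} → Run x v y u → Run y u w t → Run x v w t
    run-trans {v = v} (e , π , p) (f , ρ , q) = e ⊞ f , walk-++ π ρ (≼-refl {z = e ⊞ f}) ,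
      ≼-trans q (≼-trans (⊞-mono p (≼-refl {z = f})) (⊞-assoc (ι v) e f))

    run-step : ∀ {b ms q z q′ v v′} → (b , ms) ∈ G q → (z , q′) ∈ ms → Step v z v′ → Run q v q′ v′
    run-step {z = z} o m s = z , cons (∈-map⁺ proj₂ (labelled⁺ o m)) (nil (≼-refl {z = 𝟎})) (+-identityʳ-≼ z) , s

    record GoodEvent (x : Fin k) (v : V d) : Set where
      constructor event
      field
        {g t} : Fin k
        {u u′} : V d
        {z}    : Z d
        run    : Run x v g u
        edge   : (true , g , z , t) ∈ labelled
        step   : Step u z u′
        inv    : P t u′

      point : Fin k × V d
      point = g , u

      past : Run x v t u′
      past with labelled⁻ edge
      ... | ms , o , m = run-trans run (run-step o m step)

    open GoodEvent

    prepend : ∀ {x v y u} → Run x v y u → GoodEvent y u → GoodEvent x v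
    prepend r E = event (run-trans r (run E)) (edge E) (step E) (inv E)

    Terminates : Fin k → V d → Set
    Terminates x v = ∃₂ λ y u → Run x v y u × Terminal y

    next : ∀ {x v} → Ind G P x v → Terminates x v ⊎ GoodEvent x v
    next {x} {v} (node f) = go (G x) refl
      where
      go : ∀ os → G x ≡ os → Terminates x v ⊎ GoodEvent x v
      go [] eq = inj₁ (x , v , run-refl , eq)
      go ((b , ms) ∷ _) eq with subst ((b , ms) ∈_) (sym eq) (here refl)
      ... | o with f o
      ... | choice m s (good p) = inj₂ (event run-refl (labelled⁺ o m) s p)
      ... | choice m s (more i) with next i
      ... | inj₁ (y , u , r , t) = inj₁ (y , u , run-trans (run-step o m s) r , t)
      ... | inj₂ E               = inj₂ (prepend (run-step o m s) E)

    -- Induction on the almost-full relation, fed with one good event at a time. Events are compared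
    -- at the configurations just before their good edges, so the stretch from `A` to `B` begins
    -- with the good edge of `A`; the search for `B` starts right after it.
    repetition : ∀ {R : Fin k × V d → Fin k × V d → Set} → AF R → ∀ {x v} → P x v →
                 Terminates x v ⊎ Σ (GoodEvent x v) λ A → Σ (GoodEvent (t A) (u′ A)) λ B → R (point A) (point B)
    repetition af p with next (closed p)
    ... | inj₁ T = inj₁ T
    repetition (AF.now r) p | inj₂ A with next (closed (inv A))
    ... | inj₁ (y , w , ρ , τ) = inj₁ (y , w , run-trans (past A) ρ , τ)
    ... | inj₂ B = inj₂ (A , B , r _ _)
    repetition (AF.later r) p | inj₂ A with repetition (r (point A)) (inv A)
    ... | inj₁ (y , w , ρ , τ) = inj₁ (y , w , run-trans (past A) ρ , τ)
    ... | inj₂ (A′ , B′ , inj₁ rel) = inj₂ (prepend (past A) A′ , B′ , rel)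
    ... | inj₂ (A′ , B′ , inj₂ rel) = inj₂ (A , A′ , rel)

    any-∈ˢ : ∀ {S : List (Linear d)} {e} → e ∈ˢ S → Any (λ _ → ⊤) S
    any-∈ˢ (_ , l∈ , _) = lose l∈ tt

    criterion : ∀ {x v} → P x v → Criterion x
    criterion p with repetition (dickson k d) p
    ... | inj₁ (y , _ , (_ , π , _) , τ) = y , any-∈ˢ (effects-complete es π) , inj₁ τ
    ... | inj₂ (event {g} {t} {u} {u′} {z} (_ , π , _) edge s _ , event {u = w} (e , ρ , q) _ _ _ , refl , u≤w)
      with effects-complete es ρ
    ... | (b , Q) , l∈ , c , cc , e≼ = g , any-∈ˢ (effects-complete es π) ,
      inj₂ (lose edge (refl , refl , lose l∈ (c , comb-⊆ there cc , λ i →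
        ℤP.≤-trans (+-cancelˡ-≤ (+ u i) (gain i)) (ℤP.≤-trans (ℤP.+-monoʳ-≤ (z i) (e≼ i))
          (ℤP.≤-reflexive (sym (ℤP.+-assoc (z i) (b i) (c i))))))))
      where
      gain : ∀ i → + u i ℤ.+ + 0 ℤ.≤ + u i ℤ.+ (z i ℤ.+ e i)
      gain i = ℤP.≤-trans (ℤP.≤-reflexive (ℤP.+-identityʳ (+ u i))) (ℤP.≤-trans (+≤+ (u≤w i)) (ℤP.≤-trans (q i)
        (ℤP.≤-trans (ℤP.+-monoˡ-≤ (e i) (s i)) (ℤP.≤-reflexive (ℤP.+-assoc (+ u i) (z i) (e i))))))

  unknownCredit? : ∀ q → Dec (UnknownCredit G q)
  unknownCredit? q = map′ criterion⇒wins (λ (_ , W) → Play.criterion (Win.closed W) (Win.holds W)) (criterion? q)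

-- Unknown initial credit

total : ∀ {n} → (Fin n → ℕ) → ℕ
total {zero}  f = 0
total {suc n} f = f zero ℕ.+ total (λ i → f (suc i))

total-mono : ∀ {n} {f g : Fin n → ℕ} → (∀ i → f i ℕ.≤ g i) → total f ℕ.≤ total g
total-mono {zero}  p = z≤n
total-mono {suc n} p = ℕP.+-mono-≤ (p zero) (total-mono (λ i → p (suc i)))

total-< : ∀ {n} {f g : Fin n → ℕ} i → (∀ i → f i ℕ.≤ g i) → f i ℕ.< g i → total f ℕ.< total g
total-< zero    p q = ℕP.+-mono-<-≤ q (total-mono (λ i → p (suc i)))
total-< (suc i) p q = ℕP.+-mono-≤-< (p zero) (total-< i (λ i → p (suc i)) q)

-- Two winning strategies for the games A and B, which split the options of G
-- at s, are interleaved: a play of G is a shuffle of a play of A and a play of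
-- B, one of them waiting at s, and the credits add up.
module Shuffle {k d} {G A B : Game k d} {s : Fin k}
  (coverᴬ : ∀ {x o} → o ∈ G x → o ∈ A x ⊎ (x ≡ s × o ∈ B s))
  (coverᴮ : ∀ {x o} → o ∈ G x → o ∈ B x ⊎ (x ≡ s × o ∈ A s))
  {Pᴬ Pᴮ : Fin k → V d → Set}
  (closedᴬ : ∀ {q v} → Pᴬ q v → Ind A Pᴬ q v)
  (closedᴮ : ∀ {q v} → Pᴮ q v → Ind B Pᴮ q v)
  where

  _⊎ⱽ_ : V d → V d → V d
  (v ⊎ⱽ w) i = v i ℕ.+ w i

  data Both (x : Fin k) (v : V d) : Set where
    inA : ∀ {a b} → a ⊎ⱽ b ≤ⱽ v → Ind A Pᴬ x a → Ind B Pᴮ s b → Both x v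
    inB : ∀ {a b} → a ⊎ⱽ b ≤ⱽ v → Ind A Pᴬ s a → Ind B Pᴮ x b → Both x v

  stepA : ∀ {a b v z a′} → a ⊎ⱽ b ≤ⱽ v → Step a z a′ → Step v z (a′ ⊎ⱽ b)
  stepA {a} {b} {v} {z} {a′} p st i = ℤP.≤-trans (ℤP.+-monoˡ-≤ (+ b i) (st i)) (ℤP.≤-trans
    (ℤP.≤-reflexive (ring (+ a i) (z i) (+ b i))) (ℤP.+-monoˡ-≤ (z i) (+≤+ (p i))))
    where
    ring : ∀ a z b → (a ℤ.+ z) ℤ.+ b ≡ (a ℤ.+ b) ℤ.+ z
    ring = solve-∀

  stepB : ∀ {a b v z b′} → a ⊎ⱽ b ≤ⱽ v → Step b z b′ → Step v z (a ⊎ⱽ b′)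
  stepB {a} {b} {v} {z} {b′} p st i = ℤP.≤-trans (ℤP.+-monoʳ-≤ (+ a i) (st i)) (ℤP.≤-trans
    (ℤP.≤-reflexive (sym (ℤP.+-assoc (+ a i) (+ b i) (z i)))) (ℤP.+-monoˡ-≤ (z i) (+≤+ (p i))))

  mutual
    goA : ∀ {x a b v} → a ⊎ⱽ b ≤ⱽ v → Ind A Pᴬ x a → Ind B Pᴮ s b → Ind G Both x v
    goA {x} {a} {b} {v} p (node f) (node g) = node λ m → by (coverᴬ m)
      where
      by : ∀ {c ms} → (c , ms) ∈ A x ⊎ (x ≡ s × (c , ms) ∈ B s) → Choice G Both c ms v
      by (inj₁ m)          = moveA p (f m) (node g)
      by (inj₂ (refl , m)) = moveB p (node f) (g m)

    goB : ∀ {x a b v} → a ⊎ⱽ b ≤ⱽ v → Ind A Pᴬ s a → Ind B Pᴮ x b → Ind G Both x v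
    goB {x} {a} {b} {v} p (node f) (node g) = node λ m → by (coverᴮ m)
      where
      by : ∀ {c ms} → (c , ms) ∈ B x ⊎ (x ≡ s × (c , ms) ∈ A s) → Choice G Both c ms v
      by (inj₁ m)          = moveB p (node f) (g m)
      by (inj₂ (refl , m)) = moveA p (f m) (node g)

    moveA : ∀ {a b v c ms} → a ⊎ⱽ b ≤ⱽ v → Choice A Pᴬ c ms a → Ind B Pᴮ s b → Choice G Both c ms v
    moveA {a} {b} {v} p (choice {z} {_} {a′} m st (good q)) j =
      choice m (stepA {a} {b} {v} {z} {a′} p st) (good (inA (≤ⱽ-refl {v = a′ ⊎ⱽ b}) (closedᴬ q) j))
    moveA {a} {b} {v} p (choice {z} {_} {a′} m st (more i)) j =
      choice m (stepA {a} {b} {v} {z} {a′} p st) (more (goA (≤ⱽ-refl {v = a′ ⊎ⱽ b}) i j))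

    moveB : ∀ {a b v c ms} → a ⊎ⱽ b ≤ⱽ v → Ind A Pᴬ s a → Choice B Pᴮ c ms b → Choice G Both c ms v
    moveB {a} {b} {v} p i (choice {z} {_} {b′} m st (good q)) =
      choice m (stepB {a} {b} {v} {z} {b′} p st) (good (inB (≤ⱽ-refl {v = a ⊎ⱽ b′}) i (closedᴮ q)))
    moveB {a} {b} {v} p i (choice {z} {_} {b′} m st (more j)) =
      choice m (stepB {a} {b} {v} {z} {b′} p st) (more (goB (≤ⱽ-refl {v = a ⊎ⱽ b′}) i j))

  both-closed : ∀ {x v} → Both x v → Ind G Both x v
  both-closed (inA p i j) = goA p i j
  both-closed (inB p i j) = goB p i j

module _ {k d} {G A : Game k d} {s : Fin k} (elsewhere : ∀ {x o} → x ≢ s → o ∈ G x → o ∈ A x) where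

  private
    avoid : ∀ {P} → (∀ {v} → ¬ Ind A P s v) → ∀ {x v} → Ind A P x v → Ind G P x v
    avoidᶜ : ∀ {P} → (∀ {v} → ¬ Ind A P s v) → ∀ {b ms v} → Choice A P b ms v → Choice G P b ms v
    avoid ¬s {x} (node f) with x Fin.≟ s
    ... | yes refl = ⊥-elim (¬s (node f))
    ... | no  x≢s  = node λ m → avoidᶜ ¬s (f (elsewhere x≢s m))
    avoidᶜ ¬s (choice m st (good p)) = choice m st (good p)
    avoidᶜ ¬s (choice m st (more i)) = choice m st (more (avoid ¬s i))

  -- A strategy that wins in `A` never visits `s`, since no credit wins there; so the options that
  -- only `G` has at `s` are never met.
  avoiding : ¬ UnknownCredit A s → ∀ {q} → UnknownCredit A q → UnknownCredit G q
  avoiding ¬s (w , W) = w , record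
    { P = Win.P W
    ; closed = λ p → avoid (λ i → ¬s (_ , ind⇒win (Win.closed W) i)) (Win.closed W p)
    ; holds = Win.holds W }

module _ {k d} {G A B : Game k d} {s : Fin k}
  (coverᴬ : ∀ {x o} → o ∈ G x → o ∈ A x ⊎ (x ≡ s × o ∈ B s))
  (coverᴮ : ∀ {x o} → o ∈ G x → o ∈ B x ⊎ (x ≡ s × o ∈ A s)) where

  shuffle : UnknownCredit A s → UnknownCredit B s → ∀ {q} → UnknownCredit A q → UnknownCredit G q
  shuffle (a , Wᴬ) (b , Wᴮ) {q} (c , W) with win-merge {I = Bool} {q = λ { false → s ; true → q }} {v = λ { false → a ; true → c }}
                                              (λ { false → Wᴬ ; true → W })
  ... | P , closed , holds = (λ i → c i ℕ.+ b i) , record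
    { P = Both ; closed = both-closed
    ; holds = inA (λ i → ℕP.≤-refl) (closed (holds true)) (Win.closed Wᴮ (Win.holds Wᴮ)) }
    where open Shuffle coverᴬ coverᴮ {P} {Win.P Wᴮ} closed (Win.closed Wᴮ)

_[_↦_] : ∀ {k d} → Game k d → Fin k → List (Option k d) → Game k d
(G [ s ↦ os ]) q with q Fin.≟ s
... | yes _ = os
... | no  _ = G q

module _ {k d} {G : Game k d} {s : Fin k} {os : List (Option k d)} where

  update-⊆ : (∀ {o} → o ∈ os → o ∈ G s) → ∀ {x o} → o ∈ (G [ s ↦ os ]) x → o ∈ G x
  update-⊆ f {x} m with x Fin.≟ s
  ... | yes refl = f m
  ... | no  _    = m

  update-≢ : ∀ {x o} → x ≢ s → o ∈ G x → o ∈ (G [ s ↦ os ]) x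
  update-≢ {x} x≢s m with x Fin.≟ s
  ... | yes x≡s = ⊥-elim (x≢s x≡s)
  ... | no  _   = m

  update-≡ : ∀ {o} → o ∈ os → o ∈ (G [ s ↦ os ]) s
  update-≡ m with s Fin.≟ s
  ... | yes _   = m
  ... | no  s≢s = ⊥-elim (s≢s refl)

  update-total : length os ℕ.< length (G s) → total (λ x → length ((G [ s ↦ os ]) x)) ℕ.< total (λ x → length (G x))
  update-total lt = total-< s le lt′
    where
    le : ∀ x → length ((G [ s ↦ os ]) x) ℕ.≤ length (G x)
    le x with x Fin.≟ s
    ... | yes refl = ℕP.<⇒≤ lt
    ... | no  _    = ℕP.≤-refl
    lt′ : length ((G [ s ↦ os ]) s) ℕ.< length (G s)
    lt′ with s Fin.≟ s
    ... | yes _   = lt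
    ... | no  s≢s = ⊥-elim (s≢s refl)

-- Induction on the number of options: those of a state `s` with at least two are split into the
-- first, in `A`, and the rest, in `B`. If one of these games is lost from `s` with every credit, it
-- has the same winning states as `G`. Otherwise winning strategies are shuffled, and `A` has the
-- same winning states as `G`.
unknownCredit? : ∀ {k d} (G : Game k d) q → Dec (UnknownCredit G q)
unknownCredit? {k} {d} G = go _ G ℕP.≤-refl
  where
  restrict : ∀ {G G′ : Game k d} → (∀ {x o} → o ∈ G′ x → o ∈ G x) → ∀ {q} → UnknownCredit G q → UnknownCredit G′ q
  restrict r (w , W) = w , record { P = Win.P W ; closed = λ p → ind-restrict r (Win.closed W p) ; holds = Win.holds W }

  go : ∀ n (G : Game k d) → total (λ x → length (G x)) ℕ.≤ n → ∀ q → Dec (UnknownCredit G q)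
  branch : ∀ n (G : Game k d) → total (λ x → length (G x)) ℕ.≤ suc n → ∀ s {o o′ os} → G s ≡ o ∷ o′ ∷ os → ∀ q → Dec (UnknownCredit G q)

  go n G le with FinP.any? (λ s → 2 ℕ.≤? length (G s))
  go n G le | no ¬2 = SinglePlayer.unknownCredit? G (λ {q} m m′ → only (λ 2≤ → ¬2 (q , 2≤)) m m′)
    where
    only : ∀ {os : List (Option k d)} → ¬ 2 ℕ.≤ length os → ∀ {o o′} → o ∈ os → o′ ∈ os → o ≡ o′
    only {_ ∷ []}    _  (here refl) (here refl) = refl
    only {_ ∷ _ ∷ _} ¬2 _           _           = ⊥-elim (¬2 (s≤s (s≤s z≤n)))
  go n G le | yes (s , 2≤) with G s in eq
  go zero    G le | yes (s , 2≤)   | o ∷ o′ ∷ os =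
    ⊥-elim (ℕP.n≮0 (ℕP.≤-trans (update-total {G = G} {s} {[]} (subst (λ l → 0 ℕ.< length l) (sym eq) (s≤s z≤n))) le))
  go (suc n) G le | yes (s , 2≤)   | o ∷ o′ ∷ os = branch n G le s eq
  go n       G le | yes (s , s≤s ()) | _ ∷ []

  branch n G le s {o} {o′} {os} eq q = decide (decA s) (decB s) (decA q) (decB q)
    where
    A B : Game k d
    A = G [ s ↦ o ∷ [] ]
    B = G [ s ↦ o′ ∷ os ]
    A⊆ : ∀ {x o} → o ∈ A x → o ∈ G x
    A⊆ = update-⊆ {G = G} (λ { (here refl) → subst (_ ∈_) (sym eq) (here refl) })
    B⊆ : ∀ {x o} → o ∈ B x → o ∈ G x
    B⊆ = update-⊆ {G = G} (λ m → subst (_ ∈_) (sym eq) (there m))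
    decA : ∀ q → Dec (UnknownCredit A q)
    decA = go n A (ℕP.≤-pred (ℕP.≤-trans (update-total {G = G} (subst (λ l → 1 ℕ.< length l) (sym eq) (s≤s (s≤s z≤n)))) le))
    decB : ∀ q → Dec (UnknownCredit B q)
    decB = go n B (ℕP.≤-pred (ℕP.≤-trans (update-total {G = G} (subst (λ l → length (o′ ∷ os) ℕ.< length l) (sym eq) ℕP.≤-refl)) le))
    coverᴬ : ∀ {x p} → p ∈ G x → p ∈ A x ⊎ (x ≡ s × p ∈ B s)
    coverᴬ {x} m with x Fin.≟ s
    ... | no _ = inj₁ m
    ... | yes refl with subst (_ ∈_) eq m
    ... | here refl = inj₁ (here refl)
    ... | there m′  = inj₂ (refl , update-≡ {G = G} {s} m′)
    coverᴮ : ∀ {x p} → p ∈ G x → p ∈ B x ⊎ (x ≡ s × p ∈ A s)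
    coverᴮ {x} m with x Fin.≟ s
    ... | no _ = inj₁ m
    ... | yes refl with subst (_ ∈_) eq m
    ... | here refl = inj₂ (refl , update-≡ {G = G} {s} {o ∷ []} (here refl))
    ... | there m′  = inj₁ m′
    decide : Dec (UnknownCredit A s) → Dec (UnknownCredit B s) → Dec (UnknownCredit A q) → Dec (UnknownCredit B q) → Dec (UnknownCredit G q)
    decide (no ¬a) _       a _ = map′ (avoiding (update-≢ {G = G}) ¬a) (restrict A⊆) a
    decide (yes _) (no ¬b) _ b = map′ (avoiding (update-≢ {G = G}) ¬b) (restrict B⊆) b
    decide (yes a) (yes b) c _ = map′ (shuffle coverᴬ coverᴮ a b) (restrict A⊆) c

-- Boxes with unbounded coordinates

Mask : ℕ → Set
Mask d = Fin d → Bool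

-- Comparison on the coordinates of m only; the other ones play the role of ω.
_≤[_]_ : ∀ {d} → V d → Mask d → V d → Set
w ≤[ m ] v = ∀ i → m i ≡ true → w i ℕ.≤ v i

_∖_ : ∀ {d} → Mask d → Fin d → Mask d
m ∖ i = updateAt m i (const false)

∖-⊆ : ∀ {d} {m : Mask d} i j → (m ∖ i) j ≡ true → m j ≡ true × j ≢ i
∖-⊆ {m = m} i j eq with j Fin.≟ i
... | no  j≢i  = trans (sym (updateAt-minimal j i m j≢i)) eq , j≢i
... | yes refl with trans (sym (updateAt-updates i m)) eq
... | ()

∖-⊇ : ∀ {d} {m : Mask d} i j → m j ≡ true → j ≢ i → (m ∖ i) j ≡ true
∖-⊇ {m = m} i j eq j≢i = trans (updateAt-minimal j i m j≢i) eq

indicator : Bool → ℕ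
indicator b = if b then 1 else 0

indicator-mono : ∀ {a b} → (a ≡ true → b ≡ true) → indicator a ℕ.≤ indicator b
indicator-mono {false} f = z≤n
indicator-mono {true}  f rewrite f refl = ℕP.≤-refl

indicator-< : ∀ {a b} → a ≡ false → b ≡ true → indicator a ℕ.< indicator b
indicator-< refl refl = s≤s z≤n

size : ∀ {d} → Mask d → ℕ
size m = total (λ i → indicator (m i))

size-< : ∀ {d} {m m′ : Mask d} i → (∀ j → m j ≡ true → m′ j ≡ true) → m i ≡ false → m′ i ≡ true → size m ℕ.< size m′
size-< i sub f t = total-< i (λ j → indicator-mono (sub j)) (indicator-< f t)

maximum : ∀ {ℓ n} {Q : Fin n → ℕ → Set ℓ} → (∀ i {a b} → a ℕ.≤ b → Q i a → Q i b) → (∀ i → ∃ (Q i)) → ∃ λ N → ∀ i → Q i N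
maximum {n = zero}  up f = 0 , λ ()
maximum {n = suc n} up f with f zero | maximum (λ i → up (suc i)) (λ i → f (suc i))
... | a , q | b , qs = a ℕ.+ b , λ { zero → up zero (ℕP.m≤m+n a b) q ; (suc i) → up (suc i) (ℕP.m≤n+m b a) (qs i) }

-- Bounding a monotone requirement R uniformly over U, given answers to all
-- queries "does U meet this box" (after Valk and Jantzen): below a member u of
-- U, some coordinate takes one of finitely many values, which is then fixed.
module _ {a b : Level} {d} {U : V d → Set a} {R : ℕ → V d → Set b}
  (up : ∀ {n n′ v v′} → n ℕ.≤ n′ → v ≤ⱽ v′ → R n v → R n′ v′)
  (meets? : ∀ m v → Dec (∃ λ u → u ≤[ m ] v × U u))
  (bounded : ∀ {v} → U v → ∃ λ n → R n v) where

  private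
    Agree : Mask d → V d → V d → Set
    Agree m v w = ∀ i → m i ≡ true → w i ≡ v i

    In : Mask d → V d → ℕ → Set _
    In m v N = ∀ w → Agree m v w → U w → R N w

    in-up : ∀ m v {N N′} → N ℕ.≤ N′ → In m v N → In m v N′
    in-up m v le f w ag uw = up le (λ _ → ℕP.≤-refl) (f w ag uw)

    fix : Mask d → Fin d → Mask d
    fix m i = updateAt m i (const true)

    Below : Mask d → V d → V d → Fin d → ℕ → Set _
    Below m v u i N = m i ≡ false → ∀ (c : Fin (u i)) → In (fix m i) (updateAt v i (const (Fin.toℕ c))) N

    fix-size : ∀ m i → m i ≡ false → size (λ j → not (fix m i j)) ℕ.< size (λ j → not (m j))
    fix-size m i eq = size-< i sub (cong not (updateAt-updates i m)) (cong not eq)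
      where
      sub : ∀ j → not (fix m i j) ≡ true → not (m j) ≡ true
      sub j e with j Fin.≟ i
      ... | yes refl = cong not eq
      ... | no j≢i   = trans (cong not (sym (updateAt-minimal j i m j≢i))) e

    claim   : ∀ fuel m v → size (λ i → not (m i)) ℕ.≤ fuel → ∃ (In m v)
    descend : ∀ fuel m v → size (λ i → not (m i)) ℕ.≤ fuel → ∀ u i → ∃ (Below m v u i)

    descend fuel m v le u i with m i in eq
    descend fuel m v le u i | true = 0 , λ ()
    descend zero m v le u i | false = ⊥-elim (ℕP.n≮0 (ℕP.≤-trans (fix-size m i eq) le))
    descend (suc fuel) m v le u i | false
      with maximum {Q = λ c → In (fix m i) (updateAt v i (const (Fin.toℕ c)))} (λ c → in-up _ _)
             (λ c → claim fuel (fix m i) (updateAt v i (const (Fin.toℕ c))) (ℕP.≤-pred (ℕP.≤-trans (fix-size m i eq) le)))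
    ... | N , f = N , λ _ → f

    claim fuel m v le with meets? m v
    ... | no ¬u = 0 , λ w ag uw → ⊥-elim (¬u (w , (λ i mi → ℕP.≤-reflexive (ag i mi)) , uw))
    ... | yes (u , u≤v , uu) with bounded uu | maximum {Q = Below m v u} (λ i le q f c → in-up _ _ le (q f c)) (descend fuel m v le u)
    ... | n , r | N , f = n ℕ.+ N , λ w ag uw → cases w ag uw (FinP.any? (λ i → w i ℕ.<? u i))
      where
      cases : ∀ w → Agree m v w → U w → Dec (∃ λ i → w i ℕ.< u i) → R (n ℕ.+ N) w
      cases w ag uw (no ¬lt) = up (ℕP.m≤m+n n N) (λ i → ℕP.≮⇒≥ (λ lt → ¬lt (i , lt))) r
      cases w ag uw (yes (i , lt)) with m i in eq
      ... | true = ⊥-elim (ℕP.<⇒≱ lt (ℕP.≤-trans (u≤v i eq) (ℕP.≤-reflexive (sym (ag i eq)))))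
      ... | false = up (ℕP.m≤n+m N n) (λ _ → ℕP.≤-refl) (f i eq (Fin.fromℕ< lt) w ag′ uw)
        where
        ag′ : Agree (fix m i) (updateAt v i (const (Fin.toℕ (Fin.fromℕ< lt)))) w
        ag′ j e with j Fin.≟ i
        ... | yes refl = sym (trans (updateAt-updates i v) (FinP.toℕ-fromℕ< lt))
        ... | no j≢i = trans (ag j (trans (sym (updateAt-minimal j i m j≢i)) e)) (sym (updateAt-minimal j i v j≢i))

  uniform : ∃ λ N → ∀ v → U v → R N v
  uniform with claim _ (const false) (const 0) ℕP.≤-refl
  ... | N , f = N , λ v → f v (λ _ ())

-- Known initial credit

WinsWithin : ∀ {k d} → Game k d → Fin k → Mask d → V d → Set₁
WinsWithin G q m v = ∃ λ w → w ≤[ m ] v × Win G q w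

module Capped {k d} (G : Game k d) (m : Mask d)
  (smaller? : ∀ m′ → size m′ ℕ.< size m → ∀ q v → Dec (WinsWithin G q m′ v)) where

  ∖-size : ∀ i → m i ≡ true → ∀ {m′ : Mask d} → (∀ j → m′ j ≡ true → (m ∖ i) j ≡ true) → size m′ ℕ.< size m
  ∖-size i mi {m′} sub = size-< i (λ j e → proj₁ (∖-⊆ i j (sub j e))) (false-at (m′ i) refl) mi
    where
    false-at : ∀ b → m′ i ≡ b → m′ i ≡ false
    false-at false e = e
    false-at true  e = ⊥-elim (proj₂ (∖-⊆ i i (sub i e)) refl)

  Low : Fin d → Fin k → ℕ → Set₁
  Low i q N = m i ≡ true → ∀ v → WinsWithin G q (m ∖ i) v → ∃ λ w → w ≤[ m ∖ i ] v × w i ℕ.≤ N × Win G q w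

  low-up : ∀ {i q a b} → a ℕ.≤ b → Low i q a → Low i q b
  low-up le f mi v e with f mi v e
  ... | w , p , wi , W = w , p , ℕP.≤-trans wi le , W

  -- The bound `uniform` is applied to the region won with `i` forgotten. Whether that region meets
  -- a box is itself a winning query: a coordinate is free if the region forgets it or the box
  -- ignores it, so the query has the intersection of both masks, which lacks `i` and is smaller
  -- than `m`.
  low : ∀ i q → ∃ (Low i q)
  low i q with m i in eq
  ... | false = 0 , λ ()
  ... | true with uniform {U = WinsWithin G q (m ∖ i)} {R = λ n v → ∃ λ w → w ≤[ m ∖ i ] v × w i ℕ.≤ n × Win G q w}
       (λ le v≤ (w , p , wi , W) → w , (λ j e → ℕP.≤-trans (p j e) (v≤ j)) , ℕP.≤-trans wi le , W)
       meets? (λ (w , p , W) → w i , w , p , ℕP.≤-refl , W)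
    where
    meets? : ∀ m′ v → Dec (∃ λ u → u ≤[ m′ ] v × WinsWithin G q (m ∖ i) u)
    meets? m′ v = map′ to from (smaller? both (∖-size i eq (λ j e → proj₁ (∧⁻ j e))) q v)
      where
      both : Mask d
      both j = (m ∖ i) j ∧ m′ j
      ∧⁻ : ∀ j → both j ≡ true → (m ∖ i) j ≡ true × m′ j ≡ true
      ∧⁻ j e with (m ∖ i) j | m′ j
      ... | true | true = refl , refl
      ∧⁺ : ∀ {a b} → a ≡ true → b ≡ true → a ∧ b ≡ true
      ∧⁺ refl refl = refl
      to : WinsWithin G q both v → ∃ λ u → u ≤[ m′ ] v × WinsWithin G q (m ∖ i) u
      to (w , p , W) = (λ j → if (m ∖ i) j then w j else 0) , below , w , within , W
        where
        below : (λ j → if (m ∖ i) j then w j else 0) ≤[ m′ ] v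
        below j e with (m ∖ i) j in e′
        ... | true  = p j (∧⁺ e′ e)
        ... | false = z≤n
        within : w ≤[ m ∖ i ] (λ j → if (m ∖ i) j then w j else 0)
        within j e rewrite e = ℕP.≤-refl
      from : (∃ λ u → u ≤[ m′ ] v × WinsWithin G q (m ∖ i) u) → WinsWithin G q both v
      from (u , u≤v , w , w≤u , W) = w , (λ j e → ℕP.≤-trans (w≤u j (proj₁ (∧⁻ j e))) (u≤v j (proj₂ (∧⁻ j e)))) , W
  ... | N , f = N , λ _ → f

  abstract
    threshold : ∃ λ N → ∀ i q → Low i q N
    threshold = maximum {Q = λ i N → ∀ q → Low i q N} (λ i le f q → low-up le (f q)) (λ i → maximum (λ q → low-up) (low i))

  H : ℕ
  H = proj₁ threshold

  abstract
    -- Credit above H never helps on the coordinates of m.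
    trim : ∀ {q w} → Win G q w → ∃ λ w′ → Win G q w′ × w′ ≤[ m ] w × w′ ≤[ m ] const H
    trim {q} {w} W with on (allFin d)
      where
      on : ∀ (is : List (Fin d)) → ∃ λ w′ → Win G q w′ × w′ ≤[ m ] w × (∀ j → m j ≡ true → j ∈ is → w′ j ℕ.≤ H)
      on [] = w , W , (λ _ _ → ℕP.≤-refl) , λ _ _ ()
      on (i ∷ is) with on is
      ... | u , U , u≤w , u≤H with u i ℕ.≤? H | m i in mi
      ... | yes ui≤H | _     = u , U , u≤w , λ { j mj (here refl) → ui≤H ; j mj (there j∈) → u≤H j mj j∈ }
      ... | no  _    | false = u , U , u≤w , λ { j mj (here refl) → ⊥-elim (false≢true (trans (sym mi) mj)) ; j mj (there j∈) → u≤H j mj j∈ }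
        where
        false≢true : false ≢ true
        false≢true ()
      ... | no  ui≰H | true with proj₂ threshold i q mi u (u , (λ _ _ → ℕP.≤-refl) , U)
      ... | w′ , w′≤u , w′i≤H , W′ = w′ , W′ , (λ j mj → ℕP.≤-trans (le j mj) (u≤w j mj)) , λ
          { j mj (here refl) → w′i≤H
          ; j mj (there j∈)  → ℕP.≤-trans (le j mj) (u≤H j mj j∈) }
        where
        le : w′ ≤[ m ] u
        le j mj with j Fin.≟ i
        ... | yes refl = ℕP.≤-trans w′i≤H (ℕP.<⇒≤ (ℕP.≰⇒> ui≰H))
        ... | no  j≢i  = w′≤u j (∖-⊇ i j mj j≢i)
    ... | w′ , W′ , w′≤w , w′≤H = w′ , W′ , w′≤w , λ j mj → w′≤H j mj (∈-allFin j)

  K : ℕ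
  K = k ℕ.* suc H ℕ.^ d

  abstract
    encode : Fin k → (Fin d → Fin (suc H)) → Fin K
    encode q u = Fin.combine q (Fin.funToFin u)

    state : Fin K → Fin k
    state x = proj₁ (Fin.remQuot {k} (suc H ℕ.^ d) x)

    value : Fin K → V d
    value x i = Fin.toℕ (Fin.finToFun {suc H} {d} (proj₂ (Fin.remQuot {k} (suc H ℕ.^ d) x)) i)

    state-encode : ∀ q u → state (encode q u) ≡ q
    state-encode q u = cong proj₁ (FinP.remQuot-combine {k} {suc H ℕ.^ d} q (Fin.funToFin u))

    value-encode : ∀ q u i → value (encode q u) i ≡ Fin.toℕ (u i)
    value-encode q u i = trans
      (cong (λ c → Fin.toℕ (Fin.finToFun {suc H} {d} (proj₂ c) i)) (FinP.remQuot-combine {k} {suc H ℕ.^ d} q (Fin.funToFin u)))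
      (cong Fin.toℕ (FinP.finToFun-funToFin u i))

    cap : V d → Fin d → Fin (suc H)
    cap v i = Fin.fromℕ< (s≤s (ℕP.m⊓n≤n (v i) H))

    toℕ-cap : ∀ v i → Fin.toℕ (cap v i) ≡ v i ⊓ H
    toℕ-cap v i = FinP.toℕ-fromℕ< (s≤s (ℕP.m⊓n≤n (v i) H))

    value-cap : ∀ q v i → value (encode q (cap v)) i ≡ v i ⊓ H
    value-cap q v i = trans (value-encode q (cap v) i) (toℕ-cap v i)

  Within : Fin K → Set₁
  Within x = WinsWithin G (state x) m (value x)

  Hit : Fin K → Set
  Hit x = ∃ λ i → m i ≡ true × H ℕ.≤ value x i

  hit? : ∀ x → Dec (Hit x)
  hit? x = FinP.any? (λ i → (m i BoolP.≟ true) ×-dec (H ℕ.≤? value x i))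

  data View (x : Fin K) : Set₁ where
    won  : Within x → View x
    lost : ¬ Within x → View x
    undecided : ¬ Hit x → View x

  -- When the stored value at `i` has reached `H`, forgetting `i` costs nothing: the threshold
  -- provides a winning vector with at most `H` there, which still lies below the stored value.
  verdict : ∀ x → Hit x → Dec (Within x)
  verdict x (i , mi , H≤) = map′ to from (smaller? (m ∖ i) (∖-size i mi (λ _ e → e)) (state x) (value x))
    where
    to : WinsWithin G (state x) (m ∖ i) (value x) → Within x
    to e with proj₂ threshold i (state x) mi (value x) e
    ... | w , w≤ , wi≤H , W = w , le , W
      where
      le : w ≤[ m ] value x
      le j mj with j Fin.≟ i
      ... | yes refl = ℕP.≤-trans wi≤H H≤
      ... | no  j≢i  = w≤ j (∖-⊇ i j mj j≢i)
    from : Within x → WinsWithin G (state x) (m ∖ i) (value x)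
    from (w , w≤ , W) = w , (λ j e → w≤ j (proj₁ (∖-⊆ i j e))) , W

  abstract
    view : ∀ x → View x
    view x with hit? x
    ... | no ¬h = undecided ¬h
    ... | yes h with verdict x h
    ... | yes e = won e
    ... | no ¬e = lost ¬e

  Legal : V d → Z d → Set
  Legal u z = ∀ i → m i ≡ true → + 0 ℤ.≤ + u i ℤ.+ z i

  legal? : ∀ u z → Dec (Legal u z)
  legal? u z = FinP.all? (λ i → (m i BoolP.≟ true) →-dec (+ 0 ℤ.≤? + u i ℤ.+ z i))

  moved : V d → Z d → V d
  moved u z i = ℤ.∣ + u i ℤ.+ z i ∣

  outside : Z d → Z d
  outside z i = if m i then + 0 else z i

  move : V d → Z d × Fin k → Z d × Fin K
  move u (z , q) = outside z , encode q (cap (moved u z))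

  moves : V d → List (Z d × Fin k) → List (Z d × Fin K)
  moves u ms = map (move u) (filter (λ (z , _) → legal? u z) ms)

  -- A state without options is won at once, since the opponent has nothing to ask; an option
  -- without moves is lost, since Player 1 cannot answer it. These encode the two verdicts.
  options : ∀ x → View x → List (Option K d)
  options x (won _)  = []
  options x (lost _) = (false , []) ∷ []
  options x (undecided _) = map (λ (b , ms) → b , moves (value x) ms) (G (state x))

  -- The coordinates of m become part of the state, up to the threshold H;
  -- beyond it a query with one coordinate less tells the winner.
  C : Game K d
  C x = options x (view x)

  IsWon : ∀ {x} → View x → Set
  IsWon (won _)   = ⊤
  IsWon (lost _)  = ⊥
  IsWon (undecided _) = ⊥

  won⇒ind : ∀ {P x w} → IsWon (view x) → Ind C P x w
  won⇒ind {P} {x} {w} t = node (go (view x) t)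
    where
    go : (vw : View x) → IsWon vw → ∀ {b ms} → (b , ms) ∈ options x vw → Choice C P b ms w
    go (won _) _ ()

  ∁ : Mask d
  ∁ i = not (m i)

  legal⇒moved : ∀ {u z} → Legal u z → ∀ i → m i ≡ true → + moved u z i ≡ + u i ℤ.+ z i
  legal⇒moved L i mi = ℤP.0≤i⇒+∣i∣≡i (L i mi)

  module Project {P : Fin k → V d → Set} (closed : ∀ {q v} → P q v → Ind G P q v) where

    Covered : Fin K → V d → Set
    Covered x w = ∃ λ v → Ind G P (state x) v × v ≤[ m ] value x × v ≤[ ∁ ] w

    Inv : Fin K → V d → Set
    Inv x w = IsWon (view x) ⊎ Covered x w

    -- Capping at `H` can spoil the bound only at a state that has been hit, and there the verdict
    -- replaces it: a verdict of loss would contradict `trim`, which lowers any winning vector to at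
    -- most `H`. At an undecided state all values on `m` are below `H`, so the cap changed nothing.
    arrive : ∀ {q v u} → Ind G P q v → v ≤[ m ] u → let x = encode q (cap u) in IsWon (view x) ⊎ v ≤[ m ] value x
    arrive {q} {v} {u} i v≤u = go (view x)
      where
      x = encode q (cap u)
      go : (vw : View x) → IsWon vw ⊎ v ≤[ m ] value x
      go (won _)   = inj₁ tt
      go (lost ¬e) with trim (ind⇒win closed i)
      ... | w , W , w≤v , w≤H = ⊥-elim (¬e (w ,
        (λ j mj → subst (w j ℕ.≤_) (sym (value-cap q u j)) (ℕP.⊓-glb (ℕP.≤-trans (w≤v j mj) (v≤u j mj)) (w≤H j mj))) ,
        subst (λ q → Win G q w) (sym (state-encode q (cap u))) W))
      go (undecided ¬h) = inj₂ λ j mj → below j mj (ℕP.≤-total (u j) H)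
        where
        below : ∀ j → m j ≡ true → u j ℕ.≤ H ⊎ H ℕ.≤ u j → v j ℕ.≤ value x j
        below j mj (inj₁ le) = subst (v j ℕ.≤_) (sym (trans (value-cap q u j) (ℕP.m≤n⇒m⊓n≡m le))) (v≤u j mj)
        below j mj (inj₂ ge) = ⊥-elim (¬h (j , mj , ℕP.≤-reflexive (sym (trans (value-cap q u j) (ℕP.m≥n⇒m⊓n≡n ge)))))

    project : ∀ {q v} → Ind G P q v → ∀ {x w} → state x ≡ q → v ≤[ m ] value x → v ≤[ ∁ ] w → Ind C Inv x w
    step    : ∀ {v x w b ms} → v ≤[ m ] value x → v ≤[ ∁ ] w → Choice G P b ms v → Choice C Inv b (moves (value x) ms) w

    project {v = v} (node f) {x} {w} refl v≤u v≤w = node (go (view x))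
      where
      go : (vw : View x) → ∀ {b ms} → (b , ms) ∈ options x vw → Choice C Inv b ms w
      go (lost ¬e) _ = ⊥-elim (¬e (v , v≤u , ind⇒win closed (node f)))
      go (undecided _) o with ∈-map⁻ _ o
      ... | (b , ms) , o′ , refl = step {x = x} v≤u v≤w (f o′)

    step {v} {x} {w} {b} {ms} v≤u v≤w (choice {z} {q} {v′} z∈ st next) =
      choice (∈-map⁺ (move (value x)) (∈-filter⁺ (λ (z , _) → legal? (value x) z) z∈ legal)) st′ (go next)
      where
      u′ : V d
      u′ = moved (value x) z
      x′ : Fin K
      x′ = encode q (cap u′)
      st-m : ∀ i → m i ≡ true → + v′ i ℤ.≤ + value x i ℤ.+ z i
      st-m i mi = ℤP.≤-trans (st i) (ℤP.+-monoˡ-≤ (z i) (+≤+ (v≤u i mi)))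
      legal : Legal (value x) z
      legal i mi = ℤP.≤-trans (+≤+ z≤n) (st-m i mi)
      v′≤u′ : v′ ≤[ m ] u′
      v′≤u′ i mi = ℤP.drop‿+≤+ (ℤP.≤-trans (st-m i mi) (ℤP.≤-reflexive (sym (legal⇒moved {value x} {z} legal i mi))))
      w′ : V d
      w′ i = if m i then 0 else v′ i
      st′ : Step w (outside z) w′
      st′ i with m i in mi
      ... | true  = +≤+ z≤n
      ... | false = ℤP.≤-trans (st i) (ℤP.+-monoˡ-≤ (z i) (+≤+ (v≤w i (cong not mi))))
      v′≤w′ : v′ ≤[ ∁ ] w′
      v′≤w′ i mi with m i
      ... | false = ℕP.≤-refl
      go : ∀ {b} → Next G P b q v′ → Next C Inv b x′ w′
      go (good p) with arrive {q} {v′} {u′} (closed p) v′≤u′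
      ... | inj₁ t  = good (inj₁ t)
      ... | inj₂ le = good (inj₂ (v′ , subst (λ q → Ind G P q v′) (sym (state-encode q (cap u′))) (closed p) , le , v′≤w′))
      go (more i) with arrive {q} {v′} {u′} i v′≤u′
      ... | inj₁ t  = more (won⇒ind t)
      ... | inj₂ le = more (project i (state-encode q (cap u′)) le v′≤w′)

    inv-closed : ∀ {x w} → Inv x w → Ind C Inv x w
    inv-closed (inj₁ t) = won⇒ind t
    inv-closed (inj₂ (v , i , v≤u , v≤w)) = project i refl v≤u v≤w

  within⇒credit : ∀ {x} → Within x → UnknownCredit C x
  within⇒credit {x} (w , w≤ , W) = w , record
    { P = Inv ; closed = inv-closed ; holds = inj₂ (w , Win.closed W (Win.holds W) , w≤ , λ _ _ → ℕP.≤-refl) }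
    where open Project (Win.closed W)

  credit : Fin K → V d
  credit x = go (view x)
    where
    go : View x → V d
    go (won (w , _)) = w
    go (lost _)      = const 0
    go (undecided _)     = const 0

  credit-wins : ∀ x → IsWon (view x) → credit x ≤[ m ] value x × Win G (state x) (credit x)
  credit-wins x t with view x
  ... | won (w , w≤ , W) = w≤ , W

  -- Entering a won state switches to the strategy found by its query, which may ask for any credit
  -- outside `m`. There are finitely many states, so the sum of all these credits is carried along
  -- from the beginning.
  reserve : V d
  reserve i = total (λ x → credit x i)

  ≤-total : ∀ {n} (f : Fin n → ℕ) i → f i ℕ.≤ total f
  ≤-total f zero    = ℕP.m≤m+n _ _
  ≤-total f (suc i) = ℕP.≤-trans (≤-total (λ i → f (suc i)) i) (ℕP.m≤n+m _ _)

  module Lift {P : Fin K → V d → Set} (closed : ∀ {x w} → P x w → Ind C P x w) where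

    settled : Σ (Fin k → V d → Set) λ R → (∀ {q v} → R q v → Ind G R q v) × (∀ (i : ∃ λ x → IsWon (view x)) → R (state (proj₁ i)) (credit (proj₁ i)))
    settled = win-merge (λ (x , t) → proj₂ (credit-wins x t))

    Settled : Fin k → V d → Set
    Settled = proj₁ settled

    Covers : V d → Fin K → V d → Set
    Covers v x w = value x ≤[ m ] v × (∀ i → m i ≡ false → w i ℕ.+ reserve i ℕ.≤ v i)

    Inv : Fin k → V d → Set
    Inv q v = Settled q v ⊎ ∃₂ λ x w → state x ≡ q × Ind C P x w × Covers v x w

    raise : ∀ {x w v} → Ind C P x w → Covers v x w → Ind G Inv (state x) v
    step  : ∀ {x w v b ms} → Choice C P b (moves (value x) ms) w → Covers v x w → Choice G Inv b ms v

    raise {x} {w} {v} (node f) (u≤v , w≤v) = go (view x) f (λ t → t)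
      where
      go : (vw : View x) → (∀ {b ms} → (b , ms) ∈ options x vw → Choice C P b ms w) → (IsWon vw → IsWon (view x)) → Ind G Inv (state x) v
      go (won _) _ t = ind-up credit≤ (ind-map inj₁ (proj₁ (proj₂ settled) (proj₂ (proj₂ settled) (x , t tt))))
        where
        credit≤ : credit x ≤ⱽ v
        credit≤ i with m i in mi
        ... | true  = ℕP.≤-trans (proj₁ (credit-wins x (t tt)) i mi) (u≤v i mi)
        ... | false = ℕP.≤-trans (≤-total (λ x → credit x i) x) (ℕP.≤-trans (ℕP.m≤n+m _ (w i)) (w≤v i mi))
      go (lost _) f _ with f (here refl)
      ... | choice () _ _
      go (undecided _) f _ = node λ {b} {ms} o → step {x} {w} {v} {b} {ms} (f (∈-map⁺ (λ (b , ms) → b , moves (value x) ms) o)) (u≤v , w≤v)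

    step {x} {w} {v} {b} {ms} (choice {_} {_} {w′} m∈ st next) (u≤v , w≤v) with ∈-map⁻ (move (value x)) m∈
    ... | (z , q) , z∈ , refl with ∈-filter⁻ (λ (z , _) → legal? (value x) z) {xs = ms} z∈
    ... | z∈ms , legal = choice z∈ms st′ (go next)
      where
      u′ : V d
      u′ = moved (value x) z
      x′ : Fin K
      x′ = encode q (cap u′)
      -- Value above `H` is given up on the coordinates of `m`, as a step may lose value; elsewhere
      -- the reserve is kept on top.
      v′ : V d
      v′ i = if m i then value x′ i else w′ i ℕ.+ reserve i
      st′ : Step v z v′
      st′ i with m i in mi | st i
      ... | true  | _ = ℤP.≤-trans (+≤+ (ℕP.≤-trans (ℕP.≤-reflexive (value-cap q u′ i)) (ℕP.m⊓n≤m (u′ i) H)))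
            (ℤP.≤-trans (ℤP.≤-reflexive (legal⇒moved {value x} {z} legal i mi)) (ℤP.+-monoˡ-≤ (z i) (+≤+ (u≤v i mi))))
      ... | false | s = ℤP.≤-trans (ℤP.+-monoˡ-≤ (+ reserve i) s) (ℤP.≤-trans (ℤP.≤-reflexive (ring (+ w i) (z i) (+ reserve i)))
            (ℤP.+-monoˡ-≤ (z i) (+≤+ (w≤v i mi))))
        where
        ring : ∀ a z r → (a ℤ.+ z) ℤ.+ r ≡ (a ℤ.+ r) ℤ.+ z
        ring = solve-∀
      covers : Covers v′ x′ w′
      covers = (λ i mi → c₁ i mi) , (λ i mi → c₂ i mi)
        where
        c₁ : value x′ ≤[ m ] v′
        c₁ i mi rewrite mi = ℕP.≤-refl
        c₂ : ∀ i → m i ≡ false → w′ i ℕ.+ reserve i ℕ.≤ v′ i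
        c₂ i mi rewrite mi = ℕP.≤-refl
      go : ∀ {b} → Next C P b x′ w′ → Next G Inv b q v′
      go (good p) = good (inj₂ (x′ , w′ , state-encode q (cap u′) , closed p , covers))
      go (more i) = more (subst (λ q → Ind G Inv q v′) (state-encode q (cap u′)) (raise i covers))

    inv-closed : ∀ {q v} → Inv q v → Ind G Inv q v
    inv-closed (inj₁ s) = ind-map inj₁ (proj₁ (proj₂ settled) s)
    inv-closed (inj₂ (x , w , refl , i , c)) = raise i c

  credit⇒within : ∀ {x} → UnknownCredit C x → Within x
  credit⇒within {x} (w , W) = v , v≤ , record
    { P = Inv ; closed = inv-closed ; holds = inj₂ (x , w , refl , Win.closed W (Win.holds W) , covers) }
    where
    open Lift (Win.closed W)
    v : V d
    v i = if m i then value x i else w i ℕ.+ reserve i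
    v≤ : v ≤[ m ] value x
    v≤ i mi rewrite mi = ℕP.≤-refl
    c₁ : value x ≤[ m ] v
    c₁ i mi rewrite mi = ℕP.≤-refl
    c₂ : ∀ i → m i ≡ false → w i ℕ.+ reserve i ℕ.≤ v i
    c₂ i mi rewrite mi = ℕP.≤-refl
    covers : Covers v x w
    covers = c₁ , c₂

  decide : ∀ q v → Dec (WinsWithin G q m v)
  decide q v = map′ to from (unknownCredit? C x)
    where
    x : Fin K
    x = encode q (cap v)
    to : UnknownCredit C x → WinsWithin G q m v
    to c with credit⇒within c
    ... | w , w≤ , W = w , (λ i mi → ℕP.≤-trans (w≤ i mi) (ℕP.≤-trans (ℕP.≤-reflexive (value-cap q v i)) (ℕP.m⊓n≤m (v i) H))) ,
      subst (λ q → Win G q w) (state-encode q (cap v)) W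
    from : WinsWithin G q m v → UnknownCredit C x
    from (w , w≤ , W) with trim W
    ... | w′ , W′ , w′≤w , w′≤H = within⇒credit (w′ ,
      (λ i mi → subst (w′ i ℕ.≤_) (sym (value-cap q v i)) (ℕP.⊓-glb (ℕP.≤-trans (w′≤w i mi) (w≤ i mi)) (w′≤H i mi))) ,
      subst (λ q → Win G q w′) (sym (state-encode q (cap v))) W′)

-- Induction on the number of known coordinates, down to the empty mask, where no smaller query can
-- be asked and all credit is unknown.
winsWithin? : ∀ {k d} (G : Game k d) m q v → Dec (WinsWithin G q m v)
winsWithin? G m = go (size m) m ℕP.≤-refl
  where
  go : ∀ n m → size m ℕ.≤ n → ∀ q v → Dec (WinsWithin G q m v)
  go zero    m le = Capped.decide G m (λ m′ lt → ⊥-elim (ℕP.n≮0 (ℕP.≤-trans lt le)))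
  go (suc n) m le = Capped.decide G m (λ m′ lt → go n m′ (ℕP.≤-pred (ℕP.≤-trans lt le)))

win? : ∀ {k d} (G : Game k d) q v → Dec (Win G q v)
win? G q v = map′ (λ (w , w≤v , W) → win-up (λ i → w≤v i refl) W) (λ W → v , (λ _ _ → ℕP.≤-refl) , W)
                  (winsWithin? G (const true) q v)

-- Rational means

frac-≃ : ∀ a n → ℚ.toℚᵘ (+ a / suc n) ℚᵘ.≃ ℚᵘ.mkℚᵘ (+ a) n
frac-≃ a n = ℚP.toℚᵘ-fromℚᵘ (ℚᵘ.mkℚᵘ (+ a) n)

frac-+ : ∀ a b n → (+ a / suc n) ℚ.+ (+ b / suc n) ≡ + (a ℕ.+ b) / suc n
frac-+ a b n = ℚP.toℚᵘ-injective (begin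
  ℚ.toℚᵘ ((+ a / suc n) ℚ.+ (+ b / suc n))              ≈⟨ ℚP.toℚᵘ-homo-+ (+ a / suc n) (+ b / suc n) ⟩
  ℚ.toℚᵘ (+ a / suc n) ℚᵘ.+ ℚ.toℚᵘ (+ b / suc n)        ≈⟨ ℚᵘP.+-cong (frac-≃ a n) (frac-≃ b n) ⟩
  ℚᵘ.mkℚᵘ (+ a) n ℚᵘ.+ ℚᵘ.mkℚᵘ (+ b) n                   ≈⟨ ℚᵘ.*≡* eq ⟩
  ℚᵘ.mkℚᵘ (+ (a ℕ.+ b)) n                                ≈⟨ frac-≃ (a ℕ.+ b) n ⟨
  ℚ.toℚᵘ (+ (a ℕ.+ b) / suc n)                           ∎)
  where
  open ℚᵘP.≃-Reasoning
  ring : ∀ a b n → (a ℤ.* n ℤ.+ b ℤ.* n) ℤ.* n ≡ (a ℤ.+ b) ℤ.* (n ℤ.* n)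
  ring = solve-∀
  eq : (+ a ℤ.* + suc n ℤ.+ + b ℤ.* + suc n) ℤ.* + suc n ≡ + (a ℕ.+ b) ℤ.* + (suc n ℕ.* suc n)
  eq = trans (ring (+ a) (+ b) (+ suc n)) (cong (+ (a ℕ.+ b) ℤ.*_) (sym (ℤP.pos-* (suc n) (suc n))))

frac-self : ∀ n → + suc n / suc n ≡ 1ℚ
frac-self n = ℚP.toℚᵘ-injective (ℚᵘP.≃-trans (frac-≃ (suc n) n) (ℚᵘ.*≡* (ℤP.*-comm (+ suc n) (+ 1))))

frac-≤ : ∀ {a b c e} → a ℕ.* suc e ℕ.≤ c ℕ.* suc b → + a / suc b ℚ.≤ + c / suc e
frac-≤ {a} {b} {c} {e} le = ℚP.toℚᵘ-cancel-≤ (begin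
  ℚ.toℚᵘ (+ a / suc b)  ≃⟨ frac-≃ a b ⟩
  ℚᵘ.mkℚᵘ (+ a) b        ≤⟨ ℚᵘ.*≤* (subst (ℤ._≤ + c ℤ.* + suc b) (ℤP.pos-* a (suc e)) (subst (+ (a ℕ.* suc e) ℤ.≤_) (ℤP.pos-* c (suc b)) (+≤+ le))) ⟩
  ℚᵘ.mkℚᵘ (+ c) e        ≃⟨ frac-≃ c e ⟨
  ℚ.toℚᵘ (+ c / suc e)  ∎)
  where open ℚᵘP.≤-Reasoning

frac-nonneg : ∀ a n → 0ℚ ℚ.≤ + a / suc n
frac-nonneg a n = subst (ℚ._≤ + a / suc n) (ℚP.0/n≡0 (suc n)) (frac-≤ {0} {n} {a} {n} z≤n)

*-monoʳ-≤ : ∀ {r p q} → 0ℚ ℚ.≤ r → p ℚ.≤ q → r ℚ.* p ℚ.≤ r ℚ.* q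
*-monoʳ-≤ {r} 0≤r = ℚP.*-monoˡ-≤-nonNeg r {{ℚ.nonNegative 0≤r}}

*-monoˡ-≤ : ∀ {r p q} → 0ℚ ℚ.≤ r → p ℚ.≤ q → p ℚ.* r ℚ.≤ q ℚ.* r
*-monoˡ-≤ {r} 0≤r = ℚP.*-monoʳ-≤-nonNeg r {{ℚ.nonNegative 0≤r}}

*-nonneg : ∀ {p q} → 0ℚ ℚ.≤ p → 0ℚ ℚ.≤ q → 0ℚ ℚ.≤ p ℚ.* q
*-nonneg {p} {q} 0≤p 0≤q = subst (ℚ._≤ p ℚ.* q) (ℚP.*-zeroʳ p) (*-monoʳ-≤ 0≤p 0≤q)

*-pos : ∀ {p q} → 0ℚ ℚ.< p → 0ℚ ℚ.< q → 0ℚ ℚ.< p ℚ.* q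
*-pos {p} {q} 0<p 0<q = subst (ℚ._< p ℚ.* q) (ℚP.*-zeroʳ p) (ℚP.*-monoʳ-<-pos p {{ℚ.positive 0<p}} 0<q)

0≤q-p⇒p≤q : ∀ {p q} → 0ℚ ℚ.≤ q ℚ.- p → p ℚ.≤ q
0≤q-p⇒p≤q {p} {q} le = subst (p ℚ.≤_) (ring p q) (subst (ℚ._≤ p ℚ.+ (q ℚ.- p)) (ℚP.+-identityʳ p) (ℚP.+-monoʳ-≤ p le))
  where
  open +-*-Solver
  ring : ∀ p q → p ℚ.+ (q ℚ.- p) ≡ q
  ring = solve 2 (λ p q → p :+ (q :- p) := q) refl

p≤q⇒0≤q-p : ∀ {p q} → p ℚ.≤ q → 0ℚ ℚ.≤ q ℚ.- p
p≤q⇒0≤q-p {p} {q} le = subst (ℚ._≤ q ℚ.- p) (ℚP.+-inverseʳ p) (ℚP.+-monoˡ-≤ (ℚ.- p) le)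

swap-≤ : ∀ {p q r} → p ℚ.- q ℚ.≤ r → p ℚ.- r ℚ.≤ q
swap-≤ {p} {q} {r} le = subst (ℚ._≤ q) (ring₁ p q r) (subst (((p ℚ.- q) ℚ.+ (q ℚ.- r)) ℚ.≤_) (ring₂ q r) (ℚP.+-monoˡ-≤ (q ℚ.- r) le))
  where
  open +-*-Solver
  ring₁ : ∀ p q r → (p ℚ.- q) ℚ.+ (q ℚ.- r) ≡ p ℚ.- r
  ring₁ = solve 3 (λ p q r → (p :- q) :+ (q :- r) := p :- r) refl
  ring₂ : ∀ q r → r ℚ.+ (q ℚ.- r) ≡ q
  ring₂ = solve 2 (λ q r → r :+ (q :- r) := q) refl

frac-pos : ∀ {a n} → 0 ℕ.< a → 0ℚ ℚ.< + a / suc n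
frac-pos {suc a} {n} _ = ℚP.positive⁻¹ (+ suc a / suc n) {{ℚP.normalize-pos (suc a) (suc n)}}

-- The denominator of `x` is large enough, as its numerator is at least 1.
archimedean : ∀ {x} → 0ℚ ℚ.< x → ∃ λ n → 1ℚ ℚ.≤ (+ n / 1) ℚ.* x
archimedean {x@(ℚ.mkℚ (+ suc a) b _)} _ = suc b , ℚP.toℚᵘ-cancel-≤ (begin
  ℚᵘ.1ℚᵘ                                     ≤⟨ ℚᵘ.*≤* (+≤+ le) ⟩
  ℚᵘ.mkℚᵘ (+ suc b) 0 ℚᵘ.* ℚ.toℚᵘ x          ≃⟨ ℚᵘP.*-congʳ {ℚ.toℚᵘ x} (frac-≃ (suc b) 0) ⟨
  ℚ.toℚᵘ (+ suc b / 1) ℚᵘ.* ℚ.toℚᵘ x         ≃⟨ ℚP.toℚᵘ-homo-* (+ suc b / 1) x ⟨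
  ℚ.toℚᵘ ((+ suc b / 1) ℚ.* x)               ∎)
  where
  open ℚᵘP.≤-Reasoning
  le : 1 ℕ.* suc (b ℕ.+ 0) ℕ.≤ suc b ℕ.* suc a ℕ.* 1
  le rewrite ℕP.+-identityʳ b | ℕP.*-identityˡ (suc b) | ℕP.*-identityʳ (suc b ℕ.* suc a) = ℕP.m≤m*n (suc b) (suc a)
archimedean {ℚ.mkℚ (+ zero) _ _} (ℚ.*<* (+<+ ()))
archimedean {ℚ.mkℚ -[1+ _ ] _ _} (ℚ.*<* ())

module _ {k d : ℕ} (W : ℕ) where

  α : ℕ × Config k d → ℚ
  α (w , _) = + w / suc W

  abstract
    mean : List (ℕ × Config k d) → (Config k d → ℚ) → ℚ
    mean es f = sumℚ (map (λ wc → α wc ℚ.* f (proj₂ wc)) es)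

    mean-mono : ∀ {es f g} → (∀ {w c} → (w , c) ∈ es → f c ℚ.≤ g c) → mean es f ℚ.≤ mean es g
    mean-mono {[]}          le = ℚP.≤-refl
    mean-mono {(w , c) ∷ _} le = ℚP.+-mono-≤ (*-monoʳ-≤ (frac-nonneg w W) (le (here refl))) (mean-mono (λ m → le (there m)))

    -- The weight of `es` is left general because a tail of the list of successors no longer sums to
    -- `suc W`.
    mean-affine : ∀ es a b f → mean es (λ c → a ℚ.+ b ℚ.* f c) ≡ a ℚ.* (+ sumℕ es / suc W) ℚ.+ b ℚ.* mean es f
    mean-affine [] a b f = trans (sym (ℚP.*-zeroʳ a)) (trans (cong (a ℚ.*_) (sym (ℚP.0/n≡0 (suc W))))
      (trans (sym (ℚP.+-identityʳ _)) (cong (a ℚ.* (+ 0 / suc W) ℚ.+_) (sym (ℚP.*-zeroʳ b)))))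
    mean-affine ((w , c) ∷ es) a b f = trans
      (cong (α (w , c) ℚ.* (a ℚ.+ b ℚ.* f c) ℚ.+_) (mean-affine es a b f))
      (trans (ring (α (w , c)) a b (f c) (+ sumℕ es / suc W) (mean es f))
        (cong (λ s → a ℚ.* s ℚ.+ b ℚ.* (α (w , c) ℚ.* f c ℚ.+ mean es f)) (frac-+ w (sumℕ es) W)))
      where
      open +-*-Solver
      ring : ∀ α a b f s m → α ℚ.* (a ℚ.+ b ℚ.* f) ℚ.+ (a ℚ.* s ℚ.+ b ℚ.* m) ≡ a ℚ.* (α ℚ.+ s) ℚ.+ b ℚ.* (α ℚ.* f ℚ.+ m)
      ring = solve 6 (λ α a b f s m → α :* (a :+ b :* f) :+ (a :* s :+ b :* m) := a :* (α :+ s) :+ b :* (α :* f :+ m)) refl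

    mean-nonneg : ∀ {es f} → (∀ {w c} → (w , c) ∈ es → 0ℚ ℚ.≤ f c) → 0ℚ ℚ.≤ mean es f
    mean-nonneg {[]}          le = ℚP.≤-refl
    mean-nonneg {(w , c) ∷ _} le = ℚP.+-mono-≤ (*-nonneg (frac-nonneg w W) (le (here refl))) (mean-nonneg (λ m → le (there m)))

    mean-∈ : ∀ {es f w c} → (∀ {w c} → (w , c) ∈ es → 0ℚ ℚ.≤ f c) → (w , c) ∈ es → α (w , c) ℚ.* f c ℚ.≤ mean es f
    mean-∈ {(w , c) ∷ es} {f} le (here refl) = subst (ℚ._≤ mean ((w , c) ∷ es) f) (ℚP.+-identityʳ _)
      (ℚP.+-monoʳ-≤ (α (w , c) ℚ.* f c) (mean-nonneg (λ m → le (there m))))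
    mean-∈ {(w , c) ∷ es} {f} le (there m) = ℚP.≤-trans (mean-∈ (λ m → le (there m)) m)
      (subst (ℚ._≤ mean ((w , c) ∷ es) f) (ℚP.+-identityˡ _) (ℚP.+-monoˡ-≤ (mean es f) (*-nonneg (frac-nonneg w W) (le (here refl)))))

    mean-positive : ∀ {es f} → 0ℚ ℚ.< mean es f → ∃₂ λ w c → (w , c) ∈ es × 0ℚ ℚ.< f c
    mean-positive {[]} lt = ⊥-elim (ℚP.<-irrefl refl lt)
    mean-positive {(w , c) ∷ es} {f} lt with 0ℚ ℚ.<? f c
    ... | yes pos = w , c , here refl , pos
    ... | no ¬pos with mean-positive {es} {f} (ℚP.<-≤-trans lt (subst (mean ((w , c) ∷ es) f ℚ.≤_) (ℚP.+-identityˡ _)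
                         (ℚP.+-monoˡ-≤ (mean es f) (subst (α (w , c) ℚ.* f c ℚ.≤_) (ℚP.*-zeroʳ (α (w , c))) (*-monoʳ-≤ (frac-nonneg w W) (ℚP.≮⇒≥ ¬pos))))))
    ... | w′ , c′ , m , pos = w′ , c′ , there m , pos

    mean-affine′ : ∀ es → sumℕ es ≡ suc W → ∀ a b f → mean es (λ c → a ℚ.+ b ℚ.* f c) ≡ a ℚ.+ b ℚ.* mean es f
    mean-affine′ es total-weight a b f = trans (mean-affine es a b f) (cong (ℚ._+ b ℚ.* mean es f)
      (trans (cong (a ℚ.*_) (trans (cong (λ s → + s / suc W) total-weight) (frac-self W))) (ℚP.*-identityʳ a)))

    mean-compl : ∀ es → sumℕ es ≡ suc W → ∀ f → mean es (λ c → 1ℚ ℚ.- f c) ≡ 1ℚ ℚ.- mean es f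
    mean-compl es total-weight f = trans (cong sumℚ (map-cong′ es)) (trans (mean-affine′ es total-weight 1ℚ (ℚ.- 1ℚ) f) (cong (1ℚ ℚ.+_) (neg (mean es f))))
      where
      neg : ∀ x → (ℚ.- 1ℚ) ℚ.* x ≡ ℚ.- x
      neg x = trans (sym (ℚP.neg-distribˡ-* 1ℚ x)) (cong ℚ.-_ (ℚP.*-identityˡ x))
      map-cong′ : ∀ es → map (λ wc → α wc ℚ.* (1ℚ ℚ.- f (proj₂ wc))) es ≡ map (λ wc → α wc ℚ.* (1ℚ ℚ.+ (ℚ.- 1ℚ) ℚ.* f (proj₂ wc))) es
      map-cong′ []       = refl
      map-cong′ (wc ∷ es) = cong₂ _∷_ (cong (λ x → α wc ℚ.* (1ℚ ℚ.+ x)) (sym (neg (f (proj₂ wc))))) (map-cong′ es)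

-- The game of a 1-VASS-MDP

addℤ-sound : ∀ n z {m} → addℤ n z ≡ just m → + m ≡ + n ℤ.+ z
addℤ-sound n (+ z) refl = refl
addℤ-sound n -[1+ z ] eq with suc z ℕ.≤? n
addℤ-sound n -[1+ z ] refl | yes le = sym (ℤP.⊖-≥ le)

addℤ-complete : ∀ n z → + 0 ℤ.≤ + n ℤ.+ z → ∃ λ m → addℤ n z ≡ just m
addℤ-complete n (+ z) _ = _ , refl
addℤ-complete n -[1+ z ] 0≤ with suc z ℕ.≤? n
... | yes _ = _ , refl
... | no ¬le = ⊥-elim (ℤP.<⇒≱ (subst (ℤ._< + 0) (sym (ℤP.⊖-< (ℕP.≰⇒> ¬le))) (ℤP.neg-mono-< (+<+ (ℕP.m<n⇒0<n∸m (ℕP.≰⇒> ¬le))))) 0≤)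

applyUpd-sound : ∀ {d} (v : Vec ℕ d) z {w} → applyUpd v z ≡ just w → ∀ i → + lookup w i ≡ + lookup v i ℤ.+ lookup z i
applyUpd-sound (v ∷ vs) (z ∷ zs) eq i with addℤ v z in e₁ | applyUpd vs zs in e₂
applyUpd-sound (v ∷ vs) (z ∷ zs) refl zero    | just w | just ws = addℤ-sound v z e₁
applyUpd-sound (v ∷ vs) (z ∷ zs) refl (suc i) | just w | just ws = applyUpd-sound vs zs e₂ i

applyUpd-complete : ∀ {d} (v : Vec ℕ d) z → (∀ i → + 0 ℤ.≤ + lookup v i ℤ.+ lookup z i) → ∃ λ w → applyUpd v z ≡ just w
applyUpd-complete []       []       _ = [] , refl
applyUpd-complete (v ∷ vs) (z ∷ zs) 0≤ with addℤ v z | addℤ-complete v z (0≤ zero) | applyUpd vs zs | applyUpd-complete vs zs (λ i → 0≤ (suc i))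
... | _ | w , refl | _ | ws , refl = _ , refl

fire-sound : ∀ {k d} (c : Config k d) t {c′} → fire c t ≡ just c′ →
             proj₁ c ≡ src t × proj₁ c′ ≡ tgt t × (∀ i → + lookup (proj₂ c′) i ≡ + lookup (proj₂ c) i ℤ.+ lookup (upd t) i)
fire-sound (q , v) t eq with q Fin.≟ src t
... | yes q≡ with applyUpd v (upd t) in e
fire-sound (q , v) t refl | yes q≡ | just w = q≡ , refl , applyUpd-sound v (upd t) e

fire-complete : ∀ {k d} (c : Config k d) t → src t ≡ proj₁ c → (∀ i → + 0 ℤ.≤ + lookup (proj₂ c) i ℤ.+ lookup (upd t) i) →
                ∃ λ c′ → fire c t ≡ just c′
fire-complete (q , v) t eq 0≤ with q Fin.≟ src t
... | no q≢ = ⊥-elim (q≢ (sym eq))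
... | yes _ with applyUpd v (upd t) | applyUpd-complete v (upd t) 0≤
... | _ | w , refl = _ , refl

mapMaybe⁻ : ∀ {A B : Set} (f : A → Maybe B) xs {y} → y ∈ mapMaybe f xs → ∃ λ x → x ∈ xs × f x ≡ just y
mapMaybe⁻ f (x ∷ xs) m with f x in eq
mapMaybe⁻ f (x ∷ xs) (here refl) | just y = x , here refl , eq
mapMaybe⁻ f (x ∷ xs) (there m)   | just y = let x′ , x∈ , e = mapMaybe⁻ f xs m in x′ , there x∈ , e
mapMaybe⁻ f (x ∷ xs) m           | nothing = let x′ , x∈ , e = mapMaybe⁻ f xs m in x′ , there x∈ , e

mapMaybe⁺ : ∀ {A B : Set} (f : A → Maybe B) {xs x y} → x ∈ xs → f x ≡ just y → y ∈ mapMaybe f xs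
mapMaybe⁺ f {x ∷ xs} (here refl) e with f x | e
... | _ | refl = here refl
mapMaybe⁺ f {x ∷ xs} (there m) e with f x
... | just _  = there (mapMaybe⁺ f m e)
... | nothing = mapMaybe⁺ f m e

module _ {k d} (S : VASSMDP k d) where

  enabled⁻ : ∀ c {w c′} → (w , c′) ∈ enabled S c → ∃ λ t → t ∈ transitions S × weight t ≡ w × fire c t ≡ just c′
  enabled⁻ c m with mapMaybe⁻ _ (transitions S) m
  ... | t , t∈ , eq with fire c t in e
  enabled⁻ c m | t , t∈ , refl | just c′ = t , t∈ , refl , e

  enabled⁺ : ∀ c {t c′} → t ∈ transitions S → fire c t ≡ just c′ → (weight t , c′) ∈ enabled S c
  enabled⁺ c {t} {c′} t∈ e with (λ y → (_ ≡ just y → y ∈ enabled S c) ∋ mapMaybe⁺ _ t∈)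
  ... | inject with fire c t | e
  ... | _ | refl = inject (weight t , c′) refl

  total-weight : ℕ
  total-weight = sum (map weight (transitions S))

  private
    -- The function mapped by `enabled` is local to it, so `f` is arbitrary here; an entry whose
    -- weight is not that of its transition is returned, to be refuted once `f` is known.
    heavy-or-bounded : ∀ (f : Transition k d → Maybe (ℕ × Config k d)) ts →
      (∃ λ t → ∃₂ λ w c → f t ≡ just (w , c) × w ≢ weight t) ⊎ sumℕ (mapMaybe f ts) ℕ.≤ sum (map weight ts)
    heavy-or-bounded f [] = inj₂ z≤n
    heavy-or-bounded f (t ∷ ts) with f t in eq | heavy-or-bounded f ts
    ... | _            | inj₁ heavy = inj₁ heavy
    ... | nothing      | inj₂ le = inj₂ (ℕP.≤-trans le (ℕP.m≤n+m _ (weight t)))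
    ... | just (w , c) | inj₂ le with w ℕ.≟ weight t
    ... | yes refl = inj₂ (ℕP.+-monoʳ-≤ w le)
    ... | no  w≢   = inj₁ (t , w , c , eq , w≢)

  sumℕ-enabled : ∀ c → sumℕ (enabled S c) ℕ.≤ total-weight
  sumℕ-enabled c with heavy-or-bounded _ (transitions S)
  ... | inj₂ le = le
  ... | inj₁ (t , w , c′ , eq , w≢) with fire c t
  sumℕ-enabled c | inj₁ (t , w , c′ , refl , w≢) | just _ = ⊥-elim (w≢ refl)

sumℕ-∈ : ∀ {k d w} {c : Config k d} {es} → (w , c) ∈ es → w ℕ.≤ sumℕ es
sumℕ-∈ (here refl) = ℕP.m≤m+n _ _
sumℕ-∈ {es = (w , _) ∷ _} (there m) = ℕP.≤-trans (sumℕ-∈ m) (ℕP.m≤n+m _ w)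

val : ∀ {k d} → Config k d → V d
val c = lookup (proj₂ c)

module Reachability {k d} (S : VASSMDP k d) (qF : Fin k) where

  moves : Fin k → List (Z d × Fin k)
  moves q = map (λ t → lookup (upd t) , tgt t) (filter (λ t → src t Fin.≟ q) (transitions S))

  turn : Owner → List (Z d × Fin k) → List (Option k d)
  turn P1 ms = (false , ms) ∷ []
  turn PP ms = (false , ms) ∷ map (λ m → true , m ∷ []) ms

  -- At a probabilistic state the opponent either fixes the successor, which is
  -- a good event, or leaves the choice to Player 1. So Player 1 always has a
  -- path of positive probability to qF, and cannot be driven off such paths.
  game : Game k d
  game q with q Fin.≟ qF
  ... | yes _ = []
  ... | no  _ = turn (owner S q) (moves q)

  game-target : ∀ {q} → q ≡ qF → game q ≡ []
  game-target {q} eq with q Fin.≟ qF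
  ... | yes _ = refl
  ... | no  ¬F = ⊥-elim (¬F eq)

  game-turn : ∀ {q a} → q ≢ qF → owner S q ≡ a → game q ≡ turn a (moves q)
  game-turn {q} ¬F refl with q Fin.≟ qF
  ... | yes eq = ⊥-elim (¬F eq)
  ... | no  _  = refl

  move⁺ : ∀ {t q} → t ∈ transitions S → src t ≡ q → (lookup (upd t) , tgt t) ∈ moves q
  move⁺ t∈ eq = ∈-map⁺ (λ t → lookup (upd t) , tgt t) (∈-filter⁺ (λ t → src t Fin.≟ _) t∈ eq)

  move⁻ : ∀ {q z q′} → (z , q′) ∈ moves q → ∃ λ t → t ∈ transitions S × src t ≡ q × z ≡ lookup (upd t) × q′ ≡ tgt t
  move⁻ {q} m with ∈-map⁻ (λ t → lookup (upd t) , tgt t) m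
  ... | t , m′ , refl with ∈-filter⁻ (λ t → src t Fin.≟ q) {xs = transitions S} m′
  ... | t∈ , eq = t , t∈ , eq , refl , refl

  fire-move : ∀ c {t c′} → t ∈ transitions S → fire c t ≡ just c′ →
              (lookup (upd t) , proj₁ c′) ∈ moves (proj₁ c) × Step (val c) (lookup (upd t)) (val c′)
  fire-move c {t} t∈ e with fire-sound c t e
  ... | q≡ , q′≡ , exact = subst (λ q → (lookup (upd t) , q) ∈ moves (proj₁ c)) (sym q′≡) (move⁺ t∈ (sym q≡)) ,
    λ i → ℤP.≤-reflexive (exact i)

  module Prob (σ : Strategy S) where

    abstract
      prob : ℕ → List (Config k d) → Config k d → ℚ
      prob = reachProb S σ qF

      prob-def : ∀ n h c → prob n h c ≡ reachProb S σ qF n h c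
      prob-def n h c = refl

      prob-zero : ∀ {h c} → proj₁ c ≢ qF → prob 0 h c ≡ 0ℚ
      prob-zero {h} {c} ¬F with proj₁ c Fin.≟ qF
      ... | yes eq = ⊥-elim (¬F eq)
      ... | no  _  = refl

      prob-target : ∀ {h c} → proj₁ c ≡ qF → ∀ n → prob n h c ≡ 1ℚ
      prob-target {h} {c} eq n with proj₁ c Fin.≟ qF
      ... | yes _ = refl
      ... | no  ¬F = ⊥-elim (¬F eq)

      prob-dead : ∀ {h c} → proj₁ c ≢ qF → enabled S c ≡ [] → ∀ n → prob (suc n) h c ≡ 0ℚ
      prob-dead {h} {c} ¬F eq n with proj₁ c Fin.≟ qF
      ... | yes eq = ⊥-elim (¬F eq)
      ... | no  _ with enabled S c | sumℕ (enabled S c) | owner S (proj₁ c)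
      ... | [] | _ | _ = refl

      prob-player : ∀ {h c} → proj₁ c ≢ qF → enabled S c ≢ [] → owner S (proj₁ c) ≡ P1 →
                    ∀ n → prob (suc n) h c ≡ prob n (c ∷ h) (choose σ h c)
      prob-player {h} {c} ¬F ne o n with proj₁ c Fin.≟ qF
      ... | yes eq = ⊥-elim (¬F eq)
      ... | no  _ with enabled S c | sumℕ (enabled S c) | owner S (proj₁ c)
      ... | []    | _ | _  = ⊥-elim (ne refl)
      ... | _ ∷ _ | _ | P1 = refl

      prob-chance : ∀ {h c} → proj₁ c ≢ qF → owner S (proj₁ c) ≡ PP → ∀ W → sumℕ (enabled S c) ≡ suc W →
                    ∀ n → prob (suc n) h c ≡ mean W (enabled S c) (prob n (c ∷ h))
      prob-chance {h} {c} ¬F o W s n with proj₁ c Fin.≟ qF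
      ... | yes eq = ⊥-elim (¬F eq)
      ... | no  _ with enabled S c | sumℕ (enabled S c) | owner S (proj₁ c)
      prob-chance ¬F o W s    n | no _ | []    | _     | PP = refl
      prob-chance ¬F o W refl n | no _ | _ ∷ _ | suc _ | PP = refl

    data View (h : List (Config k d)) (c : Config k d) : Set where
      target : proj₁ c ≡ qF → (∀ n → prob n h c ≡ 1ℚ) → View h c
      dead   : proj₁ c ≢ qF → enabled S c ≡ [] → (∀ n → prob n h c ≡ 0ℚ) → View h c
      player : proj₁ c ≢ qF → enabled S c ≢ [] → owner S (proj₁ c) ≡ P1 →
               (∀ n → prob (suc n) h c ≡ prob n (c ∷ h) (choose σ h c)) → View h c
      chance : proj₁ c ≢ qF → owner S (proj₁ c) ≡ PP → ∀ W → sumℕ (enabled S c) ≡ suc W →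
               (∀ n → prob (suc n) h c ≡ mean W (enabled S c) (prob n (c ∷ h))) → View h c

    view : ∀ h c → View h c
    view h c with proj₁ c Fin.≟ qF | owner S (proj₁ c) in o | enabled S c in e
    ... | yes eq | _ | _ = target eq (prob-target eq)
    ... | no ¬F | _ | [] = dead ¬F e λ { zero → prob-zero ¬F ; (suc n) → prob-dead ¬F e n }
    ... | no ¬F | P1 | _ ∷ _ = player ¬F ne o (prob-player ¬F ne o)
      where
      ne : enabled S c ≢ []
      ne eq with trans (sym e) eq
      ... | ()
    ... | no ¬F | PP | (w , c′) ∷ es with w in we | enabled⁻ S c (subst ((w , c′) ∈_) (sym e) (here refl))
    ... | zero  | t , _ , wt , _ = ⊥-elim (ℕP.<⇒≢ (weight-pos t) (sym wt))
    ... | suc w′ | _ = chance ¬F o (w′ ℕ.+ sumℕ es) sum≡ (prob-chance ¬F o _ sum≡)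
      where
      sum≡ : sumℕ (enabled S c) ≡ suc (w′ ℕ.+ sumℕ es)
      sum≡ = trans (cong sumℕ e) (cong (ℕ._+ sumℕ es) we)

    0≤prob : ∀ n h c → 0ℚ ℚ.≤ prob n h c
    0≤prob n h c with view h c
    0≤prob n h c | target _ eq = ℚP.≤-trans (ℚP.nonNegative⁻¹ 1ℚ) (ℚP.≤-reflexive (sym (eq n)))
    0≤prob n h c | dead _ _ eq = ℚP.≤-reflexive (sym (eq n))
    0≤prob zero h c | player ¬F _ _ _ = ℚP.≤-reflexive (sym (prob-zero ¬F))
    0≤prob zero h c | chance ¬F _ _ _ _ = ℚP.≤-reflexive (sym (prob-zero ¬F))
    0≤prob (suc n) h c | player _ _ _ eq = ℚP.≤-trans (0≤prob n _ _) (ℚP.≤-reflexive (sym (eq n)))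
    0≤prob (suc n) h c | chance _ _ W _ eq =
      ℚP.≤-trans (mean-nonneg W {enabled S c} (λ _ → 0≤prob n _ _)) (ℚP.≤-reflexive (sym (eq n)))

    prob≤1 : ∀ n h c → prob n h c ℚ.≤ 1ℚ
    prob≤1 n h c with view h c
    prob≤1 n h c | target _ eq = ℚP.≤-reflexive (eq n)
    prob≤1 n h c | dead _ _ eq = ℚP.≤-trans (ℚP.≤-reflexive (eq n)) (ℚP.nonNegative⁻¹ 1ℚ)
    prob≤1 zero h c | player ¬F _ _ _ = ℚP.≤-trans (ℚP.≤-reflexive (prob-zero ¬F)) (ℚP.nonNegative⁻¹ 1ℚ)
    prob≤1 zero h c | chance ¬F _ _ _ _ = ℚP.≤-trans (ℚP.≤-reflexive (prob-zero ¬F)) (ℚP.nonNegative⁻¹ 1ℚ)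
    prob≤1 (suc n) h c | player _ _ _ eq = ℚP.≤-trans (ℚP.≤-reflexive (eq n)) (prob≤1 n _ _)
    prob≤1 (suc n) h c | chance _ _ W s eq = ℚP.≤-trans (ℚP.≤-reflexive (eq n)) (0≤q-p⇒p≤q (ℚP.≤-trans
      (mean-nonneg W {enabled S c} (λ _ → p≤q⇒0≤q-p (prob≤1 n _ _)))
      (ℚP.≤-reflexive (mean-compl W (enabled S c) s (prob n (c ∷ h))))))

  -- Almost surely winning continuations satisfy the fixed point equation of the game.
  module Necessity where
    open Prob

    AS : Strategy S → List (Config k d) → Config k d → Set
    AS σ h c = ∀ ε → 0ℚ ℚ.< ε → ∃ λ n → 1ℚ ℚ.- ε ℚ.≤ prob σ n h c

    as-player : ∀ {σ h c} → proj₁ c ≢ qF → (∀ n → prob σ (suc n) h c ≡ prob σ n (c ∷ h) (choose σ h c)) →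
                AS σ h c → AS σ (c ∷ h) (choose σ h c)
    as-player {σ} ¬F eq as ε 0<ε with as ε 0<ε
    ... | zero  , le = 0 , ℚP.≤-trans le (ℚP.≤-trans (ℚP.≤-reflexive (prob-zero σ ¬F)) (0≤prob σ 0 _ _))
    ... | suc n , le = n , subst (_ ℚ.≤_) (eq n) le

    -- A failure probability `x` at a successor taken with probability `a` contributes `a x` to the
    -- failure probability at `c`. So accuracy `a ε` at `c` gives accuracy `ε` at the successor.
    as-chance : ∀ {σ h c W} → proj₁ c ≢ qF → sumℕ (enabled S c) ≡ suc W →
                (∀ n → prob σ (suc n) h c ≡ mean W (enabled S c) (prob σ n (c ∷ h))) →
                AS σ h c → ∀ {w c′} → (w , c′) ∈ enabled S c → AS σ (c ∷ h) c′
    as-chance {σ} {h} {c} {W} ¬F s eq as {w} {c′} m ε 0<ε = proj₁ result , swap-≤ {1ℚ} {prob σ (proj₁ result) (c ∷ h) c′} {ε} (ℚP.*-cancelˡ-≤-pos a {{ℚ.positive 0<a}} (proj₂ result))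
      where
      a : ℚ
      a = + w / suc W
      0<a : 0ℚ ℚ.< a
      0<a with enabled⁻ S c m
      ... | t , _ , refl , _ = frac-pos (weight-pos t)
      a≤1 : a ℚ.≤ 1ℚ
      a≤1 = subst (a ℚ.≤_) (frac-self W) (frac-≤ {w} {W} {suc W} {W} (ℕP.*-monoˡ-≤ (suc W) (subst (w ℕ.≤_) s (sumℕ-∈ m))))
      result : ∃ λ n → a ℚ.* (1ℚ ℚ.- prob σ n (c ∷ h) c′) ℚ.≤ a ℚ.* ε
      result with as (a ℚ.* ε) (*-pos 0<a 0<ε)
      -- Horizon 0 can only suffice if `a ε` is at least 1; since `a` is at most 1, the bound
      -- `a ≤ a ε` then makes the claim trivial.
      ... | zero , le = 0 , ℚP.≤-trans (*-monoʳ-≤ (ℚP.<⇒≤ 0<a) (swap-≤ (ℚP.≤-trans (ℚP.≤-reflexive (ℚP.+-inverseʳ 1ℚ)) (0≤prob σ 0 (c ∷ h) c′))))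
              (ℚP.≤-trans (ℚP.≤-reflexive (ℚP.*-identityʳ a)) (ℚP.≤-trans a≤1
                (swap-≤ {1ℚ} {a ℚ.* ε} {0ℚ} (ℚP.≤-trans le (ℚP.≤-reflexive (prob-zero σ ¬F))))))
      ... | suc n , le = n , ℚP.≤-trans
              (mean-∈ W {enabled S c} {λ c → 1ℚ ℚ.- prob σ n (_ ∷ h) c} (λ _ → p≤q⇒0≤q-p (prob≤1 σ n _ _)) m)
              (ℚP.≤-trans (ℚP.≤-reflexive (mean-compl W (enabled S c) s (prob σ n (c ∷ h))))
                (swap-≤ {1ℚ} {a ℚ.* ε} {mean W (enabled S c) (prob σ n (c ∷ h))} (subst (_ ℚ.≤_) (eq n) le)))

    Inv : Fin k → V d → Set
    Inv q v = ∃ λ c → proj₁ c ≡ q × val c ≤ⱽ v × Σ (Strategy S) λ σ → ∃ λ h → AS σ h c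

    -- A probabilistic transition has update zero, so it is enabled whatever the counters are. Every
    -- successor that the opponent may fix in the game is therefore an outcome of the random step.
    chance-enabled : Is1VASSMDP S → ∀ c → owner S (proj₁ c) ≡ PP → ∀ {z q′} → (z , q′) ∈ moves (proj₁ c) →
                     ∃₂ λ w c′ → (w , c′) ∈ enabled S c × proj₁ c′ ≡ q′ × Step (val c) z (val c′)
    chance-enabled one c o m with move⁻ m
    ... | t , t∈ , src≡ , refl , refl with fire-complete c t src≡ nonneg
      where
      nonneg : ∀ i → + 0 ℤ.≤ + val c i ℤ.+ lookup (upd t) i
      nonneg i = subst (λ z → + 0 ℤ.≤ + val c i ℤ.+ z)
        (sym (trans (cong (λ z → lookup z i) (one t t∈ (trans (cong (owner S) src≡) o))) (lookup-replicate i (+ 0))))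
        (+≤+ z≤n)
    ... | c′ , e = weight t , c′ , enabled⁺ S c t∈ e , proj₁ (proj₂ (fire-sound c t e)) , proj₂ (fire-move c t∈ e)

    module _ (one : Is1VASSMDP S) where

      -- Induction on a horizon `n` with positive success probability. If the opponent leaves the
      -- choice, some successor has positive probability within `n - 1` steps; if it fixes the
      -- successor, that one is again almost surely winning, which is all a good event asks for.
      progress : ∀ n {σ h c} → AS σ h c → 0ℚ ℚ.< prob σ n h c → Ind game Inv (proj₁ c) (val c)
      progress n {σ} {h} {c} as pos with view σ h c
      progress n as pos | target eq _ = node λ o → ⊥-elim (¬∈[] (subst (_ ∈_) (game-target eq) o))
        where
        ¬∈[] : ∀ {o : Option k d} → ¬ o ∈ []
        ¬∈[] ()
      progress n as pos | dead _ _ eq = ⊥-elim (ℚP.<-irrefl refl (subst (0ℚ ℚ.<_) (eq n) pos))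
      progress zero {σ} as pos | player ¬F _ _ _ = ⊥-elim (ℚP.<-irrefl refl (subst (0ℚ ℚ.<_) (prob-zero σ ¬F) pos))
      progress zero {σ} as pos | chance ¬F _ _ _ _ = ⊥-elim (ℚP.<-irrefl refl (subst (0ℚ ℚ.<_) (prob-zero σ ¬F) pos))
      progress (suc n) {σ} {h} {c} as pos | player ¬F ne o eq = node λ m → play (subst (_ ∈_) (game-turn ¬F o) m)
        where
        next : Ind game Inv (proj₁ (choose σ h c)) (val (choose σ h c))
        next = progress n (as-player {σ} {h} {c} ¬F eq as) (subst (0ℚ ℚ.<_) (eq n) pos)
        play : ∀ {b ms} → (b , ms) ∈ turn P1 (moves (proj₁ c)) → Choice game Inv b ms (val c)
        play (here refl) with valid σ h c o ne
        ... | t , t∈ , e = choice (proj₁ (fire-move c t∈ e)) (proj₂ (fire-move c t∈ e)) (more next)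
      progress (suc n) {σ} {h} {c} as pos | chance ¬F o W s eq = node λ m → play (subst (_ ∈_) (game-turn ¬F o) m)
        where
        as′ : ∀ {w c′} → (w , c′) ∈ enabled S c → AS σ (c ∷ h) c′
        as′ = as-chance {σ} {h} {c} ¬F s eq as
        play : ∀ {b ms} → (b , ms) ∈ turn PP (moves (proj₁ c)) → Choice game Inv b ms (val c)
        play (here refl) with mean-positive W (subst (0ℚ ℚ.<_) (eq n) pos)
        ... | w , c′ , m , pos′ with enabled⁻ S c m
        ... | t , t∈ , _ , e = choice (proj₁ (fire-move c t∈ e)) (proj₂ (fire-move c t∈ e)) (more (progress n (as′ m) pos′))
        play (there m) with ∈-map⁻ (λ m → true , m ∷ []) m
        ... | (z , q′) , m′ , refl with chance-enabled one c o m′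
        ... | w , c′ , c′∈ , q′≡ , st = choice (here refl) st (good (c′ , q′≡ , ≤ⱽ-refl {v = val c′} , σ , c ∷ h , as′ c′∈))

      as⇒ind : ∀ {σ h c} → AS σ h c → Ind game Inv (proj₁ c) (val c)
      as⇒ind {σ} {h} {c} as with as ½ (ℚP.positive⁻¹ ½)
      ... | n , le = progress n as (ℚP.<-≤-trans (ℚP.positive⁻¹ ½) le)

      inv-closed : ∀ {q v} → Inv q v → Ind game Inv q v
      inv-closed (c , refl , c≤v , σ , h , as) = ind-up c≤v (as⇒ind {σ} {h} {c} as)

      necessary : ∀ {c} → ASReach S c qF → Win game (proj₁ c) (val c)
      necessary {c} (σ , as) = record
        { P = Inv ; closed = inv-closed
        ; holds = c , refl , ≤ⱽ-refl {v = val c} , σ , [] , λ ε 0<ε → let n , le = as ε 0<ε in n , subst (_ ℚ.≤_) (sym (prob-def σ n [] c)) le }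

-- From winning strategies to almost-sure reachability

module Sufficiency {k d} (S : VASSMDP k d) (one : Is1VASSMDP S) (qF : Fin k) where
  open Reachability S qF

  -- `Win` quantifies over predicates and is too large to be a parameter of `Ind`; the truth value
  -- of its decision procedure is a small substitute.
  Safe : Fin k → V d → Set
  Safe q v = True (win? game q v)

  safe-closed : ∀ {q v} → Safe q v → Ind game Safe q v
  safe-closed {q} {v} s = ind-map (λ p → fromWitness (record { P = P ; closed = closed ; holds = p })) (closed holds)
    where open Win (toWitness s)

  ind⇒safe : ∀ {q v} → Ind game Safe q v → Safe q v
  ind⇒safe i = fromWitness (ind⇒win safe-closed i)

  safe-up : ∀ {q v w} → v ≤ⱽ w → Safe q v → Safe q w
  safe-up v≤w s = fromWitness (win-up v≤w (toWitness s))

  Legal : V d → Z d → Set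
  Legal v z = ∀ i → + 0 ℤ.≤ + v i ℤ.+ z i

  shift : V d → Z d → V d
  shift v z i = ℤ.∣ + v i ℤ.+ z i ∣

  shift-exact : ∀ {v z} → Legal v z → ∀ i → + shift v z i ≡ + v i ℤ.+ z i
  shift-exact L i = ℤP.0≤i⇒+∣i∣≡i (L i)

  shift-max : ∀ {v z v′} → Step v z v′ → Legal v z × v′ ≤ⱽ shift v z
  shift-max {v} {z} {v′} st = L , λ i → ℤP.drop‿+≤+ (ℤP.≤-trans (st i) (ℤP.≤-reflexive (sym (shift-exact {v} {z} L i))))
    where
    L : Legal v z
    L i = ℤP.≤-trans (+≤+ z≤n) (st i)

  -- Rank n bounds the number of steps to a good event inside Safe; unlike Ind it is decidable.
  Rank : ℕ → Fin k → V d → Set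
  Reach : Bool → ℕ → Fin k → V d → Set
  Move : ℕ → V d → Option k d → Set
  Rank zero    q v = ⊥
  Rank (suc n) q v = All (Move n v) (game q)
  Move n v (b , ms) = Any (λ (z , q′) → Legal v z × Reach b n q′ (shift v z)) ms
  Reach true  n q v = Safe q v
  Reach false n q v = Rank n q v

  rank? : ∀ n q v → Dec (Rank n q v)
  reach? : ∀ b n q v → Dec (Reach b n q v)
  rank? zero    q v = no λ ()
  rank? (suc n) q v = All.all? (λ (b , ms) → Any.any? (λ (z , q′) →
    FinP.all? (λ i → + 0 ℤ.≤? + v i ℤ.+ z i) ×-dec reach? b n q′ (shift v z)) ms) (game q)
  reach? true  n q v = T? _
  reach? false n q v = rank? n q v

  rank-up : ∀ {n n′ q v w} → n ℕ.≤ n′ → v ≤ⱽ w → Rank n q v → Rank n′ q w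
  move-up : ∀ {n n′ v w o} → n ℕ.≤ n′ → v ≤ⱽ w → Move n v o → Move n′ w o
  rank-up {suc n} {suc n′} (s≤s le) v≤w r = All.map (λ {o} → move-up {o = o} le v≤w) r
  move-up {n} {n′} {v} {w} {b , ms} le v≤w = Any.map λ {m} → up m
    where
    up : ∀ m → Legal v (proj₁ m) × Reach b n (proj₂ m) (shift v (proj₁ m)) →
               Legal w (proj₁ m) × Reach b n′ (proj₂ m) (shift w (proj₁ m))
    up (z , q′) (L , r) with shift-max {w} {z} {shift v z}
      (λ i → ℤP.≤-trans (ℤP.≤-reflexive (shift-exact {v} {z} L i)) (ℤP.+-monoˡ-≤ (z i) (+≤+ (v≤w i))))
    ... | L′ , s≤s′ = L′ , reach-up b r
      where
      reach-up : ∀ b → Reach b n q′ (shift v z) → Reach b n′ q′ (shift w z)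
      reach-up true  = safe-up s≤s′
      reach-up false = rank-up le s≤s′

  ind⇒rank : ∀ {q v} → Ind game Safe q v → ∃ λ n → Rank n q v
  choice⇒move : ∀ {b ms v} → Choice game Safe b ms v → ∃ λ n → Move n v (b , ms)
  ind⇒rank {q} {v} (node f) = let n , a = every (game q) (λ m → choice⇒move (f m)) in suc n , a
    where
    every : ∀ os → (∀ {b ms} → (b , ms) ∈ os → ∃ λ n → Move n v (b , ms)) → ∃ λ n → All (Move n v) os
    every []       f = 0 , []
    every (o ∷ os) f with f (here refl) | every os (λ m → f (there m))
    ... | n , p | n′ , ps = n ℕ.+ n′ , move-up {o = o} (ℕP.m≤m+n n n′) (≤ⱽ-refl {v = v}) p ∷
      All.map (λ {o} → move-up {o = o} (ℕP.m≤n+m n′ n) (≤ⱽ-refl {v = v})) ps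
  choice⇒move {v = v} (choice {z} m st (good p)) = 0 , lose m (proj₁ (shift-max {v} {z} st) , safe-up (proj₂ (shift-max {v} {z} st)) p)
  choice⇒move {v = v} (choice {z} m st (more i)) with ind⇒rank i
  ... | n , r = n , lose m (proj₁ (shift-max {v} {z} st) , rank-up ℕP.≤-refl (proj₂ (shift-max {v} {z} st)) r)

  rank⇒ind : ∀ n {q v} → Rank n q v → Ind game Safe q v
  rank⇒ind (suc n) {q} {v} r = node λ m → play (All.lookup r m)
    where
    play : ∀ {b ms} → Move n v (b , ms) → Choice game Safe b ms v
    play {b} a with find a
    ... | (z , q′) , m , L , p = choice m (λ i → ℤP.≤-reflexive (shift-exact {v} {z} L i)) (next b p)
      where
      next : ∀ b → Reach b n q′ (shift v z) → Next game Safe b q′ (shift v z)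
      next true  p = good p
      next false p = more (rank⇒ind n p)

  abstract
    rank-bound : ∃ λ N → ∀ q v → Safe q v → Rank N q v
    rank-bound = maximum {Q = λ q N → ∀ v → Safe q v → Rank N q v}
      (λ q le f v s → rank-up le (≤ⱽ-refl {v = v}) (f v s))
      (λ q → uniform rank-up (meets? q) (λ s → ind⇒rank (safe-closed s)))
      where
      meets? : ∀ q m v → Dec (∃ λ u → u ≤[ m ] v × Safe q u)
      meets? q m v = map′ (λ (w , w≤ , W) → w , w≤ , fromWitness W) (λ (w , w≤ , s) → w , w≤ , toWitness s) (winsWithin? game m q v)

  N : ℕ
  N = proj₁ rank-bound

  Safeᶜ : Config k d → Set
  Safeᶜ c = Safe (proj₁ c) (val c)

  Rankᶜ : ℕ → ℕ × Config k d → Set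
  Rankᶜ n (_ , c) = Rank n (proj₁ c) (val c)

  safe⇒rank : ∀ {c} → Safeᶜ c → Rank N (proj₁ c) (val c)
  safe⇒rank {c} s = proj₂ rank-bound (proj₁ c) (val c) s

  rank⇒safe : ∀ n {c} → Rank n (proj₁ c) (val c) → Safeᶜ c
  rank⇒safe n {c} r = ind⇒safe (rank⇒ind n r)

  realise : ∀ c {z q′} → (z , q′) ∈ moves (proj₁ c) → Legal (val c) z →
            ∃₂ λ w c′ → (w , c′) ∈ enabled S c × proj₁ c′ ≡ q′ × shift (val c) z ≤ⱽ val c′
  realise c m L with move⁻ m
  ... | t , t∈ , src≡ , refl , refl with fire-complete c t src≡ L
  ... | c′ , e with fire-sound c t e
  ... | _ , q′≡ , exact = weight t , c′ , enabled⁺ S c t∈ e , q′≡ ,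
    λ i → ℤP.drop‿+≤+ (ℤP.≤-reflexive (trans (shift-exact {val c} {lookup (upd t)} L i) (sym (exact i))))

  follow : ∀ n c → Move n (val c) (false , moves (proj₁ c)) → Any (Rankᶜ n) (enabled S c)
  follow n c a with find a
  ... | (z , q′) , m , L , r with realise c m L
  ... | w , c′ , c′∈ , refl , le = lose c′∈ (rank-up ℕP.≤-refl le r)

  rank-next : ∀ n {c} → proj₁ c ≢ qF → Rank (suc n) (proj₁ c) (val c) → Any (Rankᶜ n) (enabled S c)
  rank-next n {c} ¬F r with owner S (proj₁ c) in o
  ... | P1 = follow n c (All.lookup r (subst ((false , moves (proj₁ c)) ∈_) (sym (game-turn ¬F o)) (here refl)))
  ... | PP = follow n c (All.lookup r (subst ((false , moves (proj₁ c)) ∈_) (sym (game-turn ¬F o)) (here refl)))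

  -- Each outcome is the only move of one good option, and a good option can only be answered by a
  -- move into `Safe`.
  rank-all : ∀ n {c} → proj₁ c ≢ qF → owner S (proj₁ c) ≡ PP → Rank (suc n) (proj₁ c) (val c) →
             ∀ {w c′} → (w , c′) ∈ enabled S c → Safeᶜ c′
  rank-all n {c} ¬F o r {w} {c′} c′∈ with enabled⁻ S c c′∈
  ... | t , t∈ , _ , e with fire-move c t∈ e | fire-sound c t e
  ... | m , st | _ , _ , exact with All.lookup r (subst ((true , (lookup (upd t) , proj₁ c′) ∷ []) ∈_) (sym (game-turn ¬F o)) (there (∈-map⁺ (λ m → true , m ∷ []) m)))
  ... | here (L , s) = safe-up (λ i → ℤP.drop‿+≤+ (ℤP.≤-reflexive
          (trans (shift-exact {val c} {lookup (upd t)} L i) (sym (exact i))))) s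

  first : Config k d → List (ℕ × Config k d) → Config k d
  first c []             = c
  first _ ((_ , c′) ∷ _) = c′

  -- Moves to an enabled configuration of least rank.
  search : ℕ → ℕ → Config k d → Config k d
  search fuel i c with Any.any? (λ (_ , c′) → rank? i (proj₁ c′) (val c′)) (enabled S c)
  search fuel       i c | yes a = proj₂ (proj₁ (find a))
  search zero       i c | no _  = first c (enabled S c)
  search (suc fuel) i c | no _  = search fuel (suc i) c

  search-∈ : ∀ fuel i c → ¬ enabled S c ≡ [] → ∃ λ w → (w , search fuel i c) ∈ enabled S c
  search-∈ fuel i c ne with Any.any? (λ (_ , c′) → rank? i (proj₁ c′) (val c′)) (enabled S c)
  search-∈ fuel       i c ne | yes a = _ , proj₁ (proj₂ (find a))
  search-∈ zero       i c ne | no _  = first-∈ (enabled S c) ne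
    where
    first-∈ : ∀ es → ¬ es ≡ [] → ∃ λ w → (w , first c es) ∈ es
    first-∈ []            ne = ⊥-elim (ne refl)
    first-∈ ((w , _) ∷ _) ne = w , here refl
  search-∈ (suc fuel) i c ne | no _  = search-∈ fuel (suc i) c ne

  search-rank : ∀ fuel i j {c} → j ℕ.≤ fuel → Any (Rankᶜ (i ℕ.+ j)) (enabled S c) → Rankᶜ (i ℕ.+ j) (0 , search fuel i c)
  search-rank fuel i j {c} le a with Any.any? (λ (_ , c′) → rank? i (proj₁ c′) (val c′)) (enabled S c)
  search-rank fuel i j {c} le a | yes b = rank-up (ℕP.m≤m+n i j) (λ _ → ℕP.≤-refl) (proj₂ (proj₂ (find b)))
  search-rank fuel i zero {c} le a | no ¬b = ⊥-elim (¬b (subst (λ n → Any (Rankᶜ n) (enabled S c)) (ℕP.+-identityʳ i) a))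
  search-rank (suc fuel) i (suc j) {c} (s≤s le) a | no _ =
    subst (λ n → Rankᶜ n (0 , search fuel (suc i) c)) (sym (ℕP.+-suc i j))
      (search-rank fuel (suc i) j le (subst (λ n → Any (Rankᶜ n) (enabled S c)) (ℕP.+-suc i j) a))

  strategy : Strategy S
  strategy = record
    { choose = λ _ c → search N 0 c
    ; valid  = λ _ c _ ne → let _ , m = search-∈ N 0 c ne ; t , t∈ , _ , e = enabled⁻ S c m in t , t∈ , e }

  open Prob strategy

  -- A lower bound for the probability of any single outcome: its weight is at least 1, and the
  -- enabled weights sum to at most `total-weight S`. The successor keeps the denominator positive.
  δ : ℚ
  δ = + 1 / suc (total-weight S)

  δ^_ : ℕ → ℚ
  δ^ zero  = 1ℚ
  δ^ suc n = δ ℚ.* δ^ n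

  0<δ : 0ℚ ℚ.< δ
  0<δ = frac-pos {1} {total-weight S} (s≤s z≤n)

  δ≤1 : δ ℚ.≤ 1ℚ
  δ≤1 = subst (δ ℚ.≤_) (frac-self (total-weight S)) (frac-≤ {1} {total-weight S} {suc (total-weight S)} {total-weight S} (ℕP.*-monoˡ-≤ (suc (total-weight S)) {1} {suc (total-weight S)} (s≤s z≤n)))

  0<δ^ : ∀ n → 0ℚ ℚ.< δ^ n
  0<δ^ zero    = ℚP.positive⁻¹ 1ℚ
  0<δ^ (suc n) = *-pos 0<δ (0<δ^ n)

  δ^≤1 : ∀ n → δ^ n ℚ.≤ 1ℚ
  δ^≤1 zero    = ℚP.≤-refl
  δ^≤1 (suc n) = ℚP.≤-trans (*-monoʳ-≤ (ℚP.<⇒≤ 0<δ) (δ^≤1 n)) (ℚP.≤-trans (ℚP.≤-reflexive (ℚP.*-identityʳ δ)) δ≤1)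

  δ≤α : ∀ {c W} → sumℕ (enabled S c) ≡ suc W → ∀ {w c′} → (w , c′) ∈ enabled S c → δ ℚ.≤ + w / suc W
  δ≤α {c} {W} s {w} m with enabled⁻ S c m
  ... | t , _ , refl , _ = frac-≤ {1} {total-weight S} {w} {W} (ℕP.≤-trans (ℕP.≤-reflexive (ℕP.*-identityˡ (suc W)))
    (ℕP.≤-trans (subst (ℕ._≤ suc (total-weight S)) s (ℕP.m≤n⇒m≤1+n (sumℕ-enabled S c)))
      (ℕP.≤-trans (ℕP.≤-reflexive (sym (ℕP.*-identityˡ (suc (total-weight S))))) (ℕP.*-monoˡ-≤ (suc (total-weight S)) (weight-pos t)))))

  ¬any[] : ∀ {A : Set} {P : A → Set} {xs} → xs ≡ [] → ¬ Any P xs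
  ¬any[] refl ()

  choice-rank : ∀ n {h c} → n ℕ.≤ N → proj₁ c ≢ qF → Rank (suc n) (proj₁ c) (val c) → Rankᶜ n (0 , choose strategy h c)
  choice-rank n {h} {c} le ¬F r = search-rank N 0 n {c} le (rank-next n {c} ¬F r)

  -- Only the target has no options, so a chain of strictly decreasing ranks can end nowhere else.
  -- The strategy lowers the rank at states of Player 1, and at probabilistic states some outcome
  -- lowers it, with probability at least `δ`.
  path : ∀ n {h c} → n ℕ.≤ N → Rank n (proj₁ c) (val c) → δ^ n ℚ.≤ prob n h c
  path (suc n) {h} {c} le r with view h c
  ... | target _ eq = ℚP.≤-trans (δ^≤1 (suc n)) (ℚP.≤-reflexive (sym (eq (suc n))))
  ... | dead ¬F eq _ = ⊥-elim (¬any[] eq (rank-next n {c} ¬F r))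
  ... | player ¬F _ _ eq = ℚP.≤-trans (*-monoˡ-≤ (ℚP.<⇒≤ (0<δ^ n)) δ≤1) (ℚP.≤-trans (ℚP.≤-reflexive (ℚP.*-identityˡ (δ^ n)))
      (ℚP.≤-trans (path n (ℕP.<⇒≤ le) (choice-rank n {h} {c} (ℕP.<⇒≤ le) ¬F r)) (ℚP.≤-reflexive (sym (eq n)))))
  ... | chance ¬F _ W s eq with find (rank-next n {c} ¬F r)
  ... | (w , c′) , m , r′ = ℚP.≤-trans (*-monoˡ-≤ (ℚP.<⇒≤ (0<δ^ n)) (δ≤α {c} s m))
      (ℚP.≤-trans (*-monoʳ-≤ (frac-nonneg w W) (path n (ℕP.<⇒≤ le) r′))
      (ℚP.≤-trans (mean-∈ W {enabled S c} {prob n (c ∷ h)} (λ {_} {c′} _ → 0≤prob n (c ∷ h) c′) m) (ℚP.≤-reflexive (sym (eq n)))))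

  safe-suc : ∀ {c} → Safeᶜ c → ∃ λ n → n ℕ.≤ N × Rank (suc n) (proj₁ c) (val c)
  safe-suc {c} s with N | ℕP.≤-refl {N} | safe⇒rank {c} s
  ... | suc n | le | r = n , ℕP.n≤1+n n , r

  affine-zero : ∀ {h c} → proj₁ c ≢ qF → ∀ L → L ℚ.+ (1ℚ ℚ.- L) ℚ.* prob 0 h c ≡ L
  affine-zero ¬F L = trans (cong (λ p → L ℚ.+ (1ℚ ℚ.- L) ℚ.* p) (prob-zero ¬F)) (trans (cong (L ℚ.+_) (ℚP.*-zeroʳ (1ℚ ℚ.- L))) (ℚP.+-identityʳ L))

  -- After n steps the strategy may be restarted, since it never leaves Safe.
  restart : ∀ m L → (∀ h {c} → Safeᶜ c → L ℚ.≤ prob m h c) →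
            ∀ n h {c} → Safeᶜ c → L ℚ.+ (1ℚ ℚ.- L) ℚ.* prob n h c ℚ.≤ prob (n ℕ.+ m) h c
  restart m L base n h {c} s with view h c
  restart m L base n h {c} s | target _ eq = ℚP.≤-reflexive (trans (cong (λ p → L ℚ.+ (1ℚ ℚ.- L) ℚ.* p) (eq n)) (trans (ring L) (sym (eq (n ℕ.+ m)))))
    where
    open +-*-Solver
    ring : ∀ L → L ℚ.+ (1ℚ ℚ.- L) ℚ.* 1ℚ ≡ 1ℚ
    ring = solve 1 (λ L → L :+ (con 1ℚ :- L) :* con 1ℚ := con 1ℚ) refl
  restart m L base n h {c} s | dead ¬F eq _ = let n , _ , r = safe-suc {c} s in ⊥-elim (¬any[] eq (rank-next n {c} ¬F r))
  restart m L base zero h {c} s | player ¬F _ _ _ = ℚP.≤-trans (ℚP.≤-reflexive (affine-zero ¬F L)) (base h s)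
  restart m L base zero h {c} s | chance ¬F _ _ _ _ = ℚP.≤-trans (ℚP.≤-reflexive (affine-zero ¬F L)) (base h s)
  restart m L base (suc n) h {c} s | player ¬F _ _ eq =
    subst (λ p → L ℚ.+ (1ℚ ℚ.- L) ℚ.* p ℚ.≤ prob (suc n ℕ.+ m) h c) (sym (eq n))
      (subst (_ ℚ.≤_) (sym (eq (n ℕ.+ m))) (restart m L base n (c ∷ h) (safe-next (safe-suc {c} s))))
    where
    safe-next : (∃ λ n → n ℕ.≤ N × Rank (suc n) (proj₁ c) (val c)) → Safeᶜ (choose strategy h c)
    safe-next (n , le , r) = rank⇒safe n {choose strategy h c} (choice-rank n {h} {c} le ¬F r)
  restart m L base (suc n) h {c} s | chance ¬F o W sum≡ eq =
    subst (λ p → L ℚ.+ (1ℚ ℚ.- L) ℚ.* p ℚ.≤ prob (suc n ℕ.+ m) h c) (sym (eq n))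
      (subst (_ ℚ.≤_) (sym (eq (n ℕ.+ m)))
        (subst (ℚ._≤ mean W (enabled S c) (prob (n ℕ.+ m) (c ∷ h))) (mean-affine′ W (enabled S c) sum≡ L (1ℚ ℚ.- L) (prob n (c ∷ h)))
          (mean-mono W {enabled S c} {λ c′ → L ℚ.+ (1ℚ ℚ.- L) ℚ.* prob n (c ∷ h) c′} {prob (n ℕ.+ m) (c ∷ h)}
            (λ {w} {c′} m∈ → restart m L base n (c ∷ h) (safe-next (safe-suc {c} s) m∈)))))
    where
    safe-next : (∃ λ n → n ℕ.≤ N × Rank (suc n) (proj₁ c) (val c)) → ∀ {w c′} → (w , c′) ∈ enabled S c → Safeᶜ c′
    safe-next (n , _ , r) = rank-all n {c} ¬F o r

  -- A round of N steps adds at least ε δᴺ to a success probability below 1 - ε.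
  rounds : ∀ ε → 0ℚ ℚ.< ε → ∀ j →
           (∀ h {c} → Safeᶜ c → 1ℚ ℚ.- ε ℚ.≤ prob (j ℕ.* N) h c) ⊎
           (∀ h {c} → Safeᶜ c → (+ j / 1) ℚ.* (ε ℚ.* δ^ N) ℚ.≤ prob (j ℕ.* N) h c)
  rounds ε 0<ε zero = inj₂ λ h {c} s → ℚP.≤-trans (ℚP.≤-reflexive (ℚP.*-zeroˡ (ε ℚ.* δ^ N))) (0≤prob 0 h c)
  rounds ε 0<ε (suc j) = next (rounds ε 0<ε j)
    where
    η : ℚ
    η = ε ℚ.* δ^ N

    1-[1-ε]≡ε : 1ℚ ℚ.- (1ℚ ℚ.- ε) ≡ ε
    1-[1-ε]≡ε = solve 1 (λ ε → con 1ℚ :- (con 1ℚ :- ε) := ε) refl ε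
      where open +-*-Solver

    keep : (∀ h {c} → Safeᶜ c → 1ℚ ℚ.- ε ℚ.≤ prob (j ℕ.* N) h c) → ∀ h {c} → Safeᶜ c → 1ℚ ℚ.- ε ℚ.≤ prob (suc j ℕ.* N) h c
    keep f h {c} s = ℚP.≤-trans
      (subst (ℚ._≤ (1ℚ ℚ.- ε) ℚ.+ (1ℚ ℚ.- (1ℚ ℚ.- ε)) ℚ.* prob N h c) (ℚP.+-identityʳ (1ℚ ℚ.- ε))
        (ℚP.+-monoʳ-≤ (1ℚ ℚ.- ε) (*-nonneg (ℚP.≤-trans (ℚP.<⇒≤ 0<ε) (ℚP.≤-reflexive (sym 1-[1-ε]≡ε))) (0≤prob N h c))))
      (restart (j ℕ.* N) (1ℚ ℚ.- ε) f N h s)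

    next : (∀ h {c} → Safeᶜ c → 1ℚ ℚ.- ε ℚ.≤ prob (j ℕ.* N) h c) ⊎ (∀ h {c} → Safeᶜ c → (+ j / 1) ℚ.* η ℚ.≤ prob (j ℕ.* N) h c) →
           (∀ h {c} → Safeᶜ c → 1ℚ ℚ.- ε ℚ.≤ prob (suc j ℕ.* N) h c) ⊎ (∀ h {c} → Safeᶜ c → (+ suc j / 1) ℚ.* η ℚ.≤ prob (suc j ℕ.* N) h c)
    next (inj₁ f) = inj₁ (keep f)
    next (inj₂ f) with 1ℚ ℚ.- ε ℚ.≤? (+ j / 1) ℚ.* η
    ... | yes le = inj₁ (keep (λ h s → ℚP.≤-trans le (f h s)))
    ... | no ¬le = inj₂ λ h {c} s → ℚP.≤-trans (ℚP.≤-reflexive one-more)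
        (ℚP.≤-trans (ℚP.+-monoʳ-≤ L (ℚP.≤-trans (*-monoˡ-≤ (ℚP.<⇒≤ (0<δ^ N)) ε≤1-L)
                                               (*-monoʳ-≤ (ℚP.≤-trans (ℚP.<⇒≤ 0<ε) ε≤1-L) (path N ℕP.≤-refl (safe⇒rank {c} s)))))
                    (restart (j ℕ.* N) L f N h s))
      where
      L : ℚ
      L = (+ j / 1) ℚ.* η
      ε≤1-L : ε ℚ.≤ 1ℚ ℚ.- L
      ε≤1-L = subst (ℚ._≤ 1ℚ ℚ.- L) 1-[1-ε]≡ε (ℚP.+-monoʳ-≤ 1ℚ (ℚP.neg-antimono-≤ (ℚP.<⇒≤ (ℚP.≰⇒> ¬le))))
      one-more : (+ suc j / 1) ℚ.* η ≡ L ℚ.+ η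
      one-more = trans (cong (ℚ._* η) (sym (frac-+ 1 j 0))) (trans (ℚP.*-distribʳ-+ η (+ 1 / 1) (+ j / 1))
        (trans (ℚP.+-comm ((+ 1 / 1) ℚ.* η) L) (cong (L ℚ.+_) (ℚP.*-identityˡ η))))

  sufficient : ∀ {c} → Win game (proj₁ c) (val c) → ASReach S c qF
  -- With this many rounds the second alternative of `rounds` means probability at least 1, so both
  -- alternatives give `1 - ε`.
  sufficient {c} W = strategy , λ ε 0<ε → almost-sure ε 0<ε (archimedean (*-pos 0<ε (0<δ^ N)))
    where
    almost-sure : ∀ ε → 0ℚ ℚ.< ε → (∃ λ j → 1ℚ ℚ.≤ (+ j / 1) ℚ.* (ε ℚ.* δ^ N)) → ∃ λ n → 1ℚ ℚ.- ε ℚ.≤ reachProb S strategy qF n [] c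
    almost-sure ε 0<ε (j , 1≤) = j ℕ.* N , subst (1ℚ ℚ.- ε ℚ.≤_) (prob-def (j ℕ.* N) [] c) (bound (rounds ε 0<ε j))
      where
      bound : (∀ h {c} → Safeᶜ c → 1ℚ ℚ.- ε ℚ.≤ prob (j ℕ.* N) h c) ⊎ (∀ h {c} → Safeᶜ c → (+ j / 1) ℚ.* (ε ℚ.* δ^ N) ℚ.≤ prob (j ℕ.* N) h c) →
              1ℚ ℚ.- ε ℚ.≤ prob (j ℕ.* N) [] c
      bound (inj₁ f) = f [] (fromWitness W)
      bound (inj₂ f) = ℚP.≤-trans (swap-≤ {1ℚ} {1ℚ} {ε} (ℚP.<⇒≤ 0<ε)) (ℚP.≤-trans 1≤ (f [] (fromWitness W)))

theorem7 : (k d : ℕ) (S : VASSMDP k d) → Is1VASSMDP S →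
    (c₀ : Config k d) (qF : Fin k) → Dec (ASReach S c₀ qF)
theorem7 k d S one c₀ qF =
  map′ (Sufficiency.sufficient S one qF) (Reachability.Necessity.necessary S qF one)
       (win? (Reachability.game S qF) (proj₁ c₀) (lookup (proj₂ c₀)))
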